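{- Let $k\in\{5,9,10,11\}$ or $k\geq 13$. Then there exists a $4$-polytope with exactly $k$ vertices which is $2$-simple, $2$-simplicial and elementary.
   Context: For a $4$-polytope $P$, $f_i$ denotes the number of $i$-dimensional faces and $f_{02}$ the number of pairs (vertex $v$, $2$-face $F$) with $v\in F$. A polytope is $2$-simplicial if all its $2$-dimensional faces are triangles; a $4$-polytope is $2$-simple if every edge is contained in exactly $3$ facets (equivalently, its polar is $2$-simplicial). For a $d$-polytope, $g_2(P)=f_{02}-3f_2+f_1-d f_0+\binom{d+1}{2}$; for $d=4$ this is $f_{02}-3f_2+f_1-4f_0+10$. A polytope is elementary if $g_2(P)=0$. -}

module Defs where

open import Data.Fin.Base using (Fin)
open import Data.Integer.Base as ℤ using (ℤ; +_)
open import Data.Nat.Base as ℕ using (ℕ; suc; _⊔_)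
open import Data.Nat.Combinatorics using (_C_)
import Data.Nat.Properties as ℕₚ
open import Data.Product.Base using (Σ-syntax; ∃-syntax; _×_; _,_; proj₁; proj₂)
open import Data.Rational.Base as ℚ using (ℚ; 0ℚ; 1ℚ; ½; ∣_∣; 1/_)
import Data.Rational.Properties as ℚₚ
import Data.Rational.Solver as ℚ-Solver
open import Data.Product.Relation.Binary.Pointwise.NonDependent using (×-setoid)
open import Data.Sum.Base using (_⊎_)
open import Data.Vec.Functional using (Vector; foldr)
open import Function.Bundles using (Bijection)
open import Level using (0ℓ)
open import Relation.Binary.Bundles using (Setoid)
import Relation.Binary.Construct.On as On
open import Relation.Binary.PropositionalEquality using (_≡_; refl; sym; cong; cong₂; subst; setoid)
open import Relation.Unary using (Pred; _∈_; _⊆′_; _≐′_)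
open import Relation.Unary.Relation.Binary.Equality using (≐′-setoid)

-- Real numbers: Cauchy sequences of rationals with termwise arithmetic.
-- Two sequences denote the same real when they are related by _≈_.

IsCauchy : (ℕ → ℚ) → Set
IsCauchy s = ∀ ε → 0ℚ ℚ.< ε →
  ∃[ N ] (∀ m n → N ℕ.≤ m → N ℕ.≤ n → ∣ s m ℚ.- s n ∣ ℚ.< ε)

record ℝ : Set where
  constructor mkℝ
  field
    seq    : ℕ → ℚ
    cauchy : IsCauchy seq

open ℝ public

fromℚ : ℚ → ℝ
fromℚ q = mkℝ (λ _ → q) λ ε ε>0 → 0 , λ _ _ _ _ →
  subst (ℚ._< ε) (sym (cong ∣_∣ (ℚₚ.+-inverseʳ q))) ε>0

0ℝ 1ℝ : ℝ
0ℝ = fromℚ 0ℚ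
1ℝ = fromℚ 1ℚ

private

  halves : ∀ ε → ½ ℚ.* ε ℚ.+ ½ ℚ.* ε ≡ ε
  halves = solve 1 (λ ε → con ½ :* ε :+ con ½ :* ε := ε) refl
    where open ℚ-Solver.+-*-Solver

  half>0 : ∀ ε → 0ℚ ℚ.< ε → 0ℚ ℚ.< ½ ℚ.* ε
  half>0 ε ε>0 = subst (ℚ._< ½ ℚ.* ε) (ℚₚ.*-zeroʳ ½) (ℚₚ.*-monoʳ-<-pos ½ {0ℚ} {ε} ε>0)

  +-split : ∀ a b c d → (a ℚ.+ b) ℚ.- (c ℚ.+ d) ≡ (a ℚ.- c) ℚ.+ (b ℚ.- d)
  +-split = solve 4 (λ a b c d → (a :+ b) :- (c :+ d) := (a :- c) :+ (b :- d)) refl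
    where open ℚ-Solver.+-*-Solver

  *-split : ∀ a b c d → a ℚ.* b ℚ.- c ℚ.* d ≡ a ℚ.* (b ℚ.- d) ℚ.+ d ℚ.* (a ℚ.- c)
  *-split = solve 4 (λ a b c d → a :* b :- c :* d := a :* (b :- d) :+ d :* (a :- c)) refl
    where open ℚ-Solver.+-*-Solver

  +-cauchy′ : ∀ s t → IsCauchy s → IsCauchy t → IsCauchy (λ n → s n ℚ.+ t n)
  +-cauchy′ s t cs ct ε ε>0 = M ⊔ N , λ m n p q → begin-strict
    ∣ (s m ℚ.+ t m) ℚ.- (s n ℚ.+ t n) ∣     ≡⟨ cong ∣_∣ (+-split (s m) (t m) (s n) (t n)) ⟩
    ∣ (s m ℚ.- s n) ℚ.+ (t m ℚ.- t n) ∣     ≤⟨ ℚₚ.∣p+q∣≤∣p∣+∣q∣ (s m ℚ.- s n) (t m ℚ.- t n) ⟩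
    ∣ s m ℚ.- s n ∣ ℚ.+ ∣ t m ℚ.- t n ∣     <⟨ ℚₚ.+-mono-<
      (proj₂ S m n (ℕₚ.m⊔n≤o⇒m≤o M N p) (ℕₚ.m⊔n≤o⇒m≤o M N q))
      (proj₂ T m n (ℕₚ.m⊔n≤o⇒n≤o M N p) (ℕₚ.m⊔n≤o⇒n≤o M N q)) ⟩
    ½ ℚ.* ε ℚ.+ ½ ℚ.* ε                     ≡⟨ halves ε ⟩
    ε                                       ∎
    where
    open ℚₚ.≤-Reasoning
    S = cs (½ ℚ.* ε) (half>0 ε ε>0)
    T = ct (½ ℚ.* ε) (half>0 ε ε>0)
    M = proj₁ S
    N = proj₁ T

  cauchy-bounded : ∀ s → IsCauchy s →
    ∃[ B ] (ℚ.Positive B × ∃[ N ] (∀ n → N ℕ.≤ n → ∣ s n ∣ ℚ.≤ B))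
  cauchy-bounded s cs = 1ℚ ℚ.+ ∣ s N ∣
              , ℚₚ.pos+nonNeg⇒pos 1ℚ ∣ s N ∣ {{ℚₚ.∣-∣-nonNeg (s N)}}
              , N , λ n p → begin
    ∣ s n ∣                          ≡⟨ cong ∣_∣ (restore (s n) (s N)) ⟩
    ∣ (s n ℚ.- s N) ℚ.+ s N ∣        ≤⟨ ℚₚ.∣p+q∣≤∣p∣+∣q∣ (s n ℚ.- s N) (s N) ⟩
    ∣ s n ℚ.- s N ∣ ℚ.+ ∣ s N ∣      ≤⟨ ℚₚ.+-monoˡ-≤ ∣ s N ∣ (ℚₚ.<⇒≤ (proj₂ S n N p ℕₚ.≤-refl)) ⟩
    1ℚ ℚ.+ ∣ s N ∣                   ∎
    where
    open ℚₚ.≤-Reasoning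
    S = cs 1ℚ (ℚₚ.positive⁻¹ 1ℚ)
    N = proj₁ S
    restore : ∀ a b → a ≡ (a ℚ.- b) ℚ.+ b
    restore = solve 2 (λ a b → a := (a :- b) :+ b) refl
      where open ℚ-Solver.+-*-Solver

  -- Differences of s become smaller than ε even after multiplication by B.
  scaled : ∀ s → IsCauchy s → ∀ B → ℚ.Positive B → ∀ ε → 0ℚ ℚ.< ε →
    ∃[ N ] (∀ m n → N ℕ.≤ m → N ℕ.≤ n → B ℚ.* ∣ s m ℚ.- s n ∣ ℚ.< ε)
  scaled s cs B B>0 ε ε>0 = N , λ m n p q → begin-strict
    B ℚ.* ∣ s m ℚ.- s n ∣    <⟨ ℚₚ.*-monoʳ-<-pos B (h m n p q) ⟩
    B ℚ.* (B⁻¹ ℚ.* ε)        ≡⟨ ℚₚ.*-assoc B B⁻¹ ε ⟨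
    (B ℚ.* B⁻¹) ℚ.* ε        ≡⟨ cong (ℚ._* ε) (ℚₚ.*-inverseʳ B) ⟩
    1ℚ ℚ.* ε                 ≡⟨ ℚₚ.*-identityˡ ε ⟩
    ε                        ∎
    where
    open ℚₚ.≤-Reasoning
    instance
      _ = B>0
      _ = ℚₚ.pos⇒nonZero B
    B⁻¹ = 1/ B
    δ>0 : 0ℚ ℚ.< B⁻¹ ℚ.* ε
    δ>0 = ℚₚ.positive⁻¹ (B⁻¹ ℚ.* ε)
      {{ℚₚ.pos*pos⇒pos B⁻¹ {{ℚₚ.1/pos⇒pos B}} ε {{ℚ.positive ε>0}}}}
    N = proj₁ (cs (B⁻¹ ℚ.* ε) δ>0)
    h = proj₂ (cs (B⁻¹ ℚ.* ε) δ>0)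

  *-cauchy′ : ∀ s t → IsCauchy s → IsCauchy t → IsCauchy (λ n → s n ℚ.* t n)
  *-cauchy′ s t cs ct = product (cauchy-bounded s cs) (cauchy-bounded t ct)
    where
    open ℚₚ.≤-Reasoning

    product : ∃[ B ] (ℚ.Positive B × ∃[ N ] (∀ n → N ℕ.≤ n → ∣ s n ∣ ℚ.≤ B)) →
              ∃[ D ] (ℚ.Positive D × ∃[ N ] (∀ n → N ℕ.≤ n → ∣ t n ∣ ℚ.≤ D)) →
              IsCauchy (λ n → s n ℚ.* t n)
    product (B , B>0 , K , s≤B) (D , D>0 , L , t≤D) ε ε>0 = (K ⊔ L) ⊔ (M ⊔ N) , close
      where
      T = scaled t ct B B>0 (½ ℚ.* ε) (half>0 ε ε>0)
      S = scaled s cs D D>0 (½ ℚ.* ε) (half>0 ε ε>0)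
      M = proj₁ T
      N = proj₁ S

      close : ∀ m n → (K ⊔ L) ⊔ (M ⊔ N) ℕ.≤ m → (K ⊔ L) ⊔ (M ⊔ N) ℕ.≤ n →
              ∣ s m ℚ.* t m ℚ.- s n ℚ.* t n ∣ ℚ.< ε
      close m n p q = begin-strict
        ∣ s m ℚ.* t m ℚ.- s n ℚ.* t n ∣           ≡⟨ cong ∣_∣ (*-split (s m) (t m) (s n) (t n)) ⟩
        ∣ s m ℚ.* v ℚ.+ t n ℚ.* u ∣               ≤⟨ ℚₚ.∣p+q∣≤∣p∣+∣q∣ (s m ℚ.* v) (t n ℚ.* u) ⟩
        ∣ s m ℚ.* v ∣ ℚ.+ ∣ t n ℚ.* u ∣           ≡⟨ cong₂ ℚ._+_ (ℚₚ.∣p*q∣≡∣p∣*∣q∣ (s m) v) (ℚₚ.∣p*q∣≡∣p∣*∣q∣ (t n) u) ⟩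
        ∣ s m ∣ ℚ.* ∣ v ∣ ℚ.+ ∣ t n ∣ ℚ.* ∣ u ∣   ≤⟨ ℚₚ.+-mono-≤
          (ℚₚ.*-monoʳ-≤-nonNeg ∣ v ∣ {{ℚₚ.∣-∣-nonNeg v}} (s≤B m K≤m))
          (ℚₚ.*-monoʳ-≤-nonNeg ∣ u ∣ {{ℚₚ.∣-∣-nonNeg u}} (t≤D n L≤n)) ⟩
        B ℚ.* ∣ v ∣ ℚ.+ D ℚ.* ∣ u ∣               <⟨ ℚₚ.+-mono-<
          (proj₂ T m n (ℕₚ.m⊔n≤o⇒m≤o M N p₂) (ℕₚ.m⊔n≤o⇒m≤o M N q₂))
          (proj₂ S m n (ℕₚ.m⊔n≤o⇒n≤o M N p₂) (ℕₚ.m⊔n≤o⇒n≤o M N q₂)) ⟩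
        ½ ℚ.* ε ℚ.+ ½ ℚ.* ε                       ≡⟨ halves ε ⟩
        ε                                         ∎
        where
        u = s m ℚ.- s n
        v = t m ℚ.- t n
        p₂ = ℕₚ.m⊔n≤o⇒n≤o (K ⊔ L) (M ⊔ N) p
        q₂ = ℕₚ.m⊔n≤o⇒n≤o (K ⊔ L) (M ⊔ N) q
        K≤m = ℕₚ.m⊔n≤o⇒m≤o K L (ℕₚ.m⊔n≤o⇒m≤o (K ⊔ L) (M ⊔ N) p)
        L≤n = ℕₚ.m⊔n≤o⇒n≤o K L (ℕₚ.m⊔n≤o⇒m≤o (K ⊔ L) (M ⊔ N) q)

  -- Sealed so that comparing reals never unfolds Cauchy moduli.
  abstract
    +-cauchy : ∀ s t → IsCauchy s → IsCauchy t → IsCauchy (λ n → s n ℚ.+ t n)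
    +-cauchy = +-cauchy′

    *-cauchy : ∀ s t → IsCauchy s → IsCauchy t → IsCauchy (λ n → s n ℚ.* t n)
    *-cauchy = *-cauchy′

infixl 6 _+_
infixl 7 _*_
infix  4 _≈_ _≤_ _<_ _#_

_+_ : ℝ → ℝ → ℝ
x + y = mkℝ (λ n → seq x n ℚ.+ seq y n) (+-cauchy (seq x) (seq y) (cauchy x) (cauchy y))

_*_ : ℝ → ℝ → ℝ
x * y = mkℝ (λ n → seq x n ℚ.* seq y n) (*-cauchy (seq x) (seq y) (cauchy x) (cauchy y))

_≈_ : ℝ → ℝ → Set
x ≈ y = ∀ ε → 0ℚ ℚ.< ε → ∃[ N ] (∀ n → N ℕ.≤ n → ∣ seq x n ℚ.- seq y n ∣ ℚ.< ε)

_≤_ : ℝ → ℝ → Set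
x ≤ y = ∀ ε → 0ℚ ℚ.< ε → ∃[ N ] (∀ n → N ℕ.≤ n → seq x n ℚ.≤ seq y n ℚ.+ ε)

_<_ : ℝ → ℝ → Set
x < y = ∃[ ε ] (0ℚ ℚ.< ε × ∃[ N ] (∀ n → N ℕ.≤ n → seq x n ℚ.+ ε ℚ.≤ seq y n))

-- x ≠ y in the positive form appropriate to constructive reals.
_#_ : ℝ → ℝ → Set
x # y = x < y ⊎ y < x

∑ : ∀ {n} → Vector ℝ n → ℝ
∑ = foldr _+_ 0ℝ

Point : ℕ → Set
Point e = Vector ℝ e

infix 4 _≋_

_≋_ : ∀ {e} → Point e → Point e → Set
x ≋ y = ∀ j → x j ≈ y j

infixl 7 _·_

_·_ : ∀ {e} → Point e → Point e → ℝ
c · x = ∑ (λ j → c j * x j)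

combination : ∀ {e n} → Vector ℝ n → Vector (Point e) n → Point e
combination μ x j = ∑ (λ i → μ i * x i j)

conv : ∀ {e n} → Vector (Point e) n → Pred (Point e) 0ℓ
conv {n = n} x y = Σ[ μ ∈ Vector ℝ n ]
  (∀ i → 0ℝ ≤ μ i) × ∑ μ ≈ 1ℝ × y ≋ combination μ x

aff : ∀ {e n} → Vector (Point e) n → Pred (Point e) 0ℓ
aff {n = n} x y = Σ[ μ ∈ Vector ℝ n ] ∑ μ ≈ 1ℝ × y ≋ combination μ x

-- The usual "∑ μᵢ = 0 and ∑ μᵢ xᵢ = 0 imply μ = 0", contraposed and with
-- apartness for inequality, as is standard for constructive reals; the two
-- forms are classically equivalent.
AffinelyIndependent : ∀ {e n} → Vector (Point e) n → Set
AffinelyIndependent x =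
  ∀ μ → ∑ μ ≈ 0ℝ → (∃[ i ] μ i # 0ℝ) → ∃[ j ] combination μ x j # 0ℝ

-- The affine hull of S has an affine basis of k + 1 points, taken from S.
-- The empty set has no dimension k : ℕ.
HasDimension : ∀ {e} → Pred (Point e) 0ℓ → ℕ → Set
HasDimension {e} S k = Σ[ x ∈ Vector (Point e) (suc k) ]
  (∀ i → x i ∈ S) × AffinelyIndependent x × S ⊆′ aff x

IsTriangle : ∀ {e} → Pred (Point e) 0ℓ → Set
IsTriangle {e} S = Σ[ x ∈ Vector (Point e) 3 ] AffinelyIndependent x × S ≐′ conv x

record Polytope (d : ℕ) : Set where
  field
    ambient    : ℕ
    size       : ℕ
    generators : Vector (Point ambient) size

  points : Pred (Point ambient) 0ℓ
  points = conv generators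

  field
    dimension : HasDimension points d

-- A face is cut out by a valid inequality c · x ≤ δ; different inequalities
-- may define the same face, so faces are compared as point sets.
record Face {d} (P : Polytope d) : Set where
  open Polytope P
  field
    normal : Point ambient
    offset : ℝ
    valid  : ∀ x → x ∈ points → normal · x ≤ offset

  facePoints : Pred (Point ambient) 0ℓ
  facePoints x = x ∈ points × normal · x ≈ offset

open Face public using (facePoints)

infix 4 _⊑_

_⊑_ : ∀ {d} {P : Polytope d} → Face P → Face P → Set
F ⊑ G = facePoints F ⊆′ facePoints G

module _ {d} (P : Polytope d) where
  open Polytope P using (ambient)

  FaceOfDim : ℕ → Set
  FaceOfDim i = Σ[ F ∈ Face P ] HasDimension (facePoints F) i

  faces : ℕ → Setoid 0ℓ 0ℓ
  faces i = On.setoid {B = FaceOfDim i}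
    (≐′-setoid (Point ambient) 0ℓ) (λ F → facePoints (proj₁ F))

  facesContaining : Face P → ℕ → Setoid 0ℓ 0ℓ
  facesContaining E i = On.setoid {B = Σ[ F ∈ FaceOfDim i ] E ⊑ proj₁ F}
    (faces i) proj₁

  flags : ℕ → ℕ → Setoid 0ℓ 0ℓ
  flags i j = On.setoid {B = Σ[ (V , F) ∈ FaceOfDim i × FaceOfDim j ] proj₁ V ⊑ proj₁ F}
    (×-setoid (faces i) (faces j)) proj₁

HasCardinality : Setoid 0ℓ 0ℓ → ℕ → Set
HasCardinality S n = Bijection (setoid (Fin n)) S

HasVertices : ∀ {d} → Polytope d → ℕ → Set
HasVertices P k = HasCardinality (faces P 0) k

TwoSimplicial : ∀ {d} → Polytope d → Set
TwoSimplicial P = ∀ (F : FaceOfDim P 2) → IsTriangle (facePoints (proj₁ F))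

TwoSimple : Polytope 4 → Set
TwoSimple P = ∀ (E : FaceOfDim P 1) → HasCardinality (facesContaining P (proj₁ E) 3) 3

g₂ : (d f₀ f₁ f₂ f₀₂ : ℕ) → ℤ
g₂ d f₀ f₁ f₂ f₀₂ =
  + f₀₂ ℤ.- + 3 ℤ.* + f₂ ℤ.+ + f₁ ℤ.- + d ℤ.* + f₀ ℤ.+ + (suc d C 2)

Elementary : ∀ {d} → Polytope d → Set
Elementary {d} P = ∃[ f₀ ] ∃[ f₁ ] ∃[ f₂ ] ∃[ f₀₂ ]
    HasCardinality (faces P 0) f₀
  × HasCardinality (faces P 1) f₁
  × HasCardinality (faces P 2) f₂
  × HasCardinality (flags P 0 2) f₀₂
  × g₂ d f₀ f₁ f₂ f₀₂ ≡ + 0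

{-# OPTIONS --safe #-}
module Submission where

-- Let P₁ be a polytope with a simple vertex v and P₂ one with a simplex facet F.  A projective map
-- takes F to the tetrahedron spanned by the four neighbours of v and the four facets adjacent to F
-- into the hyperplanes of the four facets at v.  Then P₂ lies in the simplex cut off at v, and
-- replacing that simplex by P₂ gives a polytope in which the facets at v are merged with those
-- adjacent to F.  It is again 2-simple, 2-simplicial and elementary, and has f₀(P₁) + f₀(P₂) − 5
-- vertices; a simple vertex of P₂ outside F stays simple, so the construction can be repeated.
-- Starting from the simplex and gluing on polytopes with 9, 10 and 11 vertices gives all k with
-- k − 5 a sum of 4's, 5's and 6's.
--
-- All coordinates are rational.  A face of the real polytope is recognised from its vertices:
-- an affine basis of the face can be exchanged for vertices, one at a time, and every vertex w
-- common to all facets through vertices J of the face lies on it, since ∑ J = τ w + (a conic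
-- combination of vertices) with τ > 0.

open import Defs
open import Algebra.Bundles using (CommutativeRing)
open import Algebra.Structures using (IsCommutativeRing)
open import Data.Bool.Base using (Bool; true; false)
open import Data.Bool.ListAction using (any)
import Data.Bool.Properties as Boolₚ
open import Data.Empty using (⊥; ⊥-elim)
open import Data.Fin.Base as Fin using (Fin; zero; suc; toℕ; fromℕ<; punchIn; punchOut; splitAt; _↑ʳ_)
open import Data.Fin.Patterns using (0F; 1F; 2F; 3F; 4F)
import Data.Fin.Properties as Finₚ
open import Data.Integer.Base as ℤ using (ℤ; +_; -[1+_])
import Data.Integer.Properties as ℤₚ
import Data.Integer.Solver as ℤ-Solver
open import Data.List.Base using (List; []; _∷_)
open import Data.List.Membership.Propositional using (_∈_)
open import Data.List.Relation.Unary.Any using (here; there)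
open import Data.Nat.Base as ℕ using (ℕ; zero; suc; _≥_; _⊔_)
open import Data.Nat.DivMod using (_mod_)
import Data.Nat.Properties as ℕₚ
open import Data.Product.Base using (Σ-syntax; ∃-syntax; _×_; _,_; proj₁; proj₂)
open import Data.Product.Function.NonDependent.Propositional using (_×-↔_)
open import Data.Rational.Base as ℚ using (ℚ; 0ℚ; 1ℚ; ½; ∣_∣; 1/_)
import Data.Rational.Properties as ℚₚ
import Data.Rational.Solver as ℚ-Solver
open import Data.Sum.Base using (_⊎_; inj₁; inj₂; [_,_]′)
open import Data.Sum.Function.Propositional using (_⊎-↔_)
open import Data.Sum.Properties as Sumₚ using (inj₁-injective; inj₂-injective)
open import Data.Vec.Base using (Vec; []; _∷_; lookup)
open import Data.Vec.Functional as Vector using (Vector; insertAt)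
open import Data.Vec.Functional.Properties using (insertAt-lookup; insertAt-punchIn)
open import Function.Base using (_∘_; id)
open import Function.Bundles using (Inverse; _↔_)
open import Function.Construct.Composition using (_↔-∘_)
open import Function.Construct.Identity using (↔-id)
open import Level using (0ℓ)
open import Relation.Binary.Definitions using (DecidableEquality)
open import Relation.Binary.PropositionalEquality as ≡ using (_≡_; _≢_; refl; cong; cong₂; subst; subst₂)
open import Relation.Nullary using (¬_; ¬?; yes; no; Dec; does)
open import Relation.Nullary.Decidable using (map′; _×-dec_; _⊎-dec_; _→-dec_; True; toWitness; from-yes)
open import Relation.Unary using (Pred; _⊆′_; _≐′_) renaming (_∈_ to _∈ᵖ_)

open ℚ-Solver.+-*-Solver using (solve; _:+_; _:*_; _:-_; :-_; con; _:=_)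
open import Algebra.Properties.Semiring.Sum (CommutativeRing.semiring ℚₚ.+-*-commutativeRing) as ℚ-Sum using () renaming (sum to ∑q)


-- Real arithmetic

-- In homogeneous coordinates a projective map is linear, so gluing is a substitution. Relative to
-- the basis formed by v and its neighbours, the other vertices of P₁ have negative v-coordinate,
-- while the vertices of P₂ off F have a positive one. A facet of P₂ that is neither F nor adjacent
-- to F is negative at v, hence positive on those vertices of P₁: this is why the union is convex.
-- An edge of F loses the facet F but keeps the third facet that it has in P₁; the triangle of v and
-- two neighbours gives way to the triangle of P₂ on the same edge. The values 6, 7, 8 and 12 are
-- the k > 5 that such sums do not reach. The obstacle on the real side is that a face is given by
-- an arbitrary real inequality, and whether it is tight at a vertex cannot be decided for Cauchy
-- sequences. What can be used is the affine basis supplied with the dimension of the face: its dual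
-- functionals have values apart from 0, and a sum apart from 0 has a summand apart from 0. Each
-- exchange thus finds a vertex without deciding any equality of reals.

Ev : (ℕ → Set) → Set
Ev P = ∃[ N ] (∀ n → N ℕ.≤ n → P n)

Ev-map : ∀ {P Q : ℕ → Set} → (∀ n → P n → Q n) → Ev P → Ev Q
Ev-map f (N , p) = N , λ n N≤n → f n (p n N≤n)

Ev-zip : ∀ {P Q R : ℕ → Set} → (∀ n → P n → Q n → R n) → Ev P → Ev Q → Ev R
Ev-zip f (M , p) (N , q) = M ⊔ N , λ n le →
  f n (p n (ℕₚ.m⊔n≤o⇒m≤o M N le)) (q n (ℕₚ.m⊔n≤o⇒n≤o M N le))

Ev-always : ∀ {P : ℕ → Set} → (∀ n → P n) → Ev P
Ev-always p = 0 , λ n _ → p n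

Ev-witness : ∀ {P : ℕ → Set} → Ev P → ∃[ n ] P n
Ev-witness (N , p) = N , p N ℕₚ.≤-refl

abstract

  -- A total reciprocal; the value at 0 is 0.
  inv : ℚ → ℚ
  inv q with q ℚₚ.≟ 0ℚ
  ... | yes _ = 0ℚ
  ... | no q≢0 = 1/_ q {{ℚ.≢-nonZero q≢0}}

  inv-inverse : ∀ q → q ≢ 0ℚ → q ℚ.* inv q ≡ 1ℚ
  inv-inverse q q≢0 with q ℚₚ.≟ 0ℚ
  ... | yes q≡0 = ⊥-elim (q≢0 q≡0)
  ... | no q≢0′ = ℚₚ.*-inverseʳ q {{ℚ.≢-nonZero q≢0′}}

>⇒≢0 : ∀ {q} → 0ℚ ℚ.< q → q ≢ 0ℚ
>⇒≢0 q>0 refl = ℚₚ.<-irrefl refl q>0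

*-pos : ∀ {p q} → 0ℚ ℚ.< p → 0ℚ ℚ.< q → 0ℚ ℚ.< p ℚ.* q
*-pos {p} {q} p>0 q>0 = ℚₚ.positive⁻¹ (p ℚ.* q)
  {{ℚₚ.pos*pos⇒pos p {{ℚ.positive p>0}} q {{ℚ.positive q>0}}}}

*-nonneg : ∀ {p q} → 0ℚ ℚ.≤ p → 0ℚ ℚ.≤ q → 0ℚ ℚ.≤ p ℚ.* q
*-nonneg {p} {q} p≥0 q≥0 = subst (ℚ._≤ p ℚ.* q) (ℚₚ.*-zeroʳ p)
  (ℚₚ.*-monoˡ-≤-nonNeg p {{ℚ.nonNegative p≥0}} q≥0)

+-nonneg : ∀ {p q} → 0ℚ ℚ.≤ p → 0ℚ ℚ.≤ q → 0ℚ ℚ.≤ p ℚ.+ q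
+-nonneg p≥0 q≥0 = ℚₚ.+-mono-≤ p≥0 q≥0

inv-pos : ∀ {q} → 0ℚ ℚ.< q → 0ℚ ℚ.< inv q
inv-pos {q} q>0 with inv q ℚₚ.≤? 0ℚ
... | no ≰ = ℚₚ.≰⇒> ≰
... | yes i≤0 = ⊥-elim (ℚₚ.<-irrefl refl (ℚₚ.<-≤-trans (ℚₚ.positive⁻¹ 1ℚ)
  (subst₂ ℚ._≤_ (inv-inverse q (>⇒≢0 q>0)) (ℚₚ.*-zeroʳ q)
    (ℚₚ.*-monoˡ-≤-nonNeg q {{ℚ.nonNegative (ℚₚ.<⇒≤ q>0)}} i≤0))))

half-pos : ∀ {ε} → 0ℚ ℚ.< ε → 0ℚ ℚ.< ½ ℚ.* ε
half-pos = *-pos (ℚₚ.positive⁻¹ ½)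

two-halves : ∀ ε → ½ ℚ.* ε ℚ.+ ½ ℚ.* ε ≡ ε
two-halves = solve 1 (λ ε → con ½ :* ε :+ con ½ :* ε := ε) refl

∣-∣≥0 : ∀ q → 0ℚ ℚ.≤ ∣ q ∣
∣-∣≥0 = ℚₚ.0≤∣p∣

q≤∣q∣ : ∀ q → q ℚ.≤ ∣ q ∣
q≤∣q∣ q with ℚₚ.∣p∣≡p∨∣p∣≡-p q
... | inj₁ eq = ℚₚ.≤-reflexive (≡.sym eq)
... | inj₂ eq with ℚₚ.≤-total q 0ℚ
...   | inj₁ q≤0 = ℚₚ.≤-trans q≤0 (∣-∣≥0 q)
...   | inj₂ 0≤q = ℚₚ.≤-reflexive (≡.sym (ℚₚ.0≤p⇒∣p∣≡p 0≤q))

-q≤∣q∣ : ∀ q → ℚ.- q ℚ.≤ ∣ q ∣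
-q≤∣q∣ q = subst (ℚ.- q ℚ.≤_) (ℚₚ.∣-p∣≡∣p∣ q) (q≤∣q∣ (ℚ.- q))

bounded : ∀ x → ∃[ B ] (0ℚ ℚ.< B × Ev (λ n → ∣ seq x n ∣ ℚ.≤ B))
bounded x = 1ℚ ℚ.+ ∣ seq x N ∣ , B>0 , N , λ n N≤n → begin
    ∣ seq x n ∣                                ≡⟨ cong ∣_∣ (restore (seq x n) (seq x N)) ⟩
    ∣ (seq x n ℚ.- seq x N) ℚ.+ seq x N ∣      ≤⟨ ℚₚ.∣p+q∣≤∣p∣+∣q∣ (seq x n ℚ.- seq x N) (seq x N) ⟩
    ∣ seq x n ℚ.- seq x N ∣ ℚ.+ ∣ seq x N ∣    ≤⟨ ℚₚ.+-monoˡ-≤ ∣ seq x N ∣ (ℚₚ.<⇒≤ (proj₂ C n N N≤n ℕₚ.≤-refl)) ⟩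
    1ℚ ℚ.+ ∣ seq x N ∣                         ∎
  where
  open ℚₚ.≤-Reasoning
  C = cauchy x 1ℚ (ℚₚ.positive⁻¹ 1ℚ)
  N = proj₁ C
  restore : ∀ a b → a ≡ (a ℚ.- b) ℚ.+ b
  restore = solve 2 (λ a b → a := (a :- b) :+ b) refl
  B>0 : 0ℚ ℚ.< 1ℚ ℚ.+ ∣ seq x N ∣
  B>0 = ℚₚ.<-≤-trans (ℚₚ.positive⁻¹ 1ℚ)
    (subst (ℚ._≤ 1ℚ ℚ.+ ∣ seq x N ∣) (ℚₚ.+-identityʳ 1ℚ) (ℚₚ.+-monoʳ-≤ 1ℚ (∣-∣≥0 (seq x N))))

Null : (ℕ → ℚ) → Set
Null s = ∀ ε → 0ℚ ℚ.< ε → Ev (λ n → ∣ s n ∣ ℚ.< ε)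

Null-cong : ∀ {s t} → (∀ n → s n ≡ t n) → Null s → Null t
Null-cong eq s0 ε ε>0 = Ev-map (λ n → subst (λ q → ∣ q ∣ ℚ.< ε) (eq n)) (s0 ε ε>0)

Null-+ : ∀ {s t} → Null s → Null t → Null (λ n → s n ℚ.+ t n)
Null-+ {s} {t} s0 t0 ε ε>0 = Ev-zip (λ n p q → begin-strict
    ∣ s n ℚ.+ t n ∣            ≤⟨ ℚₚ.∣p+q∣≤∣p∣+∣q∣ (s n) (t n) ⟩
    ∣ s n ∣ ℚ.+ ∣ t n ∣        <⟨ ℚₚ.+-mono-< p q ⟩
    ½ ℚ.* ε ℚ.+ ½ ℚ.* ε        ≡⟨ two-halves ε ⟩
    ε                          ∎)
  (s0 _ (half-pos ε>0)) (t0 _ (half-pos ε>0))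
  where open ℚₚ.≤-Reasoning

Null-- : ∀ {s} → Null s → Null (λ n → ℚ.- s n)
Null-- {s} s0 ε ε>0 = Ev-map (λ n → subst (ℚ._< ε) (≡.sym (ℚₚ.∣-p∣≡∣p∣ (s n)))) (s0 ε ε>0)

Null-* : ∀ x {s} → Null s → Null (λ n → seq x n ℚ.* s n)
Null-* x {s} s0 ε ε>0 = scale (bounded x)
  where
  open ℚₚ.≤-Reasoning
  scale : ∃[ B ] (0ℚ ℚ.< B × Ev (λ n → ∣ seq x n ∣ ℚ.≤ B)) → Ev (λ n → ∣ seq x n ℚ.* s n ∣ ℚ.< ε)
  scale (B , B>0 , xB) = Ev-zip step xB (s0 (inv B ℚ.* ε) (*-pos (inv-pos B>0) ε>0))
    where
    step : ∀ n → ∣ seq x n ∣ ℚ.≤ B → ∣ s n ∣ ℚ.< inv B ℚ.* ε → ∣ seq x n ℚ.* s n ∣ ℚ.< ε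
    step n p q = begin-strict
      ∣ seq x n ℚ.* s n ∣        ≡⟨ ℚₚ.∣p*q∣≡∣p∣*∣q∣ (seq x n) (s n) ⟩
      ∣ seq x n ∣ ℚ.* ∣ s n ∣    ≤⟨ ℚₚ.*-monoʳ-≤-nonNeg ∣ s n ∣ {{ℚₚ.∣-∣-nonNeg (s n)}} p ⟩
      B ℚ.* ∣ s n ∣              <⟨ ℚₚ.*-monoʳ-<-pos B {{ℚ.positive B>0}} q ⟩
      B ℚ.* (inv B ℚ.* ε)        ≡⟨ ℚₚ.*-assoc B (inv B) ε ⟨
      (B ℚ.* inv B) ℚ.* ε        ≡⟨ cong (ℚ._* ε) (inv-inverse B (>⇒≢0 B>0)) ⟩
      1ℚ ℚ.* ε                   ≡⟨ ℚₚ.*-identityˡ ε ⟩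
      ε                          ∎

Null-0 : Null (λ _ → 0ℚ)
Null-0 ε ε>0 = Ev-always (λ _ → ε>0)

-- x ≈ y is a function type from which x and y cannot be inferred; the wrapper makes them inferable.
infix 4 _≃_

record _≃_ (x y : ℝ) : Set where
  constructor wrap
  field unwrap : x ≈ y

open _≃_ public

≃-pointwise : ∀ {x y} → (∀ n → seq x n ≡ seq y n) → x ≃ y
≃-pointwise {x} {y} eq = wrap (Null-cong (λ n →
  ≡.sym (≡.trans (cong (ℚ._- seq y n) (eq n)) (ℚₚ.+-inverseʳ (seq y n)))) Null-0)

≃-refl : ∀ {x} → x ≃ x
≃-refl = ≃-pointwise (λ _ → refl)

≃-sym : ∀ {x y} → x ≃ y → y ≃ x
≃-sym {x} {y} (wrap p) = wrap (Null-cong (λ n → flip-sub (seq x n) (seq y n)) (Null-- p))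
  where
  flip-sub : ∀ a b → ℚ.- (a ℚ.- b) ≡ b ℚ.- a
  flip-sub = solve 2 (λ a b → :- (a :- b) := b :- a) refl

≃-trans : ∀ {x y z} → x ≃ y → y ≃ z → x ≃ z
≃-trans {x} {y} {z} (wrap p) (wrap q) =
  wrap (Null-cong (λ n → telescope (seq x n) (seq y n) (seq z n)) (Null-+ p q))
  where
  telescope : ∀ a b c → (a ℚ.- b) ℚ.+ (b ℚ.- c) ≡ a ℚ.- c
  telescope = solve 3 (λ a b c → (a :- b) :+ (b :- c) := a :- c) refl

+-cong : ∀ {x x′ y y′} → x ≃ x′ → y ≃ y′ → x + y ≃ x′ + y′
+-cong {x} {x′} {y} {y′} (wrap p) (wrap q) =
  wrap (Null-cong (λ n → split (seq x n) (seq x′ n) (seq y n) (seq y′ n)) (Null-+ p q))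
  where
  split : ∀ a a′ b b′ → (a ℚ.- a′) ℚ.+ (b ℚ.- b′) ≡ (a ℚ.+ b) ℚ.- (a′ ℚ.+ b′)
  split = solve 4 (λ a a′ b b′ → (a :- a′) :+ (b :- b′) := (a :+ b) :- (a′ :+ b′)) refl

*-cong : ∀ {x x′ y y′} → x ≃ x′ → y ≃ y′ → x * y ≃ x′ * y′
*-cong {x} {x′} {y} {y′} (wrap p) (wrap q) = wrap
  (Null-cong (λ n → split (seq x n) (seq x′ n) (seq y n) (seq y′ n)) (Null-+ (Null-* x q) (Null-* y′ p)))
  where
  split : ∀ a a′ b b′ → a ℚ.* (b ℚ.- b′) ℚ.+ b′ ℚ.* (a ℚ.- a′) ≡ a ℚ.* b ℚ.- a′ ℚ.* b′
  split = solve 4 (λ a a′ b b′ → a :* (b :- b′) :+ b′ :* (a :- a′) := a :* b :- a′ :* b′) refl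

infix 8 ⁻_

⁻_ : ℝ → ℝ
⁻ x = fromℚ (ℚ.- 1ℚ) * x

ℝ-isCommutativeRing : IsCommutativeRing _≃_ _+_ _*_ ⁻_ 0ℝ 1ℝ
ℝ-isCommutativeRing = record
  { isRing = record
    { +-isAbelianGroup = record
      { isGroup = record
        { isMonoid = record
          { isSemigroup = record
            { isMagma = record
              { isEquivalence = record { refl = ≃-refl ; sym = ≃-sym ; trans = ≃-trans }
              ; ∙-cong = +-cong }
            ; assoc = λ x y z → ≃-pointwise λ n → ℚₚ.+-assoc (seq x n) (seq y n) (seq z n) }
          ; identity = (λ x → ≃-pointwise λ n → ℚₚ.+-identityˡ (seq x n))
                     , (λ x → ≃-pointwise λ n → ℚₚ.+-identityʳ (seq x n)) }
        ; inverse = (λ x → ≃-pointwise λ n → inverseˡ (seq x n))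
                  , (λ x → ≃-pointwise λ n → inverseʳ (seq x n))
        ; ⁻¹-cong = *-cong ≃-refl }
      ; comm = λ x y → ≃-pointwise λ n → ℚₚ.+-comm (seq x n) (seq y n) }
    ; *-cong = *-cong
    ; *-assoc = λ x y z → ≃-pointwise λ n → ℚₚ.*-assoc (seq x n) (seq y n) (seq z n)
    ; *-identity = (λ x → ≃-pointwise λ n → ℚₚ.*-identityˡ (seq x n))
                 , (λ x → ≃-pointwise λ n → ℚₚ.*-identityʳ (seq x n))
    ; distrib = (λ x y z → ≃-pointwise λ n → ℚₚ.*-distribˡ-+ (seq x n) (seq y n) (seq z n))
              , (λ x y z → ≃-pointwise λ n → ℚₚ.*-distribʳ-+ (seq x n) (seq y n) (seq z n)) }
  ; *-comm = λ x y → ≃-pointwise λ n → ℚₚ.*-comm (seq x n) (seq y n) }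
  where
  inverseˡ : ∀ a → ℚ.- 1ℚ ℚ.* a ℚ.+ a ≡ 0ℚ
  inverseˡ = solve 1 (λ a → con (ℚ.- 1ℚ) :* a :+ a := con 0ℚ) refl
  inverseʳ : ∀ a → a ℚ.+ ℚ.- 1ℚ ℚ.* a ≡ 0ℚ
  inverseʳ = solve 1 (λ a → a :+ con (ℚ.- 1ℚ) :* a := con 0ℚ) refl

ℝ-commutativeRing : CommutativeRing 0ℓ 0ℓ
ℝ-commutativeRing = record { isCommutativeRing = ℝ-isCommutativeRing }

-- x # 0 without a sign: the form in which products and sums are easily analysed.
record Apart (x : ℝ) : Set where
  constructor apart
  field
    bound    : ℚ
    bound>0  : 0ℚ ℚ.< bound
    eventual : Ev (λ n → bound ℚ.≤ ∣ seq x n ∣)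

#⇒Apart : ∀ {x} → x # 0ℝ → Apart x
#⇒Apart {x} (inj₁ (ε , ε>0 , E)) = apart ε ε>0 (Ev-map (λ n p → ℚₚ.≤-trans
  (subst₂ ℚ._≤_ (lemma (seq x n) ε) (ℚₚ.+-identityˡ (ℚ.- seq x n)) (ℚₚ.+-monoˡ-≤ (ℚ.- seq x n) p))
  (-q≤∣q∣ (seq x n))) E)
  where
  lemma : ∀ a e → a ℚ.+ e ℚ.+ ℚ.- a ≡ e
  lemma = solve 2 (λ a e → a :+ e :+ :- a := e) refl
#⇒Apart {x} (inj₂ (ε , ε>0 , E)) = apart ε ε>0 (Ev-map (λ n p → ℚₚ.≤-trans
  (subst (ℚ._≤ seq x n) (ℚₚ.+-identityˡ ε) p) (q≤∣q∣ (seq x n))) E)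

-- The sign is read off a term beyond which the sequence moves by less than half the bound.
Apart⇒# : ∀ {x} → Apart x → x # 0ℝ
Apart⇒# {x} (apart ε ε>0 (N₁ , big)) = result
  where
  C = cauchy x (½ ℚ.* ε) (half-pos ε>0)
  N = N₁ ⊔ proj₁ C
  near : ∀ n → N ℕ.≤ n → ∣ seq x n ℚ.- seq x N ∣ ℚ.< ½ ℚ.* ε
  near n le = proj₂ C n N (ℕₚ.m⊔n≤o⇒n≤o N₁ (proj₁ C) le) (ℕₚ.m≤n⊔m N₁ (proj₁ C))
  bigN : ε ℚ.≤ ∣ seq x N ∣
  bigN = big N (ℕₚ.m≤m⊔n N₁ (proj₁ C))
  open ℚₚ.≤-Reasoning
  result : x # 0ℝ
  result with ℚₚ.≤-total (seq x N) 0ℚ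
  ... | inj₂ x≥0 = inj₂ (½ ℚ.* ε , half-pos ε>0 , N , λ n le → begin
      0ℚ ℚ.+ ½ ℚ.* ε                          ≡⟨ e₁ ε ⟩
      ε ℚ.- ½ ℚ.* ε                           ≤⟨ ℚₚ.+-mono-≤ (subst (ε ℚ.≤_) (ℚₚ.0≤p⇒∣p∣≡p x≥0) bigN)
                                                  (ℚₚ.neg-antimono-≤ (ℚₚ.≤-trans (-q≤∣q∣ _) (ℚₚ.<⇒≤ (near n le)))) ⟩
      seq x N ℚ.- (ℚ.- (seq x n ℚ.- seq x N)) ≡⟨ e₂ (seq x N) (seq x n) ⟩
      seq x n                                 ∎)
    where
    e₁ : ∀ e → 0ℚ ℚ.+ ½ ℚ.* e ≡ e ℚ.- ½ ℚ.* e
    e₁ = solve 1 (λ e → con 0ℚ :+ con ½ :* e := e :- con ½ :* e) refl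
    e₂ : ∀ a b → a ℚ.- (ℚ.- (b ℚ.- a)) ≡ b
    e₂ = solve 2 (λ a b → a :- (:- (b :- a)) := b) refl
  ... | inj₁ x≤0 = inj₁ (½ ℚ.* ε , half-pos ε>0 , N , λ n le → begin
      seq x n ℚ.+ ½ ℚ.* ε                           ≡⟨ e₁ (seq x n) (seq x N) ε ⟩
      (seq x n ℚ.- seq x N) ℚ.+ seq x N ℚ.+ ½ ℚ.* ε ≤⟨ ℚₚ.+-monoˡ-≤ (½ ℚ.* ε) (ℚₚ.+-mono-≤ (ℚₚ.≤-trans (q≤∣q∣ _) (ℚₚ.<⇒≤ (near n le))) xN≤) ⟩
      ½ ℚ.* ε ℚ.+ ℚ.- ε ℚ.+ ½ ℚ.* ε                 ≡⟨ e₂ ε ⟩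
      0ℚ                                            ∎)
    where
    e₁ : ∀ a b e → a ℚ.+ ½ ℚ.* e ≡ (a ℚ.- b) ℚ.+ b ℚ.+ ½ ℚ.* e
    e₁ = solve 3 (λ a b e → a :+ con ½ :* e := (a :- b) :+ b :+ con ½ :* e) refl
    e₂ : ∀ e → ½ ℚ.* e ℚ.+ ℚ.- e ℚ.+ ½ ℚ.* e ≡ 0ℚ
    e₂ = solve 1 (λ e → con ½ :* e :+ :- e :+ con ½ :* e := con 0ℚ) refl
    neg² : ∀ a → ℚ.- (ℚ.- a) ≡ a
    neg² = solve 1 (λ a → :- (:- a) := a) refl
    ∣x∣ : ∣ seq x N ∣ ≡ ℚ.- seq x N
    ∣x∣ = ≡.trans (≡.sym (ℚₚ.∣-p∣≡∣p∣ (seq x N))) (ℚₚ.0≤p⇒∣p∣≡p (ℚₚ.neg-antimono-≤ x≤0))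
    xN≤ : seq x N ℚ.≤ ℚ.- ε
    xN≤ = subst (ℚ._≤ ℚ.- ε) (neg² (seq x N)) (ℚₚ.neg-antimono-≤ (subst (ε ℚ.≤_) ∣x∣ bigN))

Apart-resp : ∀ {x y} → x ≃ y → Apart x → Apart y
Apart-resp {x} {y} (wrap x≈y) (apart ε ε>0 E) =
  apart (½ ℚ.* ε) (half-pos ε>0) (Ev-zip (λ n p q → step n p (ℚₚ.<⇒≤ q)) E (x≈y _ (half-pos ε>0)))
  where
  open ℚₚ.≤-Reasoning
  r₁ : ∀ a b → a ≡ (a ℚ.- b) ℚ.+ b
  r₁ = solve 2 (λ a b → a := (a :- b) :+ b) refl
  r₂ : ∀ e → ½ ℚ.* e ≡ e ℚ.- ½ ℚ.* e
  r₂ = solve 1 (λ e → con ½ :* e := e :- con ½ :* e) refl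
  r₃ : ∀ h y → h ℚ.+ y ℚ.- h ≡ y
  r₃ = solve 2 (λ h y → h :+ y :- h := y) refl
  step : ∀ n → ε ℚ.≤ ∣ seq x n ∣ → ∣ seq x n ℚ.- seq y n ∣ ℚ.≤ ½ ℚ.* ε → ½ ℚ.* ε ℚ.≤ ∣ seq y n ∣
  step n p q = begin
    ½ ℚ.* ε                                              ≡⟨ r₂ ε ⟩
    ε ℚ.- ½ ℚ.* ε                                        ≤⟨ ℚₚ.+-monoˡ-≤ _ p ⟩
    ∣ seq x n ∣ ℚ.- ½ ℚ.* ε                              ≡⟨ cong (λ z → ∣ z ∣ ℚ.- ½ ℚ.* ε) (r₁ (seq x n) (seq y n)) ⟩
    ∣ (seq x n ℚ.- seq y n) ℚ.+ seq y n ∣ ℚ.- ½ ℚ.* ε    ≤⟨ ℚₚ.+-monoˡ-≤ _ (ℚₚ.≤-trans (ℚₚ.∣p+q∣≤∣p∣+∣q∣ (seq x n ℚ.- seq y n) (seq y n)) (ℚₚ.+-monoˡ-≤ _ q)) ⟩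
    ½ ℚ.* ε ℚ.+ ∣ seq y n ∣ ℚ.- ½ ℚ.* ε                  ≡⟨ r₃ (½ ℚ.* ε) ∣ seq y n ∣ ⟩
    ∣ seq y n ∣                                          ∎

Apart-≉0 : ∀ {x} → Apart x → ¬ (x ≃ 0ℝ)
Apart-≉0 {x} (apart ε ε>0 E) (wrap x≈0) with Ev-witness (Ev-zip (λ n p q → p , q) E (x≈0 ε ε>0))
... | n , p , q = ℚₚ.<-irrefl refl (ℚₚ.≤-<-trans p (subst (λ z → ∣ z ∣ ℚ.< ε) (ℚₚ.+-identityʳ (seq x n)) q))

Apart-fromℚ : ∀ {q} → q ≢ 0ℚ → Apart (fromℚ q)
Apart-fromℚ {q} q≢0 = apart ∣ q ∣
  (ℚₚ.≰⇒> (λ le → q≢0 (ℚₚ.∣p∣≡0⇒p≡0 q (ℚₚ.≤-antisym le (∣-∣≥0 q))))) (Ev-always (λ _ → ℚₚ.≤-refl))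

Apart-* : ∀ {x y} → Apart x → Apart y → Apart (x * y)
Apart-* {x} {y} (apart ε ε>0 E) (apart δ δ>0 D) = apart (ε ℚ.* δ) (*-pos ε>0 δ>0) (Ev-zip (λ n p q → begin
    ε ℚ.* δ                         ≤⟨ ℚₚ.*-monoʳ-≤-nonNeg δ {{ℚ.nonNegative (ℚₚ.<⇒≤ δ>0)}} p ⟩
    ∣ seq x n ∣ ℚ.* δ               ≤⟨ ℚₚ.*-monoˡ-≤-nonNeg ∣ seq x n ∣ {{ℚₚ.∣-∣-nonNeg (seq x n)}} q ⟩
    ∣ seq x n ∣ ℚ.* ∣ seq y n ∣     ≡⟨ ℚₚ.∣p*q∣≡∣p∣*∣q∣ (seq x n) (seq y n) ⟨
    ∣ seq x n ℚ.* seq y n ∣         ∎) E D)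
  where open ℚₚ.≤-Reasoning

-- The factor `x` is eventually bounded by some `B`, so a product of size at least `ε` leaves at
-- least `ε / B` for `y`.
Apart-*ʳ : ∀ {x y} → Apart (x * y) → Apart y
Apart-*ʳ {x} {y} (apart ε ε>0 E) = scale (bounded x)
  where
  open ℚₚ.≤-Reasoning
  scale : ∃[ B ] (0ℚ ℚ.< B × Ev (λ n → ∣ seq x n ∣ ℚ.≤ B)) → Apart y
  scale (B , B>0 , xB) = apart (inv B ℚ.* ε) (*-pos (inv-pos B>0) ε>0) (Ev-zip step E xB)
    where
    nn = ℚ.nonNegative (ℚₚ.<⇒≤ (inv-pos B>0))
    rearrange : ∀ i b y → i ℚ.* (b ℚ.* y) ≡ (b ℚ.* i) ℚ.* y
    rearrange = solve 3 (λ i b y → i :* (b :* y) := (b :* i) :* y) refl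
    step : ∀ n → ε ℚ.≤ ∣ seq x n ℚ.* seq y n ∣ → ∣ seq x n ∣ ℚ.≤ B → inv B ℚ.* ε ℚ.≤ ∣ seq y n ∣
    step n p q = begin
      inv B ℚ.* ε                             ≤⟨ ℚₚ.*-monoˡ-≤-nonNeg (inv B) {{nn}} p ⟩
      inv B ℚ.* ∣ seq x n ℚ.* seq y n ∣       ≡⟨ cong (inv B ℚ.*_) (ℚₚ.∣p*q∣≡∣p∣*∣q∣ (seq x n) (seq y n)) ⟩
      inv B ℚ.* (∣ seq x n ∣ ℚ.* ∣ seq y n ∣) ≤⟨ ℚₚ.*-monoˡ-≤-nonNeg (inv B) {{nn}} (ℚₚ.*-monoʳ-≤-nonNeg ∣ seq y n ∣ {{ℚₚ.∣-∣-nonNeg (seq y n)}} q) ⟩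
      inv B ℚ.* (B ℚ.* ∣ seq y n ∣)           ≡⟨ rearrange (inv B) B ∣ seq y n ∣ ⟩
      B ℚ.* inv B ℚ.* ∣ seq y n ∣             ≡⟨ cong (ℚ._* ∣ seq y n ∣) (inv-inverse B (>⇒≢0 B>0)) ⟩
      1ℚ ℚ.* ∣ seq y n ∣                      ≡⟨ ℚₚ.*-identityˡ ∣ seq y n ∣ ⟩
      ∣ seq y n ∣                             ∎

Apart-*ˡ : ∀ {x y} → Apart (x * y) → Apart x
Apart-*ˡ {x} {y} p = Apart-*ʳ {y} {x} (Apart-resp (≃-pointwise λ n → ℚₚ.*-comm (seq x n) (seq y n)) p)

module _ (x : ℝ) (ε : ℚ) (ε>0 : 0ℚ ℚ.< ε) where

  private
    C = cauchy x (½ ℚ.* ε) (half-pos ε>0)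

  modulus : ℕ
  modulus = proj₁ C

  -- Beyond `modulus` the sequence moves by less than `½ ε`, so a single large term there keeps all
  -- later ones at distance `½ ε` from 0.
  Apart-far : ∀ M → modulus ℕ.≤ M → ε ℚ.≤ ∣ seq x M ∣ → Apart x
  Apart-far M le big = apart (½ ℚ.* ε) (half-pos ε>0) (modulus , λ n le′ → begin
    ½ ℚ.* ε                                              ≡⟨ r₂ ε ⟩
    ε ℚ.- ½ ℚ.* ε                                        ≤⟨ ℚₚ.+-monoˡ-≤ _ big ⟩
    ∣ seq x M ∣ ℚ.- ½ ℚ.* ε                              ≡⟨ cong (λ z → ∣ z ∣ ℚ.- ½ ℚ.* ε) (r₁ (seq x M) (seq x n)) ⟩
    ∣ (seq x M ℚ.- seq x n) ℚ.+ seq x n ∣ ℚ.- ½ ℚ.* ε    ≤⟨ ℚₚ.+-monoˡ-≤ _ (ℚₚ.≤-trans (ℚₚ.∣p+q∣≤∣p∣+∣q∣ (seq x M ℚ.- seq x n) (seq x n)) (ℚₚ.+-monoˡ-≤ _ (ℚₚ.<⇒≤ (proj₂ C M n le le′)))) ⟩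
    ½ ℚ.* ε ℚ.+ ∣ seq x n ∣ ℚ.- ½ ℚ.* ε                  ≡⟨ r₃ (½ ℚ.* ε) ∣ seq x n ∣ ⟩
    ∣ seq x n ∣                                          ∎)
    where
    open ℚₚ.≤-Reasoning
    r₁ : ∀ a b → a ≡ (a ℚ.- b) ℚ.+ b
    r₁ = solve 2 (λ a b → a := (a :- b) :+ b) refl
    r₂ : ∀ e → ½ ℚ.* e ≡ e ℚ.- ½ ℚ.* e
    r₂ = solve 1 (λ e → con ½ :* e := e :- con ½ :* e) refl
    r₃ : ∀ h y → h ℚ.+ y ℚ.- h ≡ y
    r₃ = solve 2 (λ h y → h :+ y :- h := y) refl

-- One term far out decides which summand stays away from zero.
Apart-+ : ∀ {x y} → Apart (x + y) → Apart x ⊎ Apart y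
Apart-+ {x} {y} (apart ε ε>0 (N , big)) = decide (½ ℚ.* ε ℚₚ.≤? ∣ seq x M ∣)
  where
  h>0 = half-pos ε>0
  K = modulus x (½ ℚ.* ε) h>0
  L = modulus y (½ ℚ.* ε) h>0
  M = N ⊔ (K ⊔ L)
  decide : _ → Apart x ⊎ Apart y
  decide (yes xbig) = inj₁ (Apart-far x (½ ℚ.* ε) h>0 M
    (ℕₚ.≤-trans (ℕₚ.m≤m⊔n K L) (ℕₚ.m≤n⊔m N (K ⊔ L))) xbig)
  decide (no ≰) = inj₂ (Apart-far y (½ ℚ.* ε) h>0 M
    (ℕₚ.≤-trans (ℕₚ.m≤n⊔m K L) (ℕₚ.m≤n⊔m N (K ⊔ L))) (ℚₚ.≮⇒≥ λ ysmall →
      ℚₚ.<-irrefl refl (begin-strict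
        ε                                  ≤⟨ big M (ℕₚ.m≤m⊔n N (K ⊔ L)) ⟩
        ∣ seq x M ℚ.+ seq y M ∣            ≤⟨ ℚₚ.∣p+q∣≤∣p∣+∣q∣ (seq x M) (seq y M) ⟩
        ∣ seq x M ∣ ℚ.+ ∣ seq y M ∣        <⟨ ℚₚ.+-mono-< (ℚₚ.≰⇒> ≰) ysmall ⟩
        ½ ℚ.* ε ℚ.+ ½ ℚ.* ε                ≡⟨ two-halves ε ⟩
        ε                                  ∎)))
    where open ℚₚ.≤-Reasoning

Apart-∑ : ∀ {n} (f : Fin n → ℝ) → Apart (∑ f) → ∃[ i ] Apart (f i)
Apart-∑ {zero} f p = ⊥-elim (Apart-≉0 p ≃-refl)
Apart-∑ {suc n} f p with Apart-+ p
... | inj₁ q = zero , q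
... | inj₂ q = let i , r = Apart-∑ (λ i → f (suc i)) q in suc i , r

-- No reciprocal of `x` is formed: asking the product for precision `ε δ`, with `ε` the lower bound
-- of `x`, gives `y` to precision `δ`.
Apart-cancel : ∀ {x y} → Apart x → x * y ≃ 0ℝ → y ≃ 0ℝ
Apart-cancel {x} {y} (apart ε ε>0 E) (wrap xy≈0) = wrap λ δ δ>0 → Ev-zip (step δ) E (xy≈0 (ε ℚ.* δ) (*-pos ε>0 δ>0))
  where
  open ℚₚ.≤-Reasoning
  step : ∀ δ n → ε ℚ.≤ ∣ seq x n ∣ → ∣ seq x n ℚ.* seq y n ℚ.- 0ℚ ∣ ℚ.< ε ℚ.* δ → ∣ seq y n ℚ.- 0ℚ ∣ ℚ.< δ
  step δ n p q = subst (λ z → ∣ z ∣ ℚ.< δ) (≡.sym (ℚₚ.+-identityʳ (seq y n)))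
    (ℚₚ.*-cancelˡ-<-nonNeg ε {{ℚ.nonNegative (ℚₚ.<⇒≤ ε>0)}} (begin-strict
      ε ℚ.* ∣ seq y n ∣               ≤⟨ ℚₚ.*-monoʳ-≤-nonNeg ∣ seq y n ∣ {{ℚₚ.∣-∣-nonNeg (seq y n)}} p ⟩
      ∣ seq x n ∣ ℚ.* ∣ seq y n ∣     ≡⟨ ℚₚ.∣p*q∣≡∣p∣*∣q∣ (seq x n) (seq y n) ⟨
      ∣ seq x n ℚ.* seq y n ∣         ≡⟨ cong ∣_∣ (ℚₚ.+-identityʳ (seq x n ℚ.* seq y n)) ⟨
      ∣ seq x n ℚ.* seq y n ℚ.- 0ℚ ∣  <⟨ q ⟩
      ε ℚ.* δ                         ∎))

-- `0ℝ ≤ x` in a wrapper, for the same reason as `_≃_`: from the unfolded relation `x` could not be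
-- inferred.
record Nonneg (x : ℝ) : Set where
  constructor nonneg
  field lower : ∀ ε → 0ℚ ℚ.< ε → Ev (λ n → 0ℚ ℚ.≤ seq x n ℚ.+ ε)

≤⇒Nonneg : ∀ {x} → 0ℝ ≤ x → Nonneg x
≤⇒Nonneg = nonneg

Nonneg⇒≤ : ∀ {x} → Nonneg x → 0ℝ ≤ x
Nonneg⇒≤ (nonneg p) = p

Nonneg-fromℚ : ∀ {q} → 0ℚ ℚ.≤ q → Nonneg (fromℚ q)
Nonneg-fromℚ q≥0 = nonneg λ ε ε>0 → Ev-always λ _ → +-nonneg q≥0 (ℚₚ.<⇒≤ ε>0)

Nonneg-resp : ∀ {x y} → x ≃ y → Nonneg x → Nonneg y
Nonneg-resp {x} {y} (wrap x≈y) (nonneg p) = nonneg λ ε ε>0 → Ev-zip (λ n a b → begin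
    0ℚ                                                     ≤⟨ a ⟩
    seq x n ℚ.+ ½ ℚ.* ε                                    ≡⟨ r (seq x n) (seq y n) ε ⟩
    (seq x n ℚ.- seq y n) ℚ.+ (seq y n ℚ.+ ½ ℚ.* ε)        ≤⟨ ℚₚ.+-monoˡ-≤ _ (ℚₚ.≤-trans (q≤∣q∣ _) (ℚₚ.<⇒≤ b)) ⟩
    ½ ℚ.* ε ℚ.+ (seq y n ℚ.+ ½ ℚ.* ε)                      ≡⟨ s (seq y n) ε ⟩
    seq y n ℚ.+ ε                                          ∎)
  (p _ (half-pos ε>0)) (x≈y _ (half-pos ε>0))
  where
  open ℚₚ.≤-Reasoning
  r : ∀ a b e → a ℚ.+ ½ ℚ.* e ≡ (a ℚ.- b) ℚ.+ (b ℚ.+ ½ ℚ.* e)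
  r = solve 3 (λ a b e → a :+ con ½ :* e := (a :- b) :+ (b :+ con ½ :* e)) refl
  s : ∀ b e → ½ ℚ.* e ℚ.+ (b ℚ.+ ½ ℚ.* e) ≡ b ℚ.+ e
  s = solve 2 (λ b e → con ½ :* e :+ (b :+ con ½ :* e) := b :+ e) refl

Nonneg-+ : ∀ {x y} → Nonneg x → Nonneg y → Nonneg (x + y)
Nonneg-+ {x} {y} (nonneg p) (nonneg q) = nonneg λ ε ε>0 →
  Ev-zip (λ n a b → subst (0ℚ ℚ.≤_) (s (seq x n) (seq y n) ε) (+-nonneg a b))
    (p _ (half-pos ε>0)) (q _ (half-pos ε>0))
  where
  s : ∀ a b e → a ℚ.+ ½ ℚ.* e ℚ.+ (b ℚ.+ ½ ℚ.* e) ≡ a ℚ.+ b ℚ.+ e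
  s = solve 3 (λ a b e → a :+ con ½ :* e :+ (b :+ con ½ :* e) := a :+ b :+ e) refl

Nonneg-∑ : ∀ {n} {f : Fin n → ℝ} → (∀ i → Nonneg (f i)) → Nonneg (∑ f)
Nonneg-∑ {zero} p = Nonneg-fromℚ ℚₚ.≤-refl
Nonneg-∑ {suc n} p = Nonneg-+ (p zero) (Nonneg-∑ (λ i → p (suc i)))

-- (x + δ)(y + δ) ≥ 0 bounds x y from below by − δ (x + y + δ), and x + y + δ is bounded.
Nonneg-* : ∀ {x y} → Nonneg x → Nonneg y → Nonneg (x * y)
Nonneg-* {x} {y} (nonneg p) (nonneg q) = nonneg λ ε ε>0 → scale ε ε>0 (bounded (x + y))
  where
  open ℚₚ.≤-Reasoning
  scale : ∀ ε → 0ℚ ℚ.< ε → ∃[ B ] (0ℚ ℚ.< B × Ev (λ n → ∣ seq x n ℚ.+ seq y n ∣ ℚ.≤ B)) →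
          Ev (λ n → 0ℚ ℚ.≤ seq x n ℚ.* seq y n ℚ.+ ε)
  scale ε ε>0 (B , B>0 , sB) = Ev-zip (λ n a bc → step n a (proj₁ bc) (proj₂ bc)) (p δ δ>0)
      (Ev-zip (λ n b c → b , c) (q δ δ>0) sB)
    where
    D = B ℚ.+ 1ℚ
    D>0 : 0ℚ ℚ.< D
    D>0 = ℚₚ.+-mono-< B>0 (ℚₚ.positive⁻¹ 1ℚ)
    δ₀ = inv D ℚ.* ε
    -- The cap at 1 makes `x + y + δ` at most `B + 1`, which is `D`; the first argument then makes
    -- the error `δ D` at most `ε`.
    δ = δ₀ ℚ.⊓ 1ℚ
    δ>0 : 0ℚ ℚ.< δ
    δ>0 with ℚₚ.⊓-sel δ₀ 1ℚ
    ... | inj₁ eq = subst (0ℚ ℚ.<_) (≡.sym eq) (*-pos (inv-pos D>0) ε>0)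
    ... | inj₂ eq = subst (0ℚ ℚ.<_) (≡.sym eq) (ℚₚ.positive⁻¹ 1ℚ)
    Dδ≤ε : δ ℚ.* D ℚ.≤ ε
    Dδ≤ε = begin
      δ ℚ.* D             ≤⟨ ℚₚ.*-monoʳ-≤-nonNeg D {{ℚ.nonNegative (ℚₚ.<⇒≤ D>0)}} (ℚₚ.p⊓q≤p δ₀ 1ℚ) ⟩
      inv D ℚ.* ε ℚ.* D   ≡⟨ solve 3 (λ i e d → i :* e :* d := d :* i :* e) refl (inv D) ε D ⟩
      D ℚ.* inv D ℚ.* ε   ≡⟨ cong (ℚ._* ε) (inv-inverse D (>⇒≢0 D>0)) ⟩
      1ℚ ℚ.* ε            ≡⟨ ℚₚ.*-identityˡ ε ⟩
      ε                   ∎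
    expand : ∀ a b d → (a ℚ.+ d) ℚ.* (b ℚ.+ d) ≡ a ℚ.* b ℚ.+ d ℚ.* (a ℚ.+ b ℚ.+ d)
    expand = solve 3 (λ a b d → (a :+ d) :* (b :+ d) := a :* b :+ d :* (a :+ b :+ d)) refl
    step : ∀ n → 0ℚ ℚ.≤ seq x n ℚ.+ δ → 0ℚ ℚ.≤ seq y n ℚ.+ δ → ∣ seq x n ℚ.+ seq y n ∣ ℚ.≤ B →
           0ℚ ℚ.≤ seq x n ℚ.* seq y n ℚ.+ ε
    step n a b c = begin
      0ℚ                                                                ≤⟨ *-nonneg a b ⟩
      (seq x n ℚ.+ δ) ℚ.* (seq y n ℚ.+ δ)                               ≡⟨ expand (seq x n) (seq y n) δ ⟩
      seq x n ℚ.* seq y n ℚ.+ δ ℚ.* (seq x n ℚ.+ seq y n ℚ.+ δ)         ≤⟨ ℚₚ.+-monoʳ-≤ (seq x n ℚ.* seq y n)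
        (ℚₚ.≤-trans (ℚₚ.*-monoˡ-≤-nonNeg δ {{ℚ.nonNegative (ℚₚ.<⇒≤ δ>0)}}
          (ℚₚ.+-mono-≤ (ℚₚ.≤-trans (q≤∣q∣ _) c) (ℚₚ.p⊓q≤q δ₀ 1ℚ))) Dδ≤ε) ⟩
      seq x n ℚ.* seq y n ℚ.+ ε                                         ∎

-- Up to arbitrarily small errors, `x` is squeezed between 0 and `x + y`.
Nonneg-+-zeroˡ : ∀ {x y} → Nonneg x → Nonneg y → x + y ≃ 0ℝ → x ≃ 0ℝ
Nonneg-+-zeroˡ {x} {y} (nonneg p) (nonneg q) (wrap e) = wrap λ ε ε>0 →
  Ev-zip (λ n ab c → step ε ε>0 n (proj₁ ab) (proj₂ ab) c)
    (Ev-zip (λ n a b → a , b) (p _ (half-pos ε>0)) (q _ (half-pos ε>0))) (e _ (half-pos ε>0))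
  where
  open ℚₚ.≤-Reasoning
  halve : ∀ {ε} → 0ℚ ℚ.< ε → ½ ℚ.* ε ℚ.< ε
  halve {ε} ε>0 = subst (½ ℚ.* ε ℚ.<_) (two-halves ε)
    (subst (ℚ._< ½ ℚ.* ε ℚ.+ ½ ℚ.* ε) (ℚₚ.+-identityʳ _) (ℚₚ.+-monoʳ-< (½ ℚ.* ε) (half-pos ε>0)))
  step : ∀ ε → 0ℚ ℚ.< ε → ∀ n → 0ℚ ℚ.≤ seq x n ℚ.+ ½ ℚ.* ε → 0ℚ ℚ.≤ seq y n ℚ.+ ½ ℚ.* ε →
         ∣ seq x n ℚ.+ seq y n ℚ.- 0ℚ ∣ ℚ.< ½ ℚ.* ε → ∣ seq x n ℚ.- 0ℚ ∣ ℚ.< ε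
  step ε ε>0 n a b c = subst (λ z → ∣ z ∣ ℚ.< ε) (≡.sym (ℚₚ.+-identityʳ (seq x n))) goal
    where
    upper : seq x n ℚ.< ε
    upper = begin-strict
      seq x n                                       ≡⟨ r (seq x n) ⟩
      seq x n ℚ.+ 0ℚ                                ≤⟨ ℚₚ.+-monoʳ-≤ (seq x n) b ⟩
      seq x n ℚ.+ (seq y n ℚ.+ ½ ℚ.* ε)             ≡⟨ s (seq x n) (seq y n) (½ ℚ.* ε) ⟩
      seq x n ℚ.+ seq y n ℚ.- 0ℚ ℚ.+ ½ ℚ.* ε        <⟨ ℚₚ.+-monoˡ-< (½ ℚ.* ε) (ℚₚ.≤-<-trans (q≤∣q∣ _) c) ⟩
      ½ ℚ.* ε ℚ.+ ½ ℚ.* ε                           ≡⟨ two-halves ε ⟩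
      ε                                             ∎
      where
      r : ∀ a → a ≡ a ℚ.+ 0ℚ
      r a = ≡.sym (ℚₚ.+-identityʳ a)
      s : ∀ a b h → a ℚ.+ (b ℚ.+ h) ≡ a ℚ.+ b ℚ.- 0ℚ ℚ.+ h
      s = solve 3 (λ a b h → a :+ (b :+ h) := a :+ b :- con 0ℚ :+ h) refl
    lower : ℚ.- seq x n ℚ.< ε
    lower = begin-strict
      ℚ.- seq x n                                    ≡⟨ ℚₚ.+-identityʳ _ ⟨
      ℚ.- seq x n ℚ.+ 0ℚ                             ≤⟨ ℚₚ.+-monoʳ-≤ (ℚ.- seq x n) a ⟩
      ℚ.- seq x n ℚ.+ (seq x n ℚ.+ ½ ℚ.* ε)          ≡⟨ s (seq x n) (½ ℚ.* ε) ⟩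
      ½ ℚ.* ε                                        <⟨ halve ε>0 ⟩
      ε                                              ∎
      where
      s : ∀ a h → ℚ.- a ℚ.+ (a ℚ.+ h) ≡ h
      s = solve 2 (λ a h → :- a :+ (a :+ h) := h) refl
    goal : ∣ seq x n ∣ ℚ.< ε
    goal with ℚₚ.∣p∣≡p∨∣p∣≡-p (seq x n)
    ... | inj₁ eq = subst (ℚ._< ε) (≡.sym eq) upper
    ... | inj₂ eq = subst (ℚ._< ε) (≡.sym eq) lower

Nonneg-+-zeroʳ : ∀ {x y} → Nonneg x → Nonneg y → x + y ≃ 0ℝ → y ≃ 0ℝ
Nonneg-+-zeroʳ {x} {y} p q e = Nonneg-+-zeroˡ q p (≃-trans (≃-pointwise λ n → ℚₚ.+-comm (seq y n) (seq x n)) e)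

Nonneg-∑-zero : ∀ {n} {f : Fin n → ℝ} → (∀ i → Nonneg (f i)) → ∑ f ≃ 0ℝ → ∀ i → f i ≃ 0ℝ
Nonneg-∑-zero p e zero = Nonneg-+-zeroˡ (p zero) (Nonneg-∑ (λ i → p (suc i))) e
Nonneg-∑-zero p e (suc i) =
  Nonneg-∑-zero (λ i → p (suc i)) (Nonneg-+-zeroʳ (p zero) (Nonneg-∑ (λ i → p (suc i))) e) i

-- Finite types and rational linear algebra

module Enumerated {A : Set} {n : ℕ} (enum : Fin n ↔ A) where
  open Inverse enum public using (to; from)

  to-from : ∀ a → to (from a) ≡ a
  to-from a = Inverse.inverseˡ enum refl

  from-to : ∀ i → from (to i) ≡ i
  from-to i = Inverse.inverseʳ enum refl

  to-injective : ∀ {i j} → to i ≡ to j → i ≡ j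
  to-injective {i} {j} eq = ≡.trans (≡.sym (from-to i)) (≡.trans (cong from eq) (from-to j))

  _≟_ : DecidableEquality A
  a ≟ b = map′ (λ eq → ≡.trans (≡.sym (to-from a)) (≡.trans (cong to eq) (to-from b))) (cong from) (from a Finₚ.≟ from b)

  any? : ∀ {P : A → Set} → (∀ a → Dec (P a)) → Dec (∃[ a ] P a)
  any? {P} P? = map′ (λ (i , p) → to i , p) (λ (a , p) → from a , subst P (≡.sym (to-from a)) p) (Finₚ.any? (P? ∘ to))

argmin-Fin : ∀ n (P : Fin n → Set) → (∀ i → Dec (P i)) → (f : Fin n → ℚ) →
  (∀ i → ¬ P i) ⊎ (∃[ i ] (P i × (∀ j → P j → f i ℚ.≤ f j)))
argmin-Fin zero P P? f = inj₁ λ ()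
argmin-Fin (suc n) P P? f with P? zero | argmin-Fin n (P ∘ suc) (P? ∘ suc) (f ∘ suc)
... | no ¬p | inj₁ none = inj₁ λ { zero → ¬p ; (suc i) → none i }
... | no ¬p | inj₂ (i , p , least) = inj₂ (suc i , p , λ { zero q → ⊥-elim (¬p q) ; (suc j) q → least j q })
... | yes p | inj₁ none = inj₂ (zero , p , λ { zero _ → ℚₚ.≤-refl ; (suc j) q → ⊥-elim (none j q) })
... | yes p | inj₂ (i , q , least) with ℚₚ.≤-total (f zero) (f (suc i))
...   | inj₁ le = inj₂ (zero , p , λ { zero _ → ℚₚ.≤-refl ; (suc j) r → ℚₚ.≤-trans le (least j r) })
...   | inj₂ ge = inj₂ (suc i , q , λ { zero _ → ge ; (suc j) r → least j r })

-- The ratio tests of `facet-cone` and `closure-combination` look for the first hyperplane met by a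
-- ray, which is a minimum over a decidable nonempty subset.
argmin : ∀ {A : Set} {n} → Fin n ↔ A → (P : A → Set) → (∀ a → Dec (P a)) → (f : A → ℚ) →
  ∃[ a ] P a → ∃[ a ] (P a × (∀ b → P b → f a ℚ.≤ f b))
argmin {n = n} enum P P? f (a , p) with argmin-Fin n (P ∘ Inverse.to enum) (λ i → P? _) (f ∘ Inverse.to enum)
... | inj₁ none = ⊥-elim (none (from a) (subst P (≡.sym (to-from a)) p))
  where open Enumerated enum
... | inj₂ (i , q , least) = to i , q , λ b r → subst (λ c → f (to i) ℚ.≤ f c) (to-from b) (least (from b) (subst P (≡.sym (to-from b)) r))
  where open Enumerated enum

_×-enum_ : ∀ {A B : Set} {m n} → Fin m ↔ A → Fin n ↔ B → Fin (m ℕ.* n) ↔ (A × B)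
a ×-enum b = (a ×-↔ b) ↔-∘ Finₚ.*↔×

Q⁵ : Set
Q⁵ = Fin 5 → ℚ

∑q-lin : ∀ {n} (f x y : Fin n → ℚ) α β →
  ∑q (λ j → f j ℚ.* (α ℚ.* x j ℚ.+ β ℚ.* y j)) ≡ α ℚ.* ∑q (λ j → f j ℚ.* x j) ℚ.+ β ℚ.* ∑q (λ j → f j ℚ.* y j)
∑q-lin {zero} f x y α β = solve 2 (λ α β → con 0ℚ := α :* con 0ℚ :+ β :* con 0ℚ) refl α β
∑q-lin {suc n} f x y α β = ≡.trans (cong (f zero ℚ.* (α ℚ.* x zero ℚ.+ β ℚ.* y zero) ℚ.+_) (∑q-lin (f ∘ suc) (x ∘ suc) (y ∘ suc) α β))
  (rearrange α β (f zero) (x zero) (y zero) _ _)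
  where
  rearrange : ∀ α β c x y p q → c ℚ.* (α ℚ.* x ℚ.+ β ℚ.* y) ℚ.+ (α ℚ.* p ℚ.+ β ℚ.* q)
            ≡ α ℚ.* (c ℚ.* x ℚ.+ p) ℚ.+ β ℚ.* (c ℚ.* y ℚ.+ q)
  rearrange = solve 7 (λ α β c x y p q → c :* (α :* x :+ β :* y) :+ (α :* p :+ β :* q)
            := α :* (c :* x :+ p) :+ β :* (c :* y :+ q)) refl

abstract

  -- Abstract, so that a pairing stays an atom that is handled by linearity alone; `⟨⟩-unfold` gives
  -- access to the sum where concrete vectors are evaluated.
  ⟨_,_⟩ : Q⁵ → Q⁵ → ℚ
  ⟨ f , x ⟩ = ∑q (λ j → f j ℚ.* x j)

  ⟨⟩-unfold : ∀ f x → ⟨ f , x ⟩ ≡ ∑q (λ j → f j ℚ.* x j)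
  ⟨⟩-unfold f x = refl

  ⟨⟩-cong : ∀ f {x y} → (∀ j → x j ≡ y j) → ⟨ f , x ⟩ ≡ ⟨ f , y ⟩
  ⟨⟩-cong f eq = ℚ-Sum.sum-cong-≗ {5} (λ j → cong (f j ℚ.*_) (eq j))

  ⟨⟩-comm : ∀ f x → ⟨ f , x ⟩ ≡ ⟨ x , f ⟩
  ⟨⟩-comm f x = ℚ-Sum.sum-cong-≗ {5} (λ j → ℚₚ.*-comm (f j) (x j))

  ⟨⟩-lin : ∀ f α x β y → ⟨ f , (λ j → α ℚ.* x j ℚ.+ β ℚ.* y j) ⟩ ≡ α ℚ.* ⟨ f , x ⟩ ℚ.+ β ℚ.* ⟨ f , y ⟩
  ⟨⟩-lin f α x β y = ∑q-lin f x y α β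

  ⟨⟩-zero : ∀ f → ⟨ f , (λ _ → 0ℚ) ⟩ ≡ 0ℚ
  ⟨⟩-zero f = ≡.trans (ℚ-Sum.sum-cong-≗ {5} (λ j → ℚₚ.*-zeroʳ (f j))) (ℚ-Sum.sum-replicate-zero 5)

⟨⟩-+ : ∀ f x y → ⟨ f , (λ j → x j ℚ.+ y j) ⟩ ≡ ⟨ f , x ⟩ ℚ.+ ⟨ f , y ⟩
⟨⟩-+ f x y = ≡.trans (⟨⟩-cong f (λ j → cong₂ ℚ._+_ (≡.sym (ℚₚ.*-identityˡ (x j))) (≡.sym (ℚₚ.*-identityˡ (y j)))))
  (≡.trans (⟨⟩-lin f 1ℚ x 1ℚ y) (cong₂ ℚ._+_ (ℚₚ.*-identityˡ ⟨ f , x ⟩) (ℚₚ.*-identityˡ ⟨ f , y ⟩)))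

⟨⟩-scale : ∀ f α x → ⟨ f , (λ j → α ℚ.* x j) ⟩ ≡ α ℚ.* ⟨ f , x ⟩
⟨⟩-scale f α x = ≡.trans (⟨⟩-cong f (λ j → pad (α ℚ.* x j) (x j)))
  (≡.trans (⟨⟩-lin f α x 0ℚ x) (≡.sym (pad (α ℚ.* ⟨ f , x ⟩) ⟨ f , x ⟩)))
  where
  pad : ∀ a b → a ≡ a ℚ.+ 0ℚ ℚ.* b
  pad = solve 2 (λ a b → a := a :+ con 0ℚ :* b) refl

⟨⟩-∑ : ∀ f {n} (x : Fin n → Q⁵) → ⟨ f , (λ j → ∑q (λ a → x a j)) ⟩ ≡ ∑q (λ a → ⟨ f , x a ⟩)
⟨⟩-∑ f {zero} x = ⟨⟩-zero f
⟨⟩-∑ f {suc n} x = ≡.trans (⟨⟩-+ f (x zero) (λ j → ∑q (λ a → x (suc a) j))) (cong (⟨ f , x zero ⟩ ℚ.+_) (⟨⟩-∑ f (x ∘ suc)))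

≤∧≢⇒< : ∀ {q} → 0ℚ ℚ.≤ q → q ≢ 0ℚ → 0ℚ ℚ.< q
≤∧≢⇒< {q} q≥0 q≢0 = ℚₚ.≰⇒> λ q≤0 → q≢0 (ℚₚ.≤-antisym q≤0 q≥0)

*-cancel-zero : ∀ p q → q ≢ 0ℚ → p ℚ.* q ≡ 0ℚ → p ≡ 0ℚ
*-cancel-zero p q q≢0 eq = ≡.trans (≡.sym (ℚₚ.*-identityʳ p)) (≡.trans (cong (p ℚ.*_) (≡.sym (inv-inverse q q≢0)))
  (≡.trans (≡.sym (ℚₚ.*-assoc p q (inv q))) (≡.trans (cong (ℚ._* inv q) eq) (ℚₚ.*-zeroˡ (inv q)))))

≤⇒0≤- : ∀ {p q} → p ℚ.≤ q → 0ℚ ℚ.≤ q ℚ.- p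
≤⇒0≤- {p} {q} le = subst (ℚ._≤ q ℚ.- p) (ℚₚ.+-inverseʳ p) (ℚₚ.+-monoˡ-≤ (ℚ.- p) le)

∑q-nonneg : ∀ {n} {f : Fin n → ℚ} → (∀ i → 0ℚ ℚ.≤ f i) → 0ℚ ℚ.≤ ∑q f
∑q-nonneg {zero} p = ℚₚ.≤-refl
∑q-nonneg {suc n} p = +-nonneg (p zero) (∑q-nonneg (p ∘ suc))

+-zeroˡ : ∀ {p q} → 0ℚ ℚ.≤ p → 0ℚ ℚ.≤ q → p ℚ.+ q ≡ 0ℚ → p ≡ 0ℚ
+-zeroˡ {p} {q} p≥0 q≥0 eq = ℚₚ.≤-antisym
  (subst (p ℚ.≤_) eq (subst (ℚ._≤ p ℚ.+ q) (ℚₚ.+-identityʳ p) (ℚₚ.+-monoʳ-≤ p q≥0))) p≥0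

+-zeroʳ : ∀ {p q} → 0ℚ ℚ.≤ p → 0ℚ ℚ.≤ q → p ℚ.+ q ≡ 0ℚ → q ≡ 0ℚ
+-zeroʳ {p} {q} p≥0 q≥0 eq = +-zeroˡ q≥0 p≥0 (≡.trans (ℚₚ.+-comm q p) eq)

∑q-zero : ∀ {n} {f : Fin n → ℚ} → (∀ i → 0ℚ ℚ.≤ f i) → ∑q f ≡ 0ℚ → ∀ i → f i ≡ 0ℚ
∑q-zero p eq zero = +-zeroˡ (p zero) (∑q-nonneg (p ∘ suc)) eq
∑q-zero p eq (suc i) = ∑q-zero (p ∘ suc) (+-zeroʳ (p zero) (∑q-nonneg (p ∘ suc)) eq) i

∑q-single : ∀ {n} (f : Fin n → ℚ) i → (∀ k → k ≢ i → f k ≡ 0ℚ) → ∑q f ≡ f i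
∑q-single {suc n} f i zeros = ≡.trans (ℚ-Sum.sum-remove {i = i} f)
  (≡.trans (cong (f i ℚ.+_) (≡.trans (ℚ-Sum.sum-cong-≗ {n} (λ b → zeros (punchIn i b) (Finₚ.punchInᵢ≢i i b)))
    (ℚ-Sum.sum-replicate-zero n))) (ℚₚ.+-identityʳ _))

indicator : ∀ {n} → Fin n → Fin n → ℚ
indicator i k with k Finₚ.≟ i
... | yes _ = 1ℚ
... | no _ = 0ℚ

indicator-self : ∀ {n} (i : Fin n) → indicator i i ≡ 1ℚ
indicator-self i with i Finₚ.≟ i
... | yes _ = refl
... | no i≢i = ⊥-elim (i≢i refl)

indicator-other : ∀ {n} {i k : Fin n} → k ≢ i → indicator i k ≡ 0ℚ
indicator-other {i = i} {k} k≢i with k Finₚ.≟ i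
... | yes k≡i = ⊥-elim (k≢i k≡i)
... | no _ = refl

indicator-nonneg : ∀ {n} (i k : Fin n) → 0ℚ ℚ.≤ indicator i k
indicator-nonneg i k with k Finₚ.≟ i
... | yes _ = ℚₚ.<⇒≤ (ℚₚ.positive⁻¹ 1ℚ)
... | no _ = ℚₚ.≤-refl

dependent : ∀ n (x : Fin (suc n) → Fin n → ℚ) →
  Σ[ c ∈ (Fin (suc n) → ℚ) ] (∃[ i ] c i ≢ 0ℚ) × (∀ j → ∑q (λ i → c i ℚ.* x i j) ≡ 0ℚ)
dependent zero x = (λ _ → 1ℚ) , (zero , λ ()) , λ ()
dependent (suc n) x with Finₚ.any? (λ i → ¬? (x i zero ℚₚ.≟ 0ℚ))
... | no none = (λ { zero → 0ℚ ; (suc i) → c i }) , (let i , ci≢0 = nz in suc i , ci≢0) , λ j →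
        ≡.trans (cong₂ ℚ._+_ (ℚₚ.*-zeroˡ (x zero j)) (vanish j)) (ℚₚ.+-identityʳ 0ℚ)
  where
  rest = dependent n (λ i j → x (suc i) (suc j))
  c = proj₁ rest
  nz = proj₁ (proj₂ rest)
  first : ∀ i → x i zero ≡ 0ℚ
  first i with x i zero ℚₚ.≟ 0ℚ
  ... | yes p = p
  ... | no ¬p = ⊥-elim (none (i , ¬p))
  vanish : ∀ j → ∑q (λ i → c i ℚ.* x (suc i) j) ≡ 0ℚ
  vanish zero = ≡.trans (ℚ-Sum.sum-cong-≗ {suc n} (λ i → ≡.trans (cong (c i ℚ.*_) (first (suc i))) (ℚₚ.*-zeroʳ (c i)))) (ℚ-Sum.sum-replicate-zero (suc n))
  vanish (suc j) = proj₂ (proj₂ rest) j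
... | yes (p , xp≢0) = d , nonzero , relation
  where
  a = x p zero
  others : Fin (suc n) → Fin (suc n) → ℚ
  others b = x (punchIn p b)
  y : Fin (suc n) → Fin n → ℚ
  y b j = a ℚ.* others b (suc j) ℚ.- others b zero ℚ.* x p (suc j)
  rest = dependent n y
  c : Fin (suc n) → ℚ
  c = proj₁ rest
  s₀ = ∑q (λ b → c b ℚ.* others b zero)
  d : Fin (suc (suc n)) → ℚ
  -- The pivot gets the coefficient that cancels the first coordinates of the rest; the factor `a`
  -- on the others avoids a division.
  d = insertAt (λ b → c b ℚ.* a) p (ℚ.- s₀)
  d-at : d p ≡ ℚ.- s₀
  d-at = insertAt-lookup (λ b → c b ℚ.* a) p (ℚ.- s₀)
  d-off : ∀ b → d (punchIn p b) ≡ c b ℚ.* a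
  d-off = insertAt-punchIn (λ b → c b ℚ.* a) p (ℚ.- s₀)
  nonzero : ∃[ i ] d i ≢ 0ℚ
  nonzero = let b , cb≢0 = proj₁ (proj₂ rest) in punchIn p b , λ eq →
    cb≢0 (*-cancel-zero (c b) a xp≢0 (≡.trans (≡.sym (d-off b)) eq))
  expand : ∀ {m} (c w z : Fin m → ℚ) u → ℚ.- ∑q (λ b → c b ℚ.* w b) ℚ.* u ℚ.+ ∑q (λ b → c b ℚ.* a ℚ.* z b)
         ≡ ∑q (λ b → c b ℚ.* (a ℚ.* z b ℚ.- w b ℚ.* u))
  expand {zero} c w z u = solve 1 (λ u → :- con 0ℚ :* u :+ con 0ℚ := con 0ℚ) refl u
  expand {suc m} c w z u = ≡.trans (step (c zero) (w zero) (z zero) u a (∑q (λ b → c (suc b) ℚ.* w (suc b))) (∑q (λ b → c (suc b) ℚ.* a ℚ.* z (suc b))))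
      (cong (c zero ℚ.* (a ℚ.* z zero ℚ.- w zero ℚ.* u) ℚ.+_) (expand (c ∘ suc) (w ∘ suc) (z ∘ suc) u))
    where
    step : ∀ c w z u a p q → ℚ.- (c ℚ.* w ℚ.+ p) ℚ.* u ℚ.+ (c ℚ.* a ℚ.* z ℚ.+ q) ≡ c ℚ.* (a ℚ.* z ℚ.- w ℚ.* u) ℚ.+ (ℚ.- p ℚ.* u ℚ.+ q)
    step = solve 7 (λ c w z u a p q → :- (c :* w :+ p) :* u :+ (c :* a :* z :+ q) := c :* (a :* z :- w :* u) :+ (:- p :* u :+ q)) refl
  relation : ∀ j → ∑q (λ i → d i ℚ.* x i j) ≡ 0ℚ
  relation j = ≡.trans (ℚ-Sum.sum-remove {i = p} (λ i → d i ℚ.* x i j))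
    (≡.trans (cong₂ ℚ._+_ (cong (ℚ._* x p j) d-at) (ℚ-Sum.sum-cong-≗ {suc n} (λ b → cong (ℚ._* others b j) (d-off b))))
      (≡.trans (expand c (λ b → others b zero) (λ b → others b j) (x p j)) (finish j)))
    where
    finish : ∀ j → ∑q (λ b → c b ℚ.* (a ℚ.* others b j ℚ.- others b zero ℚ.* x p j)) ≡ 0ℚ
    finish zero = ≡.trans (ℚ-Sum.sum-cong-≗ {suc n} (λ b → solve 3 (λ c a w → c :* (a :* w :- w :* a) := con 0ℚ) refl (c b) a (others b zero)))
      (ℚ-Sum.sum-replicate-zero (suc n))
    finish (suc j) = proj₂ (proj₂ rest) j

Independent : (Fin 5 → Q⁵) → Set
Independent x = ∀ (c : Fin 5 → ℚ) → (∀ j → ∑q (λ b → c b ℚ.* x b j) ≡ 0ℚ) → ∀ b → c b ≡ 0ℚ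

-- Six vectors of ℚ⁵ are dependent, and independence of the five forces the coefficient of `z` to be
-- nonzero, so the relation can be solved for `z`.
independent-spans : ∀ x → Independent x → ∀ z → Σ[ γ ∈ (Fin 5 → ℚ) ] (∀ j → z j ≡ ∑q (λ b → γ b ℚ.* x b j))
independent-spans x ind z = normalise (dependent 5 xs)
  where
  xs : Fin 6 → Q⁵
  xs zero = z
  xs (suc b) = x b
  normalise : Σ[ c ∈ (Fin 6 → ℚ) ] (∃[ i ] c i ≢ 0ℚ) × (∀ j → ∑q (λ i → c i ℚ.* xs i j) ≡ 0ℚ) →
              Σ[ γ ∈ (Fin 5 → ℚ) ] (∀ j → z j ≡ ∑q (λ b → γ b ℚ.* x b j))
  normalise (c , nz , rel) = (λ b → ℚ.- inv c₀ ℚ.* c (suc b)) , λ j → ≡.trans (isolate (z j) (tail j) (rel j))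
      (≡.trans (ℚ-Sum.*-distribˡ-sum (ℚ.- inv c₀) (λ b → c (suc b) ℚ.* x b j))
        (ℚ-Sum.sum-cong-≗ {5} (λ b → ≡.sym (ℚₚ.*-assoc (ℚ.- inv c₀) (c (suc b)) (x b j)))))
    where
    c₀ = c zero
    tail : Fin 5 → ℚ
    tail j = ∑q (λ b → c (suc b) ℚ.* x b j)
    c₀≢0 : c₀ ≢ 0ℚ
    c₀≢0 c₀≡0 = proj₂ nz (all-zero (proj₁ nz))
      where
      all-zero : ∀ i → c i ≡ 0ℚ
      all-zero zero = c₀≡0
      all-zero (suc b) = ind (c ∘ suc) (λ j → ≡.trans (≡.sym (≡.trans (cong (ℚ._+ tail j) (≡.trans (cong (ℚ._* z j) c₀≡0) (ℚₚ.*-zeroˡ (z j)))) (ℚₚ.+-identityˡ (tail j)))) (rel j)) b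
    isolate : ∀ u s → c₀ ℚ.* u ℚ.+ s ≡ 0ℚ → u ≡ ℚ.- inv c₀ ℚ.* s
    isolate u s eq = begin
      u                                               ≡⟨ solve 1 (λ u → u := con 1ℚ :* u) refl u ⟩
      1ℚ ℚ.* u                                        ≡⟨ cong (ℚ._* u) (inv-inverse c₀ c₀≢0) ⟨
      c₀ ℚ.* inv c₀ ℚ.* u                             ≡⟨ solve 4 (λ c i u s → c :* i :* u := i :* (c :* u :+ s) :+ :- i :* s) refl c₀ (inv c₀) u s ⟩
      inv c₀ ℚ.* (c₀ ℚ.* u ℚ.+ s) ℚ.+ ℚ.- inv c₀ ℚ.* s ≡⟨ cong (λ q → inv c₀ ℚ.* q ℚ.+ ℚ.- inv c₀ ℚ.* s) eq ⟩
      inv c₀ ℚ.* 0ℚ ℚ.+ ℚ.- inv c₀ ℚ.* s               ≡⟨ solve 2 (λ i s → i :* con 0ℚ :+ :- i :* s := :- i :* s) refl (inv c₀) s ⟩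
      ℚ.- inv c₀ ℚ.* s                                 ∎
      where open ≡.≡-Reasoning

⟨⟩-combination : ∀ f {n} (c : Fin n → ℚ) (z : Fin n → Q⁵) → ⟨ f , (λ j → ∑q (λ a → c a ℚ.* z a j)) ⟩ ≡ ∑q (λ a → c a ℚ.* ⟨ f , z a ⟩)
⟨⟩-combination f {n} c z = ≡.trans (⟨⟩-∑ f (λ a j → c a ℚ.* z a j)) (ℚ-Sum.sum-cong-≗ {n} (λ a → ⟨⟩-scale f (c a) (z a)))

⟨⟩-relation : ∀ f {n} (c : Fin n → ℚ) (z : Fin n → Q⁵) → (∀ j → ∑q (λ a → c a ℚ.* z a j) ≡ 0ℚ) → ∑q (λ a → c a ℚ.* ⟨ f , z a ⟩) ≡ 0ℚ
⟨⟩-relation f c z rel = ≡.trans (≡.sym (⟨⟩-combination f c z)) (≡.trans (⟨⟩-cong f rel) (⟨⟩-zero f))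

∑q-indicator : ∀ {n} (x : Fin n → ℚ) a → ∑q (λ b → x b ℚ.* indicator b a) ≡ x a
∑q-indicator x a = ≡.trans (∑q-single (λ b → x b ℚ.* indicator b a) a
    (λ b b≢a → ≡.trans (cong (x b ℚ.*_) (indicator-other (b≢a ∘ ≡.sym))) (ℚₚ.*-zeroʳ (x b))))
  (≡.trans (cong (x a ℚ.*_) (indicator-self a)) (ℚₚ.*-identityʳ (x a)))

dual-complete : ∀ (φ x : Fin 5 → Q⁵) → (∀ a b → ⟨ φ a , x b ⟩ ≡ indicator b a) → ∀ z j → z j ≡ ∑q (λ a → ⟨ φ a , z ⟩ ℚ.* x a j)
dual-complete φ x dual z j = ≡.trans (z≡ j) (ℚ-Sum.sum-cong-≗ {5} (λ a → cong (ℚ._* x a j)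
    (≡.sym (≡.trans (⟨⟩-cong (φ a) z≡) (≡.trans (⟨⟩-combination (φ a) γ x) (read γ a))))))
  where
  read : ∀ (c : Fin 5 → ℚ) a → ∑q (λ b → c b ℚ.* ⟨ φ a , x b ⟩) ≡ c a
  read c a = ≡.trans (ℚ-Sum.sum-cong-≗ {5} (λ b → cong (c b ℚ.*_) (dual a b))) (∑q-indicator c a)
  independent : Independent x
  independent c rel a = ≡.trans (≡.sym (read c a)) (⟨⟩-relation (φ a) c x rel)
  γ : Fin 5 → ℚ
  γ = proj₁ (independent-spans x independent z)
  z≡ = proj₂ (independent-spans x independent z)

-- Certificates: rational and combinatorial data of a polytope

other : Fin 2 → Fin 2
other 0F = 1F
other 1F = 0F

-- Homogeneous coordinates: a vertex is a ray in ℚ⁵, a facet a linear functional that is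
-- nonnegative on all vertices, and the affine polytope is the section chart = 1.
record Cert : Set₁ where
  field
    V E T Φ     : Set
    nV nE nT nΦ : ℕ
    enumV       : Fin nV ↔ V
    enumE       : Fin nE ↔ E
    enumT       : Fin nT ↔ T
    enumΦ       : Fin nΦ ↔ Φ
    vert        : V → Q⁵
    fac         : Φ → Q⁵
    chart       : Q⁵
    fac≥0       : ∀ g v → 0ℚ ℚ.≤ ⟨ fac g , vert v ⟩
    chart>0     : ∀ v → 0ℚ ℚ.< ⟨ chart , vert v ⟩
    vfun        : V → Q⁵
    vfun-self   : ∀ v → ⟨ vfun v , vert v ⟩ ≡ 0ℚ
    vfun-other  : ∀ v u → u ≢ v → 0ℚ ℚ.< ⟨ vfun v , vert u ⟩

  infix 4 _∈ᶠ_
  _∈ᶠ_ : V → Φ → Set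
  v ∈ᶠ g = ⟨ fac g , vert v ⟩ ≡ 0ℚ

  field
    out      : V → Φ
    out∌     : ∀ v → ¬ v ∈ᶠ out v

    end      : E → Fin 2 → V
    end-≢    : ∀ e → end e 0F ≢ end e 1F
    end-set  : ∀ e e′ → (∀ k → ∃[ l ] end e k ≡ end e′ l) → (∀ k → ∃[ l ] end e′ k ≡ end e l) → e ≡ e′
    tv       : T → Fin 3 → V
    tv-≢     : ∀ t {l m} → l ≢ m → tv t l ≢ tv t m
    tv-set   : ∀ t t′ → (∀ l → ∃[ m ] tv t l ≡ tv t′ m) → (∀ l → ∃[ m ] tv t′ l ≡ tv t m) → t ≡ t′

    ef       : E → Fin 3 → Φ
    ef-≢     : ∀ e {i j} → i ≢ j → ef e i ≢ ef e j
    ef∋      : ∀ e i k → end e k ∈ᶠ ef e i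
    ef-all   : ∀ e g → (∀ k → end e k ∈ᶠ g) → ∃[ i ] g ≡ ef e i
    ef-three : ∀ e w → (∀ i → w ∈ᶠ ef e i) → ∃[ k ] w ≡ end e k
    -- Two facets through `e` meet in a 2-face, which is a triangle with side `e`; a further common
    -- vertex is its third corner.
    ef-two   : ∀ e i j w → i ≢ j → w ∈ᶠ ef e i → w ∈ᶠ ef e j → (∃[ k ] w ≡ end e k) ⊎
               (∃[ t ] ((∀ k → ∃[ l ] end e k ≡ tv t l) × (∃[ l ] w ≡ tv t l) ×
                        (∀ l → (∃[ k ] tv t l ≡ end e k) ⊎ tv t l ≡ w)))
    -- Distinct facets meet in a face of dimension at most 2. Being at most a triangle, it has an
    -- edge between any two of its vertices.
    edge     : ∀ u w g g′ → u ≢ w → g ≢ g′ → u ∈ᶠ g → w ∈ᶠ g → u ∈ᶠ g′ → w ∈ᶠ g′ →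
               ∃[ e ] ((u ≡ end e 0F × w ≡ end e 1F) ⊎ (u ≡ end e 1F × w ≡ end e 0F))

    tf       : T → Fin 2 → Φ
    tf-≢     : ∀ t → tf t 0F ≢ tf t 1F
    tf∋      : ∀ t s l → tv t l ∈ᶠ tf t s
    tf-all   : ∀ t g → (∀ l → tv t l ∈ᶠ g) → ∃[ s ] g ≡ tf t s
    tf-two   : ∀ t w → (∀ s → w ∈ᶠ tf t s) → ∃[ l ] w ≡ tv t l
    -- Any two of the three facets at an edge share a triangle. This lets `facet-cone` step from a
    -- triangle of a facet to the triangles next to it.
    ef-adj   : ∀ e i j → i ≢ j → ∃[ t ] ∃[ s ] (tf t s ≡ ef e i × tf t (other s) ≡ ef e j)

    -- A triangle of each facet and a vertex of the facet off that triangle: together they witness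
    -- that facets are three-dimensional.
    base     : Φ → T
    side     : Φ → Fin 2
    base-tf  : ∀ g → tf (base g) (side g) ≡ g
    tip      : Φ → V
    tip∈     : ∀ g → tip g ∈ᶠ g
    tip∉     : ∀ g → ¬ tip g ∈ᶠ tf (base g) (other (side g))

  module VE = Enumerated enumV
  module ΦE = Enumerated enumΦ

  _∈ᶠ?_ : ∀ v g → Dec (v ∈ᶠ g)
  v ∈ᶠ? g = ⟨ fac g , vert v ⟩ ℚₚ.≟ 0ℚ

  ∉⇒> : ∀ {v g} → ¬ v ∈ᶠ g → 0ℚ ℚ.< ⟨ fac g , vert v ⟩
  ∉⇒> {v} {g} = ≤∧≢⇒< (fac≥0 g v)

  -- The triangle `base g` lies on `g` and on just one other facet, and `tip g` is a vertex of `g`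
  -- that this other facet misses.
  facet-⊆ : ∀ g g′ → (∀ v → v ∈ᶠ g → v ∈ᶠ g′) → g′ ≡ g
  facet-⊆ g g′ sub = decide (side g) (base-tf g) (tip∉ g)
      (tf-all (base g) g′ (λ l → sub _ (subst (tv (base g) l ∈ᶠ_) (base-tf g) (tf∋ (base g) (side g) l))))
    where
    decide : ∀ s → tf (base g) s ≡ g → ¬ tip g ∈ᶠ tf (base g) (other s) → ∃[ s′ ] g′ ≡ tf (base g) s′ → g′ ≡ g
    decide 0F eq _ (0F , eq′) = ≡.trans eq′ eq
    decide 1F eq _ (1F , eq′) = ≡.trans eq′ eq
    decide 0F eq ∉ (1F , eq′) = ⊥-elim (∉ (subst (tip g ∈ᶠ_) eq′ (sub _ (tip∈ g))))
    decide 1F eq ∉ (0F , eq′) = ⊥-elim (∉ (subst (tip g ∈ᶠ_) eq′ (sub _ (tip∈ g))))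

  -- The facet other than tf t 0 and tf t 1 through the edge of t opposite to its corner l.
  record Third (t : T) (l : Fin 3) : Set where
    field
      side-edge : E
      from-end  : ∀ m → ∃[ n ] end side-edge m ≡ tv t (punchIn l n)
      to-end    : ∀ n → ∃[ m ] tv t (punchIn l n) ≡ end side-edge m
      index     : Fin 2 → Fin 3
      tf-index  : ∀ s → tf t s ≡ ef side-edge (index s)
      free      : Fin 3
      free-≢    : ∀ s → index s ≢ free
      exhaust   : ∀ m → (∃[ s ] m ≡ index s) ⊎ m ≡ free

  private
    remaining : ∀ (i j : Fin 3) → i ≢ j → ∃[ k ] (i ≢ k × j ≢ k × (∀ m → m ≡ i ⊎ m ≡ j ⊎ m ≡ k))
    remaining 0F 0F ne = ⊥-elim (ne refl)
    remaining 1F 1F ne = ⊥-elim (ne refl)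
    remaining 2F 2F ne = ⊥-elim (ne refl)
    remaining 0F 1F _ = 2F , (λ ()) , (λ ()) , λ { 0F → inj₁ refl ; 1F → inj₂ (inj₁ refl) ; 2F → inj₂ (inj₂ refl) }
    remaining 1F 0F _ = 2F , (λ ()) , (λ ()) , λ { 1F → inj₁ refl ; 0F → inj₂ (inj₁ refl) ; 2F → inj₂ (inj₂ refl) }
    remaining 0F 2F _ = 1F , (λ ()) , (λ ()) , λ { 0F → inj₁ refl ; 2F → inj₂ (inj₁ refl) ; 1F → inj₂ (inj₂ refl) }
    remaining 2F 0F _ = 1F , (λ ()) , (λ ()) , λ { 2F → inj₁ refl ; 0F → inj₂ (inj₁ refl) ; 1F → inj₂ (inj₂ refl) }
    remaining 1F 2F _ = 0F , (λ ()) , (λ ()) , λ { 1F → inj₁ refl ; 2F → inj₂ (inj₁ refl) ; 0F → inj₂ (inj₂ refl) }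
    remaining 2F 1F _ = 0F , (λ ()) , (λ ()) , λ { 2F → inj₁ refl ; 1F → inj₂ (inj₁ refl) ; 0F → inj₂ (inj₂ refl) }

  abstract
    third : ∀ t l → Third t l
    third t l = build (edge u w (tf t 0F) (tf t 1F) u≢w (tf-≢ t)
      (tf∋ t 0F (punchIn l 0F)) (tf∋ t 0F (punchIn l 1F)) (tf∋ t 1F (punchIn l 0F)) (tf∋ t 1F (punchIn l 1F)))
      where
      u w : V
      u = tv t (punchIn l 0F)
      w = tv t (punchIn l 1F)
      u≢w : u ≢ w
      u≢w = tv-≢ t λ eq → 0≢1 (Finₚ.punchIn-injective l 0F 1F eq)
        where
        0≢1 : _≢_ {A = Fin 2} 0F 1F
        0≢1 ()
      finish : ∀ e → (∀ m → ∃[ n ] end e m ≡ tv t (punchIn l n)) → (∀ n → ∃[ m ] tv t (punchIn l n) ≡ end e m) → Third t l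
      finish e from to = assemble (remaining (proj₁ (idx 0F)) (proj₁ (idx 1F)) distinct)
        where
        idx : ∀ s → ∃[ i ] tf t s ≡ ef e i
        idx s = ef-all e (tf t s) λ m → subst (_∈ᶠ tf t s) (≡.sym (proj₂ (from m))) (tf∋ t s (punchIn l (proj₁ (from m))))
        distinct : proj₁ (idx 0F) ≢ proj₁ (idx 1F)
        distinct eq = tf-≢ t (≡.trans (proj₂ (idx 0F)) (≡.trans (cong (ef e) eq) (≡.sym (proj₂ (idx 1F)))))
        assemble : ∃[ k ] (proj₁ (idx 0F) ≢ k × proj₁ (idx 1F) ≢ k × (∀ m → m ≡ proj₁ (idx 0F) ⊎ m ≡ proj₁ (idx 1F) ⊎ m ≡ k)) → Third t l
        assemble (k , p , q , ex) = record
          { side-edge = e ; from-end = from ; to-end = to ; index = proj₁ ∘ idx ; tf-index = proj₂ ∘ idx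
          ; free = k ; free-≢ = λ { 0F → p ; 1F → q } ; exhaust = λ m → regroup m (ex m) }
          where
          regroup : ∀ m → m ≡ proj₁ (idx 0F) ⊎ m ≡ proj₁ (idx 1F) ⊎ m ≡ k → (∃[ s ] m ≡ proj₁ (idx s)) ⊎ m ≡ k
          regroup m (inj₁ r) = inj₁ (0F , r)
          regroup m (inj₂ (inj₁ r)) = inj₁ (1F , r)
          regroup m (inj₂ (inj₂ r)) = inj₂ r
      build : ∃[ e ] ((u ≡ end e 0F × w ≡ end e 1F) ⊎ (u ≡ end e 1F × w ≡ end e 0F)) → Third t l
      build (e , inj₁ (p , q)) = finish e (λ { 0F → 0F , ≡.sym p ; 1F → 1F , ≡.sym q }) (λ { 0F → 0F , p ; 1F → 1F , q })
      build (e , inj₂ (p , q)) = finish e (λ { 1F → 0F , ≡.sym p ; 0F → 1F , ≡.sym q }) (λ { 0F → 1F , p ; 1F → 0F , q })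

  th : T → Fin 3 → Φ
  th t l = ef side-edge free
    where open Third (third t l)

  th∋ : ∀ t {l m} → l ≢ m → tv t m ∈ᶠ th t l
  th∋ t {l} {m} l≢m = subst (_∈ᶠ th t l) (≡.trans (≡.sym (proj₂ (to-end n))) (cong (tv t) (Finₚ.punchIn-punchOut l≢m)))
      (ef∋ side-edge free (proj₁ (to-end n)))
    where
    open Third (third t l)
    n = punchOut l≢m

  -- Otherwise corner `l` would lie on all three facets through the opposite edge, and their only
  -- common vertices are the ends of that edge.
  th∌ : ∀ t l → ¬ tv t l ∈ᶠ th t l
  th∌ t l l∈ = let m , eq = ef-three side-edge (tv t l) (λ i → all i (exhaust i))
                   n , eq′ = from-end m
               in tv-≢ t (λ eq → Finₚ.punchInᵢ≢i l n (≡.sym eq)) (≡.trans eq eq′)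
    where
    open Third (third t l)
    all : ∀ i → (∃[ s ] i ≡ index s) ⊎ i ≡ free → tv t l ∈ᶠ ef side-edge i
    all i (inj₁ (s , refl)) = subst (tv t l ∈ᶠ_) (tf-index s) (tf∋ t s l)
    all i (inj₂ refl) = l∈

  th-adj : ∀ t s l → ∃[ t′ ] ∃[ s′ ] (tf t′ s′ ≡ tf t s × tf t′ (other s′) ≡ th t l)
  th-adj t s l = let t′ , s′ , eq , eq′ = ef-adj side-edge (index s) free (free-≢ s)
                 in t′ , s′ , ≡.trans eq (≡.sym (tf-index s)) , eq′
    where open Third (third t l)

  private
    beside : ∀ g h → h ≢ g → ∃[ v ] (v ∈ᶠ g × ¬ v ∈ᶠ h)
    beside g h h≢g with VE.any? (λ v → (v ∈ᶠ? g) ×-dec ¬? (v ∈ᶠ? h))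
    ... | yes found = found
    ... | no none = ⊥-elim (h≢g (facet-⊆ g h inside))
      where
      inside : ∀ v → v ∈ᶠ g → v ∈ᶠ h
      inside v v∈g with v ∈ᶠ? h
      ... | yes v∈h = v∈h
      ... | no v∉h = ⊥-elim (none (v , v∈g , v∉h))

  -- The corners of t and one further vertex on each of its two facets form a basis of ℚ⁵.
  tf-span : ∀ t x → (∀ s → ⟨ fac (tf t s) , x ⟩ ≡ 0ℚ) →
    Σ[ α ∈ (Fin 3 → ℚ) ] (∀ j → x j ≡ ∑q (λ l → α l ℚ.* vert (tv t l) j))
  tf-span t x x∈t = (λ l → γ (suc (suc l))) , λ j → ≡.trans (x≡ j)
      (≡.trans (cong₂ (λ a b → a ℚ.* vert p j ℚ.+ (b ℚ.* vert q j ℚ.+ ∑q (λ l → γ (suc (suc l)) ℚ.* vert (tv t l) j))) γ₀ γ₁)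
        (solve 3 (λ a b c → con 0ℚ :* a :+ (con 0ℚ :* b :+ c) := c) refl (vert p j) (vert q j) (∑q (λ l → γ (suc (suc l)) ℚ.* vert (tv t l) j))))
    where
    f₀ = fac (tf t 0F)
    f₁ = fac (tf t 1F)
    P = beside (tf t 1F) (tf t 0F) (tf-≢ t)
    Q = beside (tf t 0F) (tf t 1F) (tf-≢ t ∘ ≡.sym)
    p = proj₁ P
    q = proj₁ Q
    b : Fin 5 → Q⁵
    b 0F = vert p
    b 1F = vert q
    b (suc (suc l)) = vert (tv t l)
    read₀ : ∀ (c : Fin 5 → ℚ) → ∑q (λ a → c a ℚ.* ⟨ f₀ , b a ⟩) ≡ c 0F ℚ.* ⟨ f₀ , vert p ⟩
    read₀ c = ∑q-single (λ a → c a ℚ.* ⟨ f₀ , b a ⟩) 0F λ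
      { 0F ne → ⊥-elim (ne refl)
      ; 1F _ → ≡.trans (cong (c 1F ℚ.*_) (proj₁ (proj₂ Q))) (ℚₚ.*-zeroʳ (c 1F))
      ; (suc (suc l)) _ → ≡.trans (cong (c (suc (suc l)) ℚ.*_) (tf∋ t 0F l)) (ℚₚ.*-zeroʳ (c (suc (suc l)))) }
    read₁ : ∀ (c : Fin 5 → ℚ) → ∑q (λ a → c a ℚ.* ⟨ f₁ , b a ⟩) ≡ c 1F ℚ.* ⟨ f₁ , vert q ⟩
    read₁ c = ∑q-single (λ a → c a ℚ.* ⟨ f₁ , b a ⟩) 1F λ
      { 1F ne → ⊥-elim (ne refl)
      ; 0F _ → ≡.trans (cong (c 0F ℚ.*_) (proj₁ (proj₂ P))) (ℚₚ.*-zeroʳ (c 0F))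
      ; (suc (suc l)) _ → ≡.trans (cong (c (suc (suc l)) ℚ.*_) (tf∋ t 1F l)) (ℚₚ.*-zeroʳ (c (suc (suc l)))) }
    -- A triangular system: `f₀` isolates the coefficient of `p` and `f₁` that of `q`. Once these
    -- are gone, `th t l`, whose values at `p` and `q` are unknown, isolates the coefficient of
    -- corner `l`.
    independent : Independent b
    independent c rel = λ { 0F → c₀ ; 1F → c₁ ; (suc (suc l)) → cₗ l }
      where
      c₀ : c 0F ≡ 0ℚ
      c₀ = *-cancel-zero (c 0F) ⟨ f₀ , vert p ⟩ (proj₂ (proj₂ P)) (≡.trans (≡.sym (read₀ c)) (⟨⟩-relation f₀ c b rel))
      c₁ : c 1F ≡ 0ℚ
      c₁ = *-cancel-zero (c 1F) ⟨ f₁ , vert q ⟩ (proj₂ (proj₂ Q)) (≡.trans (≡.sym (read₁ c)) (⟨⟩-relation f₁ c b rel))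
      cₗ : ∀ l → c (suc (suc l)) ≡ 0ℚ
      cₗ l = *-cancel-zero (c (suc (suc l))) ⟨ h , vert (tv t l) ⟩ (th∌ t l) (≡.trans (≡.sym single) (⟨⟩-relation h c b rel))
        where
        h = fac (th t l)
        single : ∑q (λ a → c a ℚ.* ⟨ h , b a ⟩) ≡ c (suc (suc l)) ℚ.* ⟨ h , vert (tv t l) ⟩
        single = ∑q-single (λ a → c a ℚ.* ⟨ h , b a ⟩) (suc (suc l)) λ
          { 0F _ → ≡.trans (cong (ℚ._* ⟨ h , b 0F ⟩) c₀) (ℚₚ.*-zeroˡ ⟨ h , b 0F ⟩)
          ; 1F _ → ≡.trans (cong (ℚ._* ⟨ h , b 1F ⟩) c₁) (ℚₚ.*-zeroˡ ⟨ h , b 1F ⟩)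
          ; (suc (suc k)) ne → ≡.trans (cong (c (suc (suc k)) ℚ.*_) (th∋ t (λ l≡k → ne (cong (λ i → suc (suc i)) (≡.sym l≡k))))) (ℚₚ.*-zeroʳ (c (suc (suc k)))) }
    γ : Fin 5 → ℚ
    γ = proj₁ (independent-spans b independent x)
    x≡ = proj₂ (independent-spans b independent x)
    γ₀ : γ 0F ≡ 0ℚ
    γ₀ = *-cancel-zero (γ 0F) ⟨ f₀ , vert p ⟩ (proj₂ (proj₂ P)) (≡.trans (≡.sym (read₀ γ)) (≡.trans (≡.sym (⟨⟩-combination f₀ γ b)) (≡.trans (≡.sym (⟨⟩-cong f₀ x≡)) (x∈t 0F))))
    γ₁ : γ 1F ≡ 0ℚ
    γ₁ = *-cancel-zero (γ 1F) ⟨ f₁ , vert q ⟩ (proj₂ (proj₂ Q)) (≡.trans (≡.sym (read₁ γ)) (≡.trans (≡.sym (⟨⟩-combination f₁ γ b)) (≡.trans (≡.sym (⟨⟩-cong f₁ x≡)) (x∈t 1F))))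

  -- The third facet `th t l` vanishes at the corners other than `l` and so reads off the
  -- coefficient of corner `l`. Its sign is that of a facet functional, which is what yields conic
  -- and convex combinations later.
  t-span : ∀ t x → (∀ s → ⟨ fac (tf t s) , x ⟩ ≡ 0ℚ) → ∀ j →
    x j ≡ ∑q (λ l → (⟨ fac (th t l) , x ⟩ ℚ.* inv ⟨ fac (th t l) , vert (tv t l) ⟩) ℚ.* vert (tv t l) j)
  t-span t x x∈t j = ≡.trans (x≡ j) (ℚ-Sum.sum-cong-≗ {3} λ l → cong (ℚ._* vert (tv t l) j) (coefficient l))
    where
    α : Fin 3 → ℚ
    α = proj₁ (tf-span t x x∈t)
    x≡ = proj₂ (tf-span t x x∈t)
    pairing : ∀ l → ⟨ fac (th t l) , x ⟩ ≡ α l ℚ.* ⟨ fac (th t l) , vert (tv t l) ⟩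
    pairing l = ≡.trans (⟨⟩-cong (fac (th t l)) x≡) (≡.trans (⟨⟩-∑ (fac (th t l)) (λ m j → α m ℚ.* vert (tv t m) j))
      (≡.trans (ℚ-Sum.sum-cong-≗ {3} (λ m → ⟨⟩-scale (fac (th t l)) (α m) (vert (tv t m))))
        (∑q-single (λ m → α m ℚ.* ⟨ fac (th t l) , vert (tv t m) ⟩) l
          (λ m m≢l → ≡.trans (cong (α m ℚ.*_) (th∋ t (m≢l ∘ ≡.sym))) (ℚₚ.*-zeroʳ (α m))))))
    coefficient : ∀ l → α l ≡ ⟨ fac (th t l) , x ⟩ ℚ.* inv ⟨ fac (th t l) , vert (tv t l) ⟩
    coefficient l = ≡.sym (≡.trans (cong (ℚ._* inv q) (pairing l))
      (≡.trans (ℚₚ.*-assoc (α l) q (inv q)) (≡.trans (cong (α l ℚ.*_) (inv-inverse q (th∌ t l))) (ℚₚ.*-identityʳ (α l)))))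
      where q = ⟨ fac (th t l) , vert (tv t l) ⟩

  -- Conic combinations of vertices and the ratio test

  data Cone : Q⁵ → Set where
    nil : ∀ {x} → (∀ j → x j ≡ 0ℚ) → Cone x
    add : ∀ {x y} t v → 0ℚ ℚ.≤ t → Cone y → (∀ j → x j ≡ t ℚ.* vert v j ℚ.+ y j) → Cone x

  Cone-∑ : ∀ {n x} (t : Fin n → ℚ) (v : Fin n → V) → (∀ a → 0ℚ ℚ.≤ t a) →
           (∀ j → x j ≡ ∑q (λ a → t a ℚ.* vert (v a) j)) → Cone x
  Cone-∑ {zero} t v t≥0 eq = nil eq
  Cone-∑ {suc n} t v t≥0 eq = add (t zero) (v zero) (t≥0 zero) (Cone-∑ (t ∘ suc) (v ∘ suc) (t≥0 ∘ suc) (λ _ → refl)) eq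

  _∸[_]_ : Q⁵ → ℚ → V → Q⁵
  (x ∸[ τ ] w) j = x j ℚ.- τ ℚ.* vert w j

  restore : ∀ x τ w j → x j ≡ τ ℚ.* vert w j ℚ.+ (x ∸[ τ ] w) j
  restore x τ w j = solve 2 (λ a b → a := b :+ (a :- b)) refl (x j) (τ ℚ.* vert w j)

  ⟨⟩-∸ : ∀ f x τ w → ⟨ f , x ∸[ τ ] w ⟩ ≡ ⟨ f , x ⟩ ℚ.- τ ℚ.* ⟨ f , vert w ⟩
  ⟨⟩-∸ f x τ w = ≡.trans (⟨⟩-cong f (λ j → s (x j) τ (vert w j)))
    (≡.trans (⟨⟩-lin f 1ℚ x (ℚ.- τ) (vert w)) (≡.sym (s ⟨ f , x ⟩ τ ⟨ f , vert w ⟩)))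
    where
    s : ∀ a t b → a ℚ.- t ℚ.* b ≡ 1ℚ ℚ.* a ℚ.+ ℚ.- t ℚ.* b
    s = solve 3 (λ a t b → a :- t :* b := con 1ℚ :* a :+ :- t :* b) refl

  -- For `w` off `g`, the time at which the ray from `x` in direction `- vert w` meets the
  -- hyperplane of `g`.
  ratio : Q⁵ → V → Φ → ℚ
  ratio x w g = ⟨ fac g , x ⟩ ℚ.* inv ⟨ fac g , vert w ⟩

  ratio-hit : ∀ x w g → ¬ w ∈ᶠ g → ⟨ fac g , x ∸[ ratio x w g ] w ⟩ ≡ 0ℚ
  ratio-hit x w g w∉g = ≡.trans (⟨⟩-∸ (fac g) x (ratio x w g) w) (≡.trans
    (solve 3 (λ a i b → a :- a :* i :* b := a :- a :* (b :* i)) refl ⟨ fac g , x ⟩ (inv ⟨ fac g , vert w ⟩) ⟨ fac g , vert w ⟩)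
    (≡.trans (cong (λ z → ⟨ fac g , x ⟩ ℚ.- ⟨ fac g , x ⟩ ℚ.* z) (inv-inverse ⟨ fac g , vert w ⟩ w∉g))
      (solve 1 (λ a → a :- a :* con 1ℚ := con 0ℚ) refl ⟨ fac g , x ⟩)))

  ∸-on : ∀ x τ w g → w ∈ᶠ g → ⟨ fac g , x ∸[ τ ] w ⟩ ≡ ⟨ fac g , x ⟩
  ∸-on x τ w g w∈g = ≡.trans (⟨⟩-∸ (fac g) x τ w) (≡.trans (cong (λ z → ⟨ fac g , x ⟩ ℚ.- τ ℚ.* z) w∈g)
    (solve 2 (λ a t → a :- t :* con 0ℚ := a) refl ⟨ fac g , x ⟩ τ))

  ratio-≥ : ∀ x τ w g → ¬ w ∈ᶠ g → τ ℚ.≤ ratio x w g → 0ℚ ℚ.≤ ⟨ fac g , x ∸[ τ ] w ⟩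
  ratio-≥ x τ w g w∉g le = subst (0ℚ ℚ.≤_) (≡.sym (⟨⟩-∸ (fac g) x τ w)) (≤⇒0≤- (begin
    τ ℚ.* b                      ≤⟨ ℚₚ.*-monoʳ-≤-nonNeg b {{ℚ.nonNegative (fac≥0 g w)}} le ⟩
    a ℚ.* inv b ℚ.* b            ≡⟨ solve 3 (λ a i b → a :* i :* b := a :* (b :* i)) refl a (inv b) b ⟩
    a ℚ.* (b ℚ.* inv b)          ≡⟨ cong (a ℚ.*_) (inv-inverse b w∉g) ⟩
    a ℚ.* 1ℚ                     ≡⟨ ℚₚ.*-identityʳ a ⟩
    a                            ∎))
    where
    open ℚₚ.≤-Reasoning
    a = ⟨ fac g , x ⟩
    b = ⟨ fac g , vert w ⟩

  InH : Q⁵ → Set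
  InH x = ∀ g → 0ℚ ℚ.≤ ⟨ fac g , x ⟩

  ratio-nonneg : ∀ {x} → InH x → ∀ w g → ¬ w ∈ᶠ g → 0ℚ ℚ.≤ ratio x w g
  ratio-nonneg xH w g w∉g = *-nonneg (xH g) (ℚₚ.<⇒≤ (inv-pos (∉⇒> {w} {g} w∉g)))

  -- Inside the facet g, leave the vertex tip g until a triangle of g is reached; there the
  -- third facets of the three edges certify nonnegative coordinates.
  facet-cone : ∀ x g → InH x → ⟨ fac g , x ⟩ ≡ 0ℚ → Cone x
  facet-cone x g xH x∈g = shoot (argmin (enumT ×-enum ↔-id (Fin 2)) Q Q? height
      ((base g , side g) , base-tf g , tip∉ g))
    where
    w = tip g
    Q : T × Fin 2 → Set
    Q (t , s) = tf t s ≡ g × ¬ w ∈ᶠ tf t (other s)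
    Q? : ∀ p → Dec (Q p)
    Q? (t , s) = (tf t s ΦE.≟ g) ×-dec ¬? (w ∈ᶠ? tf t (other s))
    height : T × Fin 2 → ℚ
    height (t , s) = ratio x w (tf t (other s))
    shoot : ∃[ p ] (Q p × (∀ q → Q q → height p ℚ.≤ height q)) → Cone x
    shoot ((t , s) , (tfs , w∉) , least) = add τ w (ratio-nonneg {x} xH w (tf t (other s)) w∉)
      (Cone-∑ coef (tv t) coef≥0 (t-span t y y∈t)) (restore x τ w)
      where
      τ = height (t , s)
      y = x ∸[ τ ] w
      both : ∀ s s′ {P : Φ → Set} → P (tf t s) → P (tf t (other s)) → P (tf t s′)
      both 0F 0F p q = p
      both 0F 1F p q = q
      both 1F 0F p q = q
      both 1F 1F p q = p
      y∈t : ∀ s′ → ⟨ fac (tf t s′) , y ⟩ ≡ 0ℚ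
      y∈t s′ = both s s′ {λ h → ⟨ fac h , y ⟩ ≡ 0ℚ}
        (subst (λ h → ⟨ fac h , y ⟩ ≡ 0ℚ) (≡.sym tfs) (≡.trans (∸-on x τ w g (tip∈ g)) x∈g))
        (ratio-hit x w (tf t (other s)) w∉)
      neighbour : ∀ t′ s′ → tf t′ s′ ≡ g → 0ℚ ℚ.≤ ⟨ fac (tf t′ (other s′)) , y ⟩
      neighbour t′ s′ eq with w ∈ᶠ? tf t′ (other s′)
      ... | yes w∈ = subst (0ℚ ℚ.≤_) (≡.sym (∸-on x τ w (tf t′ (other s′)) w∈)) (xH (tf t′ (other s′)))
      ... | no w∉′ = ratio-≥ x τ w (tf t′ (other s′)) w∉′ (least (t′ , s′) (eq , w∉′))
      -- Only the facets across the sides of `t` matter for the coefficients. Each of them shares a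
      -- triangle with `g`, so minimality over the triangles of `g` covers it.
      th-nonneg : ∀ l → 0ℚ ℚ.≤ ⟨ fac (th t l) , y ⟩
      th-nonneg l = let t′ , s′ , eq , eq′ = th-adj t s l in
        subst (λ h → 0ℚ ℚ.≤ ⟨ fac h , y ⟩) eq′ (neighbour t′ s′ (≡.trans eq tfs))
      coef : Fin 3 → ℚ
      coef l = ⟨ fac (th t l) , y ⟩ ℚ.* inv ⟨ fac (th t l) , vert (tv t l) ⟩
      coef≥0 : ∀ l → 0ℚ ℚ.≤ coef l
      coef≥0 l = *-nonneg (th-nonneg l) (ℚₚ.<⇒≤ (inv-pos (∉⇒> {tv t l} {th t l} (th∌ t l))))

  Closure : (V → Set) → V → Set
  Closure P w = ∀ g → (∀ u → P u → u ∈ᶠ g) → w ∈ᶠ g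

  -- A facet that misses `w` also misses some `J a`, hence is positive on the sum `b`. So a positive
  -- multiple of `w` can be subtracted before the first such facet is reached, and the remainder,
  -- lying on that facet, is conic by `facet-cone`.
  closure-combination : ∀ {n} (J : Fin n → V) w → (∀ g → (∀ a → J a ∈ᶠ g) → w ∈ᶠ g) →
    ∃[ τ ] ∃[ y ] (0ℚ ℚ.< τ × Cone y × (∀ j → ∑q (λ a → vert (J a) j) ≡ τ ℚ.* vert w j ℚ.+ y j))
  closure-combination J w cl = shoot (argmin enumΦ (λ g → ¬ w ∈ᶠ g) (λ g → ¬? (w ∈ᶠ? g)) (ratio b w) (out w , out∌ w))
    where
    b : Q⁵
    b j = ∑q (λ a → vert (J a) j)
    ⟨b⟩ : ∀ g → ⟨ fac g , b ⟩ ≡ ∑q (λ a → ⟨ fac g , vert (J a) ⟩)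
    ⟨b⟩ g = ⟨⟩-∑ (fac g) (vert ∘ J)
    bH : InH b
    bH g = subst (0ℚ ℚ.≤_) (≡.sym (⟨b⟩ g)) (∑q-nonneg (λ a → fac≥0 g (J a)))
    b> : ∀ g → ¬ w ∈ᶠ g → 0ℚ ℚ.< ⟨ fac g , b ⟩
    b> g w∉g = ≤∧≢⇒< (bH g) λ eq → w∉g (cl g (∑q-zero (λ a → fac≥0 g (J a)) (≡.trans (≡.sym (⟨b⟩ g)) eq)))
    shoot : ∃[ g ] (¬ w ∈ᶠ g × (∀ h → ¬ w ∈ᶠ h → ratio b w g ℚ.≤ ratio b w h)) → _
    shoot (g , w∉g , least) = τ , b ∸[ τ ] w , *-pos (b> g w∉g) (inv-pos (∉⇒> {w} {g} w∉g))
        , facet-cone (b ∸[ τ ] w) g yH (ratio-hit b w g w∉g) , restore b τ w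
      where
      τ = ratio b w g
      yH : InH (b ∸[ τ ] w)
      yH h with w ∈ᶠ? h
      ... | yes w∈h = subst (0ℚ ℚ.≤_) (≡.sym (∸-on b τ w h w∈h)) (bH h)
      ... | no w∉h = ratio-≥ b τ w h w∉h (least h w∉h)

  -- Vertex sets of faces and their closures

  data Flat : Set where
    vertex : V → Flat
    edge′  : E → Flat
    tri    : T → Flat
    facet  : Φ → Flat
    whole  : Flat

  infix 4 _∈ˡ_
  data _∈ˡ_ (v : V) : Flat → Set where
    in-vertex : ∀ {u} → v ≡ u → v ∈ˡ vertex u
    in-edge   : ∀ {e} → ∃[ k ] v ≡ end e k → v ∈ˡ edge′ e
    in-tri    : ∀ {t} → ∃[ l ] v ≡ tv t l → v ∈ˡ tri t
    in-facet  : ∀ {g} → v ∈ᶠ g → v ∈ˡ facet g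
    in-whole  : v ∈ˡ whole

  Join : (V → Set) → V → Set
  Join P w = Σ[ Y ∈ Flat ] (∀ u → P u ⊎ u ≡ w → u ∈ˡ Y) × (∀ u → u ∈ˡ Y → Closure (λ u → P u ⊎ u ≡ w) u)

  -- Unless `w` is already on `X`, the result depends on how many facets contain both: none gives
  -- `whole`, one gives that facet, and more give an edge (from a vertex) or a triangle (from an
  -- edge).
  join : ∀ X w → Join (_∈ˡ X) w
  join (vertex u) w with u VE.≟ w
  ... | yes refl = vertex u , (λ { v (inj₁ p) → p ; v (inj₂ eq) → in-vertex eq }) , λ { v p g h → h v (inj₁ p) }
  ... | no u≢w with ΦE.any? (λ g → (u ∈ᶠ? g) ×-dec (w ∈ᶠ? g))
  ...   | no none = whole , (λ _ _ → in-whole) , λ v _ g h → ⊥-elim (none (g , h u (inj₁ (in-vertex refl)) , h w (inj₂ refl)))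
  ...   | yes (g , u∈g , w∈g) with ΦE.any? (λ g′ → ¬? (g ΦE.≟ g′) ×-dec (u ∈ᶠ? g′) ×-dec (w ∈ᶠ? g′))
  ...     | no unique = facet g
            , (λ { v (inj₁ (in-vertex refl)) → in-facet u∈g ; v (inj₂ refl) → in-facet w∈g })
            , λ { v (in-facet v∈g) g′ h → only v v∈g g′ (h u (inj₁ (in-vertex refl))) (h w (inj₂ refl)) (g ΦE.≟ g′) }
    where
    only : ∀ v → v ∈ᶠ g → ∀ g′ → u ∈ᶠ g′ → w ∈ᶠ g′ → Dec (g ≡ g′) → v ∈ᶠ g′
    only v v∈g g′ _ _ (yes refl) = v∈g
    only v v∈g g′ u∈ w∈ (no g≢g′) = ⊥-elim (unique (g′ , g≢g′ , u∈ , w∈))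
  ...     | yes (g′ , g≢g′ , u∈g′ , w∈g′) with edge u w g g′ u≢w g≢g′ u∈g w∈g u∈g′ w∈g′
  ...       | e , inj₁ (refl , refl) = edge′ e
              , (λ { v (inj₁ (in-vertex eq)) → in-edge (0F , eq) ; v (inj₂ eq) → in-edge (1F , eq) })
              , λ { v (in-edge (0F , eq)) g h → h v (inj₁ (in-vertex eq)) ; v (in-edge (1F , eq)) g h → h v (inj₂ eq) }
  ...       | e , inj₂ (refl , refl) = edge′ e
              , (λ { v (inj₁ (in-vertex eq)) → in-edge (1F , eq) ; v (inj₂ eq) → in-edge (0F , eq) })
              , λ { v (in-edge (1F , eq)) g h → h v (inj₁ (in-vertex eq)) ; v (in-edge (0F , eq)) g h → h v (inj₂ eq) }
  join (edge′ e) w with Finₚ.any? (λ k → w VE.≟ end e k)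
  ... | yes w∈e = edge′ e , (λ { v (inj₁ p) → p ; v (inj₂ refl) → in-edge w∈e }) , λ { v p g h → h v (inj₁ p) }
  ... | no w∉e = cases (w ∈ᶠ? ef e 0F) (w ∈ᶠ? ef e 1F) (w ∈ᶠ? ef e 2F)
    where
    pair : ∀ i j → i ≢ j → w ∈ᶠ ef e i → w ∈ᶠ ef e j → Join (_∈ˡ edge′ e) w
    pair i j i≢j p q with ef-two e i j w i≢j p q
    ... | inj₁ w∈e = ⊥-elim (w∉e w∈e)
    ... | inj₂ (t , ends , w∈t , split) = tri t
          , (λ { v (inj₁ (in-edge (k , refl))) → in-tri (ends k) ; v (inj₂ refl) → in-tri w∈t })
          , λ { v (in-tri (l , refl)) g h → from-split g h (split l) }
      where
      from-split : ∀ {v} g → (∀ u → u ∈ˡ edge′ e ⊎ u ≡ w → u ∈ᶠ g) → (∃[ k ] v ≡ end e k) ⊎ v ≡ w → v ∈ᶠ g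
      from-split g h (inj₁ p) = h _ (inj₁ (in-edge p))
      from-split g h (inj₂ p) = h _ (inj₂ p)
    ends∈ : ∀ {g} → (∀ u → u ∈ˡ edge′ e ⊎ u ≡ w → u ∈ᶠ g) → ∃[ i ] g ≡ ef e i
    ends∈ {g} h = ef-all e g (λ k → h _ (inj₁ (in-edge (k , refl))))
    single : ∀ i → w ∈ᶠ ef e i → (∀ j → w ∈ᶠ ef e j → j ≡ i) → Join (_∈ˡ edge′ e) w
    single i p unique = facet (ef e i)
      , (λ { v (inj₁ (in-edge (k , refl))) → in-facet (ef∋ e i k) ; v (inj₂ refl) → in-facet p })
      , λ { v (in-facet v∈) g h → only v v∈ g h (ends∈ h) }
      where
      only : ∀ v → v ∈ᶠ ef e i → ∀ g → (∀ u → u ∈ˡ edge′ e ⊎ u ≡ w → u ∈ᶠ g) → ∃[ j ] g ≡ ef e j → v ∈ᶠ g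
      only v v∈ g h (j , refl) with unique j (h w (inj₂ refl))
      ... | refl = v∈
    cases : Dec (w ∈ᶠ ef e 0F) → Dec (w ∈ᶠ ef e 1F) → Dec (w ∈ᶠ ef e 2F) → Join (_∈ˡ edge′ e) w
    cases (yes p) (yes q) _ = pair 0F 1F (λ ()) p q
    cases (yes p) (no _) (yes r) = pair 0F 2F (λ ()) p r
    cases (no _) (yes q) (yes r) = pair 1F 2F (λ ()) q r
    cases (yes p) (no ¬q) (no ¬r) = single 0F p λ { 0F _ → refl ; 1F q → ⊥-elim (¬q q) ; 2F r → ⊥-elim (¬r r) }
    cases (no ¬p) (yes q) (no ¬r) = single 1F q λ { 0F p → ⊥-elim (¬p p) ; 1F _ → refl ; 2F r → ⊥-elim (¬r r) }
    cases (no ¬p) (no ¬q) (yes r) = single 2F r λ { 0F p → ⊥-elim (¬p p) ; 1F q → ⊥-elim (¬q q) ; 2F _ → refl }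
    cases (no ¬p) (no ¬q) (no ¬r) = whole , (λ _ _ → in-whole) , λ v _ g h → ⊥-elim (none g h (ends∈ h))
      where
      none : ∀ g → (∀ u → u ∈ˡ edge′ e ⊎ u ≡ w → u ∈ᶠ g) → ∃[ i ] g ≡ ef e i → ⊥
      none g h (0F , refl) = ¬p (h w (inj₂ refl))
      none g h (1F , refl) = ¬q (h w (inj₂ refl))
      none g h (2F , refl) = ¬r (h w (inj₂ refl))
  join (tri t) w with Finₚ.any? (λ l → w VE.≟ tv t l)
  ... | yes w∈t = tri t , (λ { v (inj₁ p) → p ; v (inj₂ refl) → in-tri w∈t }) , λ { v p g h → h v (inj₁ p) }
  ... | no w∉t = cases (w ∈ᶠ? tf t 0F) (w ∈ᶠ? tf t 1F)
    where
    corners∈ : ∀ {g} → (∀ u → u ∈ˡ tri t ⊎ u ≡ w → u ∈ᶠ g) → ∃[ s ] g ≡ tf t s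
    corners∈ {g} h = tf-all t g (λ l → h _ (inj₁ (in-tri (l , refl))))
    single : ∀ s → w ∈ᶠ tf t s → (∀ s′ → w ∈ᶠ tf t s′ → s′ ≡ s) → Join (_∈ˡ tri t) w
    single s p unique = facet (tf t s)
      , (λ { v (inj₁ (in-tri (l , refl))) → in-facet (tf∋ t s l) ; v (inj₂ refl) → in-facet p })
      , λ { v (in-facet v∈) g h → only v v∈ g h (corners∈ h) }
      where
      only : ∀ v → v ∈ᶠ tf t s → ∀ g → (∀ u → u ∈ˡ tri t ⊎ u ≡ w → u ∈ᶠ g) → ∃[ j ] g ≡ tf t j → v ∈ᶠ g
      only v v∈ g h (j , refl) with unique j (h w (inj₂ refl))
      ... | refl = v∈
    cases : Dec (w ∈ᶠ tf t 0F) → Dec (w ∈ᶠ tf t 1F) → Join (_∈ˡ tri t) w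
    cases (yes p) (yes q) = ⊥-elim (w∉t (tf-two t w λ { 0F → p ; 1F → q }))
    cases (yes p) (no ¬q) = single 0F p λ { 0F _ → refl ; 1F q → ⊥-elim (¬q q) }
    cases (no ¬p) (yes q) = single 1F q λ { 0F p → ⊥-elim (¬p p) ; 1F _ → refl }
    cases (no ¬p) (no ¬q) = whole , (λ _ _ → in-whole) , λ v _ g h → ⊥-elim (none g h (corners∈ h))
      where
      none : ∀ g → (∀ u → u ∈ˡ tri t ⊎ u ≡ w → u ∈ᶠ g) → ∃[ i ] g ≡ tf t i → ⊥
      none g h (0F , refl) = ¬p (h w (inj₂ refl))
      none g h (1F , refl) = ¬q (h w (inj₂ refl))
  join (facet g) w with w ∈ᶠ? g
  ... | yes w∈g = facet g , (λ { v (inj₁ p) → p ; v (inj₂ refl) → in-facet w∈g }) , λ { v p g h → h v (inj₁ p) }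
  ... | no w∉g = whole , (λ _ _ → in-whole) , λ v _ g′ h → ⊥-elim (w∉g
          (subst (w ∈ᶠ_) (facet-⊆ g g′ (λ u u∈g → h u (inj₁ (in-facet u∈g)))) (h w (inj₂ refl))))
  join whole w = whole , (λ _ _ → in-whole) , λ v _ g h → h v (inj₁ in-whole)

  hull : ∀ {n} (J : Fin (suc n) → V) →
    Σ[ X ∈ Flat ] (∀ a → J a ∈ˡ X) × (∀ u → u ∈ˡ X → ∀ g → (∀ a → J a ∈ᶠ g) → u ∈ᶠ g)
  hull {zero} J = vertex (J zero) , (λ { zero → in-vertex refl }) , λ { u (in-vertex refl) g h → h zero }
  hull {suc n} J =
    let X , J∈X , X⊆ = hull (J ∘ suc)
        Y , ⊇ , Y⊆ = join X (J zero)
    in Y , (λ { zero → ⊇ _ (inj₂ refl) ; (suc a) → ⊇ _ (inj₁ (J∈X a)) })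
         , λ u u∈Y g h → Y⊆ u u∈Y g λ { v (inj₁ v∈X) → X⊆ v v∈X g (h ∘ suc) ; v (inj₂ refl) → h zero }

-- Affine functionals and dimension

open CommutativeRing ℝ-commutativeRing using (semiring; setoid; zeroˡ; zeroʳ; +-identityˡ; +-identityʳ; *-identityˡ; *-identityʳ; *-comm; *-assoc)
open import Algebra.Properties.Semiring.Sum semiring using (sum-cong-≋; ∑-comm; sum-remove; *-distribˡ-sum; *-distribʳ-sum; sum-replicate-zero)

module ≃-Reasoning where
  open import Relation.Binary.Reasoning.Setoid setoid public

∑-cong : ∀ {n} {f g : Fin n → ℝ} → (∀ i → f i ≃ g i) → ∑ f ≃ ∑ g
∑-cong = sum-cong-≋

∑-zero : ∀ {n} {f : Fin n → ℝ} → (∀ i → f i ≃ 0ℝ) → ∑ f ≃ 0ℝ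
∑-zero {n} p = ≃-trans (∑-cong p) (sum-replicate-zero n)

*-zero : ∀ {x y} → y ≃ 0ℝ → x * y ≃ 0ℝ
*-zero {x} p = ≃-trans (*-cong ≃-refl p) (zeroʳ x)

infix 4 _≅_
_≅_ : ∀ {e} → Point e → Point e → Set
x ≅ y = ∀ j → x j ≃ y j

lin : ∀ {e} → ℝ → Point e → ℝ → Point e → Point e
lin α x β y j = α * x j + β * y j

record Lin (e : ℕ) : Set where
  field
    fun    : Point e → ℝ
    resp   : ∀ {x y} → x ≅ y → fun x ≃ fun y
    linear : ∀ α β x y → fun (lin α x β y) ≃ α * fun x + β * fun y

  preserves-0 : ∀ {x} → (∀ j → x j ≃ 0ℝ) → fun x ≃ 0ℝ
  preserves-0 {x} x≃0 = begin
    fun x                                 ≈⟨ resp (λ j → ≃-trans (x≃0 j) (≃-pointwise λ n → ≡.sym (zeros (seq (x j) n)))) ⟩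
    fun (lin 0ℝ x 0ℝ x)                   ≈⟨ linear 0ℝ 0ℝ x x ⟩
    0ℝ * fun x + 0ℝ * fun x               ≈⟨ (≃-pointwise λ n → zeros (seq (fun x) n)) ⟩
    0ℝ                                    ∎
    where
    open ≃-Reasoning
    zeros : ∀ a → 0ℚ ℚ.* a ℚ.+ 0ℚ ℚ.* a ≡ 0ℚ
    zeros = solve 1 (λ a → con 0ℚ :* a :+ con 0ℚ :* a := con 0ℚ) refl

  preserves-∑ : ∀ {n} (μ : Fin n → ℝ) (x : Fin n → Point e) →
                fun (combination μ x) ≃ ∑ (λ i → μ i * fun (x i))
  preserves-∑ {zero} μ x = preserves-0 (λ _ → ≃-refl)
  preserves-∑ {suc n} μ x = begin
    fun (combination μ x)                                        ≈⟨ resp (λ j → +-cong ≃-refl (≃-sym (*-identityˡ _))) ⟩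
    fun (lin (μ zero) (x zero) 1ℝ (combination (μ ∘ suc) (x ∘ suc)))  ≈⟨ linear (μ zero) 1ℝ (x zero) _ ⟩
    μ zero * fun (x zero) + 1ℝ * fun (combination (μ ∘ suc) (x ∘ suc)) ≈⟨ +-cong ≃-refl (≃-trans (*-identityˡ _) (preserves-∑ (μ ∘ suc) (x ∘ suc))) ⟩
    ∑ (λ i → μ i * fun (x i))                                    ∎
    where open ≃-Reasoning

coordinate : ∀ {e} → Fin e → Lin e
coordinate p = record { fun = λ x → x p ; resp = λ eq → eq p ; linear = λ _ _ _ _ → ≃-refl }

dot : ∀ {e} → Point e → Lin e
dot {e} c = record
  { fun = c ·_
  ; resp = λ eq → ∑-cong (λ j → *-cong ≃-refl (eq j))
  ; linear = linear-dot c }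
  where
  rearrange : ∀ α β c x y p q → c ℚ.* (α ℚ.* x ℚ.+ β ℚ.* y) ℚ.+ (α ℚ.* p ℚ.+ β ℚ.* q)
            ≡ α ℚ.* (c ℚ.* x ℚ.+ p) ℚ.+ β ℚ.* (c ℚ.* y ℚ.+ q)
  rearrange = solve 7 (λ α β c x y p q → c :* (α :* x :+ β :* y) :+ (α :* p :+ β :* q)
            := α :* (c :* x :+ p) :+ β :* (c :* y :+ q)) refl
  base : ∀ α β → 0ℚ ≡ α ℚ.* 0ℚ ℚ.+ β ℚ.* 0ℚ
  base = solve 2 (λ α β → con 0ℚ := α :* con 0ℚ :+ β :* con 0ℚ) refl
  linear-dot : ∀ {e} (c : Point e) α β x y → c · lin α x β y ≃ α * (c · x) + β * (c · y)
  linear-dot {zero} c α β x y = ≃-pointwise λ n → base (seq α n) (seq β n)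
  linear-dot {suc e} c α β x y = ≃-trans
    (+-cong ≃-refl (linear-dot (c ∘ suc) α β (x ∘ suc) (y ∘ suc)))
    (≃-pointwise λ n → rearrange (seq α n) (seq β n) (seq (c zero) n) (seq (x zero) n) (seq (y zero) n)
       (seq ((c ∘ suc) · (x ∘ suc)) n) (seq ((c ∘ suc) · (y ∘ suc)) n))

-- z ↦ L (w p · z − z p · w): it kills w and agrees up to the factor w p with L where z p = 0.
eliminate : ∀ {e} → Lin e → Point e → Fin e → Lin e
eliminate L w p = record
  { fun = λ z → L.fun (lin (w p) z (⁻ z p) w)
  ; resp = λ eq → L.resp (λ j → +-cong (*-cong ≃-refl (eq j)) (*-cong (*-cong ≃-refl (eq p)) ≃-refl))
  ; linear = λ α β x y → ≃-trans
      (L.resp (λ j → ≃-pointwise λ n → rearrange (seq α n) (seq β n) (seq (w p) n) (seq (w j) n)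
        (seq (x j) n) (seq (y j) n) (seq (x p) n) (seq (y p) n)))
      (L.linear α β _ _) }
  where
  module L = Lin L
  rearrange : ∀ α β wp wj xj yj xp yp →
    wp ℚ.* (α ℚ.* xj ℚ.+ β ℚ.* yj) ℚ.+ ℚ.- 1ℚ ℚ.* (α ℚ.* xp ℚ.+ β ℚ.* yp) ℚ.* wj
    ≡ α ℚ.* (wp ℚ.* xj ℚ.+ ℚ.- 1ℚ ℚ.* xp ℚ.* wj) ℚ.+ β ℚ.* (wp ℚ.* yj ℚ.+ ℚ.- 1ℚ ℚ.* yp ℚ.* wj)
  rearrange = solve 8 (λ α β wp wj xj yj xp yp →
    wp :* (α :* xj :+ β :* yj) :+ con (ℚ.- 1ℚ) :* (α :* xp :+ β :* yp) :* wj
    := α :* (wp :* xj :+ con (ℚ.- 1ℚ) :* xp :* wj) :+ β :* (wp :* yj :+ con (ℚ.- 1ℚ) :* yp :* wj)) refl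

record Aff (e : ℕ) : Set where
  field
    fun    : Point e → ℝ
    resp   : ∀ {x y} → x ≅ y → fun x ≃ fun y
    affine : ∀ {n} (μ : Fin n → ℝ) (x : Fin n → Point e) → ∑ μ ≃ 1ℝ →
             fun (combination μ x) ≃ ∑ (λ i → μ i * fun (x i))

infix 20 _⟪_⟫
_⟪_⟫ : ∀ {e} → Aff e → Point e → ℝ
_⟪_⟫ = Aff.fun

lin⇒aff : ∀ {e} → Lin e → Aff e
lin⇒aff L = record { fun = L.fun ; resp = L.resp ; affine = λ μ x _ → L.preserves-∑ μ x }
  where module L = Lin L

constant : ∀ {e} → ℝ → Aff e
constant c = record
  { fun = λ _ → c ; resp = λ _ → ≃-refl
  ; affine = λ μ x ∑μ → ≃-sym (≃-trans (≃-sym (*-distribʳ-sum c μ)) (≃-trans (*-cong ∑μ ≃-refl) (*-identityˡ c))) }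

∑-sub : ∀ {n} (μ w : Fin n → ℝ) d → ∑ (λ i → μ i * (w i + ⁻ d)) ≃ ∑ (λ i → μ i * w i) + ⁻ ∑ μ * d
∑-sub {zero} μ w d = ≃-pointwise λ n → base (seq d n)
  where
  base : ∀ d → 0ℚ ≡ 0ℚ ℚ.+ ℚ.- 1ℚ ℚ.* 0ℚ ℚ.* d
  base = solve 1 (λ d → con 0ℚ := con 0ℚ :+ con (ℚ.- 1ℚ) :* con 0ℚ :* d) refl
∑-sub {suc n} μ w d = ≃-trans (+-cong ≃-refl (∑-sub (μ ∘ suc) (w ∘ suc) d))
  (≃-pointwise λ n → step (seq (μ zero) n) (seq (w zero) n) (seq d n)
    (seq (∑ (λ i → μ (suc i) * w (suc i))) n) (seq (∑ (μ ∘ suc)) n))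
  where
  step : ∀ m w d p q → m ℚ.* (w ℚ.+ ℚ.- 1ℚ ℚ.* d) ℚ.+ (p ℚ.+ ℚ.- 1ℚ ℚ.* q ℚ.* d)
       ≡ m ℚ.* w ℚ.+ p ℚ.+ ℚ.- 1ℚ ℚ.* (m ℚ.+ q) ℚ.* d
  step = solve 5 (λ m w d p q → m :* (w :+ con (ℚ.- 1ℚ) :* d) :+ (p :+ con (ℚ.- 1ℚ) :* q :* d)
       := m :* w :+ p :+ con (ℚ.- 1ℚ) :* (m :+ q) :* d) refl

infixl 6 _⊖_
_⊖_ : ∀ {e} → Point e → Point e → Point e
(x ⊖ y) j = x j + ⁻ y j

based : ∀ {e} → Lin e → Point e → Aff e
based L o = record
  { fun = λ x → L.fun (x ⊖ o)
  ; resp = λ eq → L.resp (λ j → +-cong (eq j) ≃-refl)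
  ; affine = λ μ x ∑μ → ≃-trans
      (L.resp (λ j → ≃-sym (≃-trans (∑-sub μ (λ i → x i j) (o j))
        (+-cong ≃-refl (*-cong (≃-trans (*-cong ≃-refl ∑μ) (*-identityʳ _)) ≃-refl)))))
      (L.preserves-∑ μ (λ i → x i ⊖ o)) }
  where module L = Lin L

cross : ∀ {e} → ℝ → Aff e → ℝ → Aff e → Aff e
cross {e} α f β g = record
  { fun = value
  ; resp = λ eq → +-cong (*-cong ≃-refl (F.resp eq)) (*-cong ≃-refl (*-cong ≃-refl (G.resp eq)))
  ; affine = λ μ x ∑μ → ≃-trans
      (+-cong (*-cong ≃-refl (F.affine μ x ∑μ)) (*-cong ≃-refl (*-cong ≃-refl (G.affine μ x ∑μ))))
      (≃-sym (split μ x)) }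
  where
  module F = Aff f
  module G = Aff g
  value : Point e → ℝ
  value x = α * F.fun x + ⁻ (β * G.fun x)
  base : ∀ a b → 0ℚ ≡ a ℚ.* 0ℚ ℚ.+ ℚ.- 1ℚ ℚ.* (b ℚ.* 0ℚ)
  base = solve 2 (λ a b → con 0ℚ := a :* con 0ℚ :+ con (ℚ.- 1ℚ) :* (b :* con 0ℚ)) refl
  step : ∀ a b m f g p q → m ℚ.* (a ℚ.* f ℚ.+ ℚ.- 1ℚ ℚ.* (b ℚ.* g)) ℚ.+ (a ℚ.* p ℚ.+ ℚ.- 1ℚ ℚ.* (b ℚ.* q))
       ≡ a ℚ.* (m ℚ.* f ℚ.+ p) ℚ.+ ℚ.- 1ℚ ℚ.* (b ℚ.* (m ℚ.* g ℚ.+ q))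
  step = solve 7 (λ a b m f g p q → m :* (a :* f :+ con (ℚ.- 1ℚ) :* (b :* g)) :+ (a :* p :+ con (ℚ.- 1ℚ) :* (b :* q))
       := a :* (m :* f :+ p) :+ con (ℚ.- 1ℚ) :* (b :* (m :* g :+ q))) refl
  split : ∀ {n} (μ : Fin n → ℝ) (x : Fin n → Point e) → ∑ (λ i → μ i * value (x i)) ≃
          α * ∑ (λ i → μ i * F.fun (x i)) + ⁻ (β * ∑ (λ i → μ i * G.fun (x i)))
  split {zero} μ x = ≃-pointwise λ n → base (seq α n) (seq β n)
  split {suc n} μ x = ≃-trans (+-cong ≃-refl (split (μ ∘ suc) (x ∘ suc)))
    (≃-pointwise λ n → step (seq α n) (seq β n) (seq (μ zero) n) (seq (F.fun (x zero)) n) (seq (G.fun (x zero)) n)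
      (seq (∑ (λ i → μ (suc i) * F.fun (x (suc i)))) n) (seq (∑ (λ i → μ (suc i) * G.fun (x (suc i)))) n))

-- Dual functionals, exchange of basis points, uniqueness of dimension

StronglyIndependent : ∀ {e n} → (Fin n → Point e) → Set
StronglyIndependent z = ∀ μ → ∃[ i ] Apart (μ i) → ∃[ j ] Apart (combination μ z j)

skip₁ : ∀ {n} → Fin (suc n) → Fin (suc (suc n))
skip₁ = punchIn (suc zero)

∑-elim : ∀ {n} (μ w u : Fin n → ℝ) c d →
  ∑ (λ i → μ i * (c * w i + ⁻ u i * d)) ≃ ∑ (λ i → (μ i * c) * w i) + ⁻ ∑ (λ i → μ i * u i) * d
∑-elim {zero} μ w u c d = ≃-pointwise λ n → base (seq d n)
  where
  base : ∀ d → 0ℚ ≡ 0ℚ ℚ.+ ℚ.- 1ℚ ℚ.* 0ℚ ℚ.* d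
  base = solve 1 (λ d → con 0ℚ := con 0ℚ :+ con (ℚ.- 1ℚ) :* con 0ℚ :* d) refl
∑-elim {suc n} μ w u c d = ≃-trans (+-cong ≃-refl (∑-elim (μ ∘ suc) (w ∘ suc) (u ∘ suc) c d))
  (≃-pointwise λ n → step (seq (μ zero) n) (seq (w zero) n) (seq (u zero) n) (seq c n) (seq d n)
    (seq (∑ (λ i → μ (suc i) * c * w (suc i))) n) (seq (∑ (λ i → μ (suc i) * u (suc i))) n))
  where
  step : ∀ m w u c d p q → m ℚ.* (c ℚ.* w ℚ.+ ℚ.- 1ℚ ℚ.* u ℚ.* d) ℚ.+ (p ℚ.+ ℚ.- 1ℚ ℚ.* q ℚ.* d)
       ≡ m ℚ.* c ℚ.* w ℚ.+ p ℚ.+ ℚ.- 1ℚ ℚ.* (m ℚ.* u ℚ.+ q) ℚ.* d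
  step = solve 7 (λ m w u c d p q → m :* (c :* w :+ con (ℚ.- 1ℚ) :* u :* d) :+ (p :+ con (ℚ.- 1ℚ) :* q :* d)
       := m :* c :* w :+ p :+ con (ℚ.- 1ℚ) :* (m :* u :+ q) :* d) refl

swap-sum : ∀ a b c → a + (b + c) ≃ a + c + b
swap-sum a b c = ≃-pointwise λ n → s (seq a n) (seq b n) (seq c n)
  where
  s : ∀ a b c → a ℚ.+ (b ℚ.+ c) ≡ a ℚ.+ c ℚ.+ b
  s = solve 3 (λ a b c → a :+ (b :+ c) := a :+ c :+ b) refl

-- Gaussian elimination without deciding whether a real is zero: independence, applied to a unit
-- coefficient vector, itself supplies a coordinate at which `w` is apart from 0. That coordinate is
-- the pivot.
dual-linear : ∀ {e} n (z : Fin (suc n) → Point e) → StronglyIndependent z →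
  Σ[ L ∈ Lin e ] (∀ b → Lin.fun L (z (suc b)) ≃ 0ℝ) × Apart (Lin.fun L (z zero))
dual-linear zero z ind with ind (λ _ → 1ℝ) (zero , Apart-fromℚ (λ ()))
... | j , q = coordinate j , (λ ()) , Apart-resp (≃-trans (+-identityʳ _) (*-identityˡ _)) q
dual-linear {e} (suc n) z ind = extend (ind pick (suc zero , Apart-fromℚ (λ ())))
  where
  w = z (suc zero)
  pick : Fin (suc (suc n)) → ℝ
  pick zero = 0ℝ
  pick (suc zero) = 1ℝ
  pick (suc (suc _)) = 0ℝ
  extend : ∃[ j ] Apart (combination pick z j) →
    Σ[ L ∈ Lin e ] (∀ b → Lin.fun L (z (suc b)) ≃ 0ℝ) × Apart (Lin.fun L (z zero))
  extend (p , q) = eliminate L w p , vanish , proj₂ (proj₂ rest)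
    where
    pivot : Apart (w p)
    pivot = Apart-resp (begin
      0ℝ * z zero p + (1ℝ * w p + ∑ (λ i → 0ℝ * z (suc (suc i)) p)) ≈⟨ +-cong (zeroˡ _) (+-cong (*-identityˡ _) (∑-zero (λ i → zeroˡ (z (suc (suc i)) p)))) ⟩
      0ℝ + (w p + 0ℝ)                                              ≈⟨ ≃-trans (+-identityˡ _) (+-identityʳ _) ⟩
      w p                                                           ∎) q
      where open ≃-Reasoning
    y : Fin (suc n) → Point e
    y b = lin (w p) (z (skip₁ b)) (⁻ z (skip₁ b) p) w
    y-ind : StronglyIndependent y
    y-ind μ (i , Aμ) = let j , r = ind ν (lift i Aμ) in j , Apart-resp (agree j) r
      where
      -- Rewrites a combination of the eliminated vectors `y` as one of the `z`; the coefficient of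
      -- `w` collects everything that was subtracted.
      ν : Fin (suc (suc n)) → ℝ
      ν zero = μ zero * w p
      ν (suc zero) = ⁻ ∑ (λ b → μ b * z (skip₁ b) p)
      ν (suc (suc b)) = μ (suc b) * w p
      lift : ∀ i → Apart (μ i) → ∃[ i ] Apart (ν i)
      lift zero q = zero , Apart-* q pivot
      lift (suc i) q = suc (suc i) , Apart-* q pivot
      agree : ∀ j → combination ν z j ≃ combination μ y j
      agree j = ≃-trans (swap-sum _ _ _) (≃-sym (∑-elim μ (λ b → z (skip₁ b) j) (λ b → z (skip₁ b) p) (w p) (w j)))
    rest = dual-linear n y y-ind
    L = proj₁ rest
    cancel : ∀ a b → a ℚ.* b ℚ.+ ℚ.- 1ℚ ℚ.* a ℚ.* b ≡ 0ℚ
    cancel = solve 2 (λ a b → a :* b :+ con (ℚ.- 1ℚ) :* a :* b := con 0ℚ) refl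
    vanish : ∀ b → Lin.fun (eliminate L w p) (z (suc b)) ≃ 0ℝ
    vanish zero = Lin.preserves-0 L (λ j → ≃-pointwise λ n → cancel (seq (w p) n) (seq (w j) n))
    vanish (suc b) = proj₁ (proj₂ rest) b

-- Taking differences from the base point `o` turns affine into linear independence: giving `o` the
-- coefficient `⁻ ∑ μ` makes the coefficients sum to 0.
dual-affine-head : ∀ {e} n (x : Fin (suc n) → Point e) → AffinelyIndependent x →
  Σ[ f ∈ Aff e ] (∀ b → f ⟪ x (suc b) ⟫ ≃ 0ℝ) × Apart (f ⟪ x zero ⟫)
dual-affine-head zero x ind = constant 1ℝ , (λ ()) , Apart-fromℚ (λ ())
dual-affine-head {e} (suc n) x ind = based L o , vanish , proj₂ (proj₂ rest)
  where
  o = x (suc zero)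
  z : Fin (suc n) → Point e
  z b = x (skip₁ b) ⊖ o
  z-ind : StronglyIndependent z
  z-ind μ (i , Aμ) = let j , r = ind ν (unwrap ∑ν) (lift i Aμ) in j , Apart-resp (agree j) (#⇒Apart r)
    where
    ν : Fin (suc (suc n)) → ℝ
    ν zero = μ zero
    ν (suc zero) = ⁻ ∑ μ
    ν (suc (suc b)) = μ (suc b)
    s : ∀ a b → a ℚ.+ (ℚ.- 1ℚ ℚ.* (a ℚ.+ b) ℚ.+ b) ≡ 0ℚ
    s = solve 2 (λ a b → a :+ (con (ℚ.- 1ℚ) :* (a :+ b) :+ b) := con 0ℚ) refl
    ∑ν : ∑ ν ≃ 0ℝ
    ∑ν = ≃-pointwise λ n → s (seq (μ zero) n) (seq (∑ (μ ∘ suc)) n)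
    lift : ∀ i → Apart (μ i) → ∃[ i ] ν i # 0ℝ
    lift zero q = zero , Apart⇒# q
    lift (suc i) q = suc (suc i) , Apart⇒# q
    agree : ∀ j → combination ν x j ≃ combination μ z j
    agree j = ≃-trans (swap-sum _ _ _) (≃-sym (∑-sub μ (λ b → x (skip₁ b) j) (o j)))
  rest = dual-linear n z z-ind
  L = proj₁ rest
  cancel : ∀ a → a ℚ.+ ℚ.- 1ℚ ℚ.* a ≡ 0ℚ
  cancel = solve 1 (λ a → a :+ con (ℚ.- 1ℚ) :* a := con 0ℚ) refl
  vanish : ∀ b → based L o ⟪ x (suc b) ⟫ ≃ 0ℝ
  vanish zero = Lin.preserves-0 L (λ j → ≃-pointwise λ n → cancel (seq (o j) n))
  vanish (suc b) = proj₁ (proj₂ rest) b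

bring : ∀ {A : Set} {n} → Fin (suc n) → (Fin (suc n) → A) → Fin (suc n) → A
bring a x zero = x a
bring a x (suc b) = x (punchIn a b)

bring-independent : ∀ {e n} (a : Fin (suc n)) (x : Fin (suc n) → Point e) →
  AffinelyIndependent x → AffinelyIndependent (bring a x)
bring-independent {e} {n} a x ind μ ∑μ (i , Aμ) =
  let j , r = ind ν (unwrap ∑ν≃0) (lift i Aμ) in j , Apart⇒# (Apart-resp (agree j) (#⇒Apart r))
  where
  ν : Fin (suc n) → ℝ
  ν = insertAt (μ ∘ suc) a (μ zero)
  νa : ν a ≡ μ zero
  νa = insertAt-lookup (μ ∘ suc) a (μ zero)
  νp : ∀ b → ν (punchIn a b) ≡ μ (suc b)
  νp = insertAt-punchIn (μ ∘ suc) a (μ zero)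
  ≡⇒≃ : ∀ {p q : ℝ} → p ≡ q → p ≃ q
  ≡⇒≃ refl = ≃-refl
  ∑ν : ∑ ν ≃ ∑ μ
  ∑ν = ≃-trans (sum-remove {i = a} ν) (+-cong (≡⇒≃ νa) (∑-cong (λ b → ≡⇒≃ (νp b))))
  ∑ν≃0 : ∑ ν ≃ 0ℝ
  ∑ν≃0 = ≃-trans ∑ν (wrap ∑μ)
  lift : ∀ i → μ i # 0ℝ → ∃[ i ] ν i # 0ℝ
  lift zero q = a , subst (_# 0ℝ) (≡.sym νa) q
  lift (suc b) q = punchIn a b , subst (_# 0ℝ) (≡.sym (νp b)) q
  agree : ∀ j → combination ν x j ≃ combination μ (bring a x) j
  agree j = ≃-trans (sum-remove {i = a} (λ i → ν i * x i j))
    (+-cong (*-cong (≡⇒≃ νa) ≃-refl) (∑-cong (λ b → *-cong (≡⇒≃ (νp b)) ≃-refl)))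

dual-affine : ∀ {e n} (x : Fin (suc n) → Point e) → AffinelyIndependent x → ∀ a →
  Σ[ f ∈ Aff e ] (∀ b → a ≢ b → f ⟪ x b ⟫ ≃ 0ℝ) × Apart (f ⟪ x a ⟫)
dual-affine {n = n} x ind a with dual-affine-head n (bring a x) (bring-independent a x ind)
... | f , vanish , diag = f , (λ b a≢b → subst (λ c → f ⟪ x c ⟫ ≃ 0ℝ) (Finₚ.punchIn-punchOut a≢b) (vanish (punchOut a≢b))) , diag

-- An affine basis of `S` presented by dual functionals that are only required to be apart from 0 on
-- the diagonal. Spanning is expressed by the vanishing of affine functionals rather than by
-- coordinates, so an exchange divides by no real number.
record Frame {e} (S : Pred (Point e) 0ℓ) (n : ℕ) : Set where
  field
    pts  : Fin n → Point e
    mem  : ∀ a → pts a ∈ᵖ S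
    φ    : Fin n → Aff e
    off  : ∀ {a b} → a ≢ b → φ a ⟪ pts b ⟫ ≃ 0ℝ
    diag : ∀ a → Apart (φ a ⟪ pts a ⟫)
    span : ∀ g → (∀ a → g ⟪ pts a ⟫ ≃ 0ℝ) → ∀ y → y ∈ᵖ S → g ⟪ y ⟫ ≃ 0ℝ

wrapped : ∀ {e} {x y : Point e} → x ≋ y → x ≅ y
wrapped eq j = wrap (eq j)

frame : ∀ {e} {S : Pred (Point e) 0ℓ} {k} → HasDimension S k → Frame S (suc k)
frame {S = S} (x , x∈S , ind , S⊆aff) = record
  { pts = x ; mem = x∈S
  ; φ = λ a → proj₁ (dual-affine x ind a)
  ; off = λ {a} {b} → proj₁ (proj₂ (dual-affine x ind a)) b
  ; diag = λ a → proj₂ (proj₂ (dual-affine x ind a))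
  ; span = λ g g0 y y∈S → let μ , ∑μ , y≋ = S⊆aff y y∈S in
      ≃-trans (Aff.resp g (wrapped y≋)) (≃-trans (Aff.affine g μ x (wrap ∑μ)) (∑-zero {f = λ i → μ i * g ⟪ x i ⟫} (λ i → *-zero (g0 i)))) }

-- Steinitz exchange: since `φ a` vanishes at the other points, its value at `u` shows `u` to be off
-- their affine span. The other functionals are corrected by a multiple of `φ a` so as to vanish at
-- `u`.
exchange : ∀ {e} {S : Pred (Point e) 0ℓ} {n} (X : Frame S n) → let open Frame X in
  ∀ a u → u ∈ᵖ S → Apart (φ a ⟪ u ⟫) →
  Σ[ Y ∈ Frame S n ] Frame.pts Y a ≡ u × (∀ b → b ≢ a → Frame.pts Y b ≡ pts b)
exchange {e} {S} {n} X a u u∈S Au = record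
  { pts = pts′ ; mem = mem′ ; φ = φ′ ; off = off′ ; diag = diag′ ; span = span′ } , pts′-a , pts′-b
  where
  open Frame X
  new : ∀ {b} → Dec (b ≡ a) → Point e
  new {b} (yes _) = u
  new {b} (no _) = pts b
  pts′ : Fin n → Point e
  pts′ b = new (b Finₚ.≟ a)
  pts′-a : pts′ a ≡ u
  pts′-a with a Finₚ.≟ a
  ... | yes _ = refl
  ... | no a≢a = ⊥-elim (a≢a refl)
  pts′-b : ∀ b → b ≢ a → pts′ b ≡ pts b
  pts′-b b b≢a with b Finₚ.≟ a
  ... | yes b≡a = ⊥-elim (b≢a b≡a)
  ... | no _ = refl
  mem′ : ∀ b → pts′ b ∈ᵖ S
  mem′ b with b Finₚ.≟ a
  ... | yes _ = u∈S
  ... | no _ = mem b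
  corrected : Fin n → Aff e
  corrected b = cross (φ a ⟪ u ⟫) (φ b) (φ b ⟪ u ⟫) (φ a)
  newφ : ∀ {b} → Dec (b ≡ a) → Aff e
  newφ (yes _) = φ a
  newφ {b} (no _) = corrected b
  φ′ : Fin n → Aff e
  φ′ b = newφ (b Finₚ.≟ a)
  cancel : ∀ p q → p ℚ.* q ℚ.+ ℚ.- 1ℚ ℚ.* (q ℚ.* p) ≡ 0ℚ
  cancel = solve 2 (λ p q → p :* q :+ con (ℚ.- 1ℚ) :* (q :* p) := con 0ℚ) refl
  corrected-u : ∀ b → corrected b ⟪ u ⟫ ≃ 0ℝ
  corrected-u b = ≃-pointwise λ n → cancel (seq (φ a ⟪ u ⟫) n) (seq (φ b ⟪ u ⟫) n)
  corrected-c : ∀ b c → c ≢ a → corrected b ⟪ pts c ⟫ ≃ φ a ⟪ u ⟫ * φ b ⟪ pts c ⟫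
  corrected-c b c c≢a = ≃-trans
    (+-cong ≃-refl (*-zero (*-zero (off (λ a≡c → c≢a (≡.sym a≡c)))))) (+-identityʳ _)
  off′ : ∀ {b c} → b ≢ c → φ′ b ⟪ pts′ c ⟫ ≃ 0ℝ
  off′ {b} {c} b≢c with b Finₚ.≟ a | c Finₚ.≟ a
  ... | yes refl | yes refl = ⊥-elim (b≢c refl)
  ... | yes refl | no c≢a = off (λ a≡c → c≢a (≡.sym a≡c))
  ... | no b≢a | yes _ = corrected-u b
  ... | no b≢a | no c≢a = ≃-trans (corrected-c b c c≢a) (*-zero (off b≢c))
  diag′ : ∀ b → Apart (φ′ b ⟪ pts′ b ⟫)
  diag′ b with b Finₚ.≟ a
  ... | yes _ = Au
  ... | no b≢a = Apart-resp (≃-sym (corrected-c b b b≢a)) (Apart-* Au (diag b))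
  span′ : ∀ g → (∀ b → g ⟪ pts′ b ⟫ ≃ 0ℝ) → ∀ y → y ∈ᵖ S → g ⟪ y ⟫ ≃ 0ℝ
  span′ g g0 = span g old
    where
    g-u : g ⟪ u ⟫ ≃ 0ℝ
    g-u = subst (λ p → g ⟪ p ⟫ ≃ 0ℝ) pts′-a (g0 a)
    g-b : ∀ b → b ≢ a → g ⟪ pts b ⟫ ≃ 0ℝ
    g-b b b≢a = subst (λ p → g ⟪ p ⟫ ≃ 0ℝ) (pts′-b b b≢a) (g0 b)
    -- φₐ(xₐ) g − g(xₐ) φₐ vanishes on all old points, hence at u, where only g(xₐ) φₐ(u) survives.
    k : Aff e
    k = cross (φ a ⟪ pts a ⟫) g (g ⟪ pts a ⟫) (φ a)
    k0 : ∀ b → k ⟪ pts b ⟫ ≃ 0ℝ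
    k0 b with b Finₚ.≟ a
    ... | yes refl = ≃-pointwise λ n → cancel (seq (φ a ⟪ pts a ⟫) n) (seq (g ⟪ pts a ⟫) n)
    ... | no b≢a = ≃-trans (+-cong (*-zero (g-b b b≢a)) (*-zero (*-zero (off (λ a≡b → b≢a (≡.sym a≡b)))))) (+-identityʳ _)
    isolate : ∀ p q → p ℚ.* q ≡ ℚ.- 1ℚ ℚ.* (0ℚ ℚ.+ ℚ.- 1ℚ ℚ.* (q ℚ.* p))
    isolate = solve 2 (λ p q → p :* q := con (ℚ.- 1ℚ) :* (con 0ℚ :+ con (ℚ.- 1ℚ) :* (q :* p))) refl
    prod : φ a ⟪ u ⟫ * g ⟪ pts a ⟫ ≃ 0ℝ
    prod = begin
      φ a ⟪ u ⟫ * g ⟪ pts a ⟫                     ≈⟨ (≃-pointwise λ n → isolate (seq (φ a ⟪ u ⟫) n) (seq (g ⟪ pts a ⟫) n)) ⟩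
      ⁻ (0ℝ + ⁻ (g ⟪ pts a ⟫ * φ a ⟪ u ⟫))        ≈⟨ *-cong ≃-refl (+-cong (≃-sym (*-zero g-u)) ≃-refl) ⟩
      ⁻ (k ⟪ u ⟫)                                 ≈⟨ *-zero (span k k0 u u∈S) ⟩
      0ℝ                                          ∎
      where open ≃-Reasoning
    old : ∀ b → g ⟪ pts b ⟫ ≃ 0ℝ
    old b with b Finₚ.≟ a
    ... | yes refl = Apart-cancel Au prod
    ... | no b≢a = g-b b b≢a

module _ {e} {S : Pred (Point e) 0ℓ} {n} (Q : Point e → Set)
         (replacement : ∀ (X : Frame S n) a → Σ[ u ∈ Point e ] Q u × u ∈ᵖ S × Apart (Frame.φ X a ⟪ u ⟫)) where

  private
    -- One exchange per index; an exchange at `m` leaves the earlier points in place, so they keep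
    -- `Q`. A replacement has to be available for every frame because each exchange alters the
    -- functionals.
    replace-below : ∀ m → Frame S n → Σ[ X ∈ Frame S n ] (∀ b → toℕ b ℕ.< m → Q (Frame.pts X b))
    replace-below zero X = X , λ _ ()
    replace-below (suc m) X₀ = next (replace-below m X₀) (m ℕₚ.<? n)
      where
      next : Σ[ X ∈ Frame S n ] (∀ b → toℕ b ℕ.< m → Q (Frame.pts X b)) → Dec (m ℕ.< n) →
             Σ[ X ∈ Frame S n ] (∀ b → toℕ b ℕ.< suc m → Q (Frame.pts X b))
      next (X , q) (no m≮n) = X , λ b _ → q b (ℕₚ.<-≤-trans (Finₚ.toℕ<n b) (ℕₚ.≮⇒≥ m≮n))
      next (X , q) (yes m<n) = install (replacement X a)
        where
        a = fromℕ< m<n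
        install : Σ[ u ∈ Point e ] Q u × u ∈ᵖ S × Apart (Frame.φ X a ⟪ u ⟫) →
                  Σ[ X ∈ Frame S n ] (∀ b → toℕ b ℕ.< suc m → Q (Frame.pts X b))
        install (u , Qu , u∈S , Au) = let Y , at , elsewhere = exchange X a u u∈S Au in
          Y , λ b b<1+m → decide Y at elsewhere b b<1+m (b Finₚ.≟ a)
          where
          decide : ∀ Y → Frame.pts Y a ≡ u → (∀ b → b ≢ a → Frame.pts Y b ≡ Frame.pts X b) →
                   ∀ b → toℕ b ℕ.< suc m → Dec (b ≡ a) → Q (Frame.pts Y b)
          decide Y at elsewhere b _ (yes refl) = subst Q (≡.sym at) Qu
          decide Y at elsewhere b b<1+m (no b≢a) = subst Q (≡.sym (elsewhere b b≢a)) (q b (ℕₚ.≤∧≢⇒< (ℕₚ.≤-pred b<1+m)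
            (λ eq → b≢a (Finₚ.toℕ-injective (≡.trans eq (≡.sym (Finₚ.toℕ-fromℕ< m<n)))))))

  replace-all : Frame S n → Σ[ X ∈ Frame S n ] (∀ b → Q (Frame.pts X b))
  replace-all X = let Y , q = replace-below n X in Y , λ b → q b (Finₚ.toℕ<n b)

-- Exchange the first basis for points `y b` of the second. If some `y b` is left out, its dual
-- functional vanishes on the new basis, hence on `S`, yet is apart from 0 at `y b`. If none is left
-- out, more points than places contradict the pigeonhole principle.
dimension-≤ : ∀ {e} {S : Pred (Point e) 0ℓ} {m n} → HasDimension S m → HasDimension S n → n ℕ.≤ m
dimension-≤ {e} {S} {m} {n} X Y@(y , y∈S , _ , S⊆aff) = ℕₚ.≮⇒≥ λ m<n → missed (suc-mono m<n)
  where
  suc-mono : m ℕ.< n → suc m ℕ.< suc n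
  suc-mono = ℕ.s≤s
  Q : Point e → Set
  Q u = ∃[ b ] u ≡ y b
  replacement : ∀ (X : Frame S (suc m)) a → Σ[ u ∈ Point e ] Q u × u ∈ᵖ S × Apart (Frame.φ X a ⟪ u ⟫)
  replacement X a = locate (S⊆aff (pts a) (mem a))
    where
    open Frame X
    locate : pts a ∈ᵖ aff y → Σ[ u ∈ Point e ] Q u × u ∈ᵖ S × Apart (φ a ⟪ u ⟫)
    locate (β , ∑β , x≋) =
      let b , q = Apart-∑ (λ b → β b * φ a ⟪ y b ⟫) (Apart-resp expand (diag a))
      in y b , (b , refl) , y∈S b , Apart-*ʳ {β b} {φ a ⟪ y b ⟫} q
      where
      expand : φ a ⟪ pts a ⟫ ≃ ∑ (λ b → β b * φ a ⟪ y b ⟫)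
      expand = ≃-trans (Aff.resp (φ a) (wrapped x≋)) (Aff.affine (φ a) β y (wrap ∑β))
  Z = replace-all Q replacement (frame X)
  index : Fin (suc m) → Fin (suc n)
  index a = proj₁ (proj₂ Z a)
  missed : suc m ℕ.< suc n → ⊥
  missed lt = decide (Finₚ.any? (λ b → Finₚ.all? (λ a → ¬? (index a Finₚ.≟ b))))
    where
    F = frame Y
    decide : Dec (∃[ b ] (∀ a → ¬ index a ≡ b)) → ⊥
    decide (yes (b , avoid)) = Apart-≉0 (Frame.diag F b) (Frame.span (proj₁ Z) (Frame.φ F b)
      (λ a → subst (λ p → Frame.φ F b ⟪ p ⟫ ≃ 0ℝ) (≡.sym (proj₂ (proj₂ Z a))) (Frame.off F (λ eq → avoid a (≡.sym eq)))) (y b) (y∈S b))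
    decide (no none) = let i , j , i<j , eq = Finₚ.pigeonhole lt preimage in
        Finₚ.<-irrefl (≡.trans (≡.sym (hits i)) (≡.trans (cong index eq) (hits j))) i<j
      where
      hit : ∀ b → ∃[ a ] index a ≡ b
      hit b = search (Finₚ.any? (λ a → index a Finₚ.≟ b))
        where
        search : Dec (∃[ a ] index a ≡ b) → ∃[ a ] index a ≡ b
        search (yes p) = p
        search (no ¬p) = ⊥-elim (none (b , λ a eq → ¬p (a , eq)))
      preimage : Fin (suc n) → Fin (suc m)
      preimage b = proj₁ (hit b)
      hits : ∀ b → index (preimage b) ≡ b
      hits b = proj₂ (hit b)

dimension-unique : ∀ {e} {S : Pred (Point e) 0ℓ} {m n} → HasDimension S m → HasDimension S n → m ≡ n
dimension-unique X Y = ℕₚ.≤-antisym (dimension-≤ Y X) (dimension-≤ X Y)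

-- From certificates to real polytopes

fromℚ-∑ : ∀ {n} (f g : Fin n → ℚ) → ∑ (λ i → fromℚ (f i) * fromℚ (g i)) ≃ fromℚ (∑q (λ i → f i ℚ.* g i))
fromℚ-∑ {zero} f g = ≃-refl
fromℚ-∑ {suc n} f g = ≃-trans (+-cong ≃-refl (fromℚ-∑ (f ∘ suc) (g ∘ suc))) (≃-pointwise λ _ → refl)

fromℚ-cong : ∀ {p q} → p ≡ q → fromℚ p ≃ fromℚ q
fromℚ-cong refl = ≃-refl

∑-single : ∀ {n} (f : Fin n → ℝ) i → (∀ k → k ≢ i → f k ≃ 0ℝ) → ∑ f ≃ f i
∑-single {suc n} f i zeros = ≃-trans (sum-remove {i = i} f)
  (≃-trans (+-cong ≃-refl (∑-zero (λ b → zeros (punchIn i b) (Finₚ.punchInᵢ≢i i b)))) (+-identityʳ _))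

vertex∈conv : ∀ {e n} (x : Fin n → Point e) i → conv x (x i)
vertex∈conv x i = (λ k → fromℚ (indicator i k)) , (λ k → Nonneg⇒≤ (Nonneg-fromℚ (indicator-nonneg i k)))
  , unwrap total , λ j → unwrap (≃-sym (value j))
  where
  value : ∀ j → ∑ (λ k → fromℚ (indicator i k) * x k j) ≃ x i j
  value j = ≃-trans (∑-single (λ k → fromℚ (indicator i k) * x k j) i
      (λ k k≢i → ≃-trans (*-cong (fromℚ-cong (indicator-other k≢i)) ≃-refl) (zeroˡ (x k j))))
    (≃-trans (*-cong (fromℚ-cong (indicator-self i)) ≃-refl) (*-identityˡ (x i j)))
  total : ∑ (λ k → fromℚ (indicator i k)) ≃ 1ℝ
  total = ≃-trans (∑-single (λ k → fromℚ (indicator i k)) i (λ k k≢i → fromℚ-cong (indicator-other k≢i))) (fromℚ-cong (indicator-self i))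

dimension-resp : ∀ {e} {S S′ : Pred (Point e) 0ℓ} {k} → S ≐′ S′ → HasDimension S k → HasDimension S′ k
dimension-resp (S⊆ , ⊆S) (x , x∈ , ind , sub) = x , (λ i → S⊆ (x i) (x∈ i)) , ind , λ y y∈ → sub y (⊆S y y∈)

negated-dot : ∀ {e} (r : Fin e → ℚ) (y : Point e) → (λ j → fromℚ (ℚ.- r j)) · y ≃ ⁻ ((λ j → fromℚ (r j)) · y)
negated-dot {zero} r y = ≃-pointwise λ _ → refl
negated-dot {suc e} r y = ≃-trans (+-cong ≃-refl (negated-dot (r ∘ suc) (y ∘ suc)))
  (≃-pointwise λ n → s (r zero) (seq (y zero) n) (seq ((λ j → fromℚ (r (suc j))) · (y ∘ suc)) n))
  where
  s : ∀ r y p → ℚ.- r ℚ.* y ℚ.+ ℚ.- 1ℚ ℚ.* p ≡ ℚ.- 1ℚ ℚ.* (r ℚ.* y ℚ.+ p)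
  s = solve 3 (λ r y p → :- r :* y :+ con (ℚ.- 1ℚ) :* p := con (ℚ.- 1ℚ) :* (r :* y :+ p)) refl

neg-neg : ∀ x → ⁻ ⁻ x ≃ x
neg-neg x = ≃-pointwise λ n → s (seq x n)
  where
  s : ∀ a → ℚ.- 1ℚ ℚ.* (ℚ.- 1ℚ ℚ.* a) ≡ a
  s = solve 1 (λ a → con (ℚ.- 1ℚ) :* (con (ℚ.- 1ℚ) :* a) := a) refl

neg-≤0 : ∀ {x} → Nonneg x → ⁻ x ≤ 0ℝ
neg-≤0 {x} (nonneg p) ε ε>0 = Ev-map (λ n le → below (seq x n) le) (p ε ε>0)
  where
  s : ∀ a e → ℚ.- 1ℚ ℚ.* a ℚ.+ (a ℚ.+ e) ≡ 0ℚ ℚ.+ e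
  s = solve 2 (λ a e → con (ℚ.- 1ℚ) :* a :+ (a :+ e) := con 0ℚ :+ e) refl
  below : ∀ a → 0ℚ ℚ.≤ a ℚ.+ ε → ℚ.- 1ℚ ℚ.* a ℚ.≤ 0ℚ ℚ.+ ε
  below a le = subst (ℚ.- 1ℚ ℚ.* a ℚ.≤_) (s a ε) (subst (ℚ._≤ ℚ.- 1ℚ ℚ.* a ℚ.+ (a ℚ.+ ε)) (ℚₚ.+-identityʳ _) (ℚₚ.+-monoʳ-≤ (ℚ.- 1ℚ ℚ.* a) le))

rational : Q⁵ → Lin 5
rational r = dot (λ j → fromℚ (r j))

embed : Q⁵ → Point 5
embed x j = fromℚ (x j)

rational-embed : ∀ r x → Lin.fun (rational r) (embed x) ≃ fromℚ ⟨ r , x ⟩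
rational-embed r x = ≃-trans (fromℚ-∑ r x) (fromℚ-cong (≡.sym (⟨⟩-unfold r x)))

module Realisation (C : Cert) where
  open Cert C

  scale : V → ℚ
  scale v = ⟨ chart , vert v ⟩

  scale-inv : ∀ v → scale v ℚ.* inv (scale v) ≡ 1ℚ
  scale-inv v = inv-inverse (scale v) (>⇒≢0 (chart>0 v))

  gv : V → Q⁵
  gv v j = inv (scale v) ℚ.* vert v j

  pt : V → Point 5
  pt v = embed (gv v)

  gens : Vector (Point 5) nV
  gens i = pt (VE.to i)

  rational-pt : ∀ r v → Lin.fun (rational r) (pt v) ≃ fromℚ (inv (scale v) ℚ.* ⟨ r , vert v ⟩)
  rational-pt r v = ≃-trans (rational-embed r (gv v)) (fromℚ-cong (⟨⟩-scale r (inv (scale v)) (vert v)))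

  chart-pt : ∀ v → Lin.fun (rational chart) (pt v) ≃ 1ℝ
  chart-pt v = ≃-trans (rational-pt chart v) (fromℚ-cong (≡.trans (ℚₚ.*-comm _ (scale v)) (scale-inv v)))

  vert-gv : ∀ v j → vert v j ≡ scale v ℚ.* gv v j
  vert-gv v j = ≡.sym (≡.trans (≡.sym (ℚₚ.*-assoc (scale v) (inv (scale v)) (vert v j)))
    (≡.trans (cong (ℚ._* vert v j) (scale-inv v)) (ℚₚ.*-identityˡ (vert v j))))

  NonnegOn : Q⁵ → Set
  NonnegOn r = ∀ v → 0ℚ ℚ.≤ ⟨ r , vert v ⟩

  rational-nonneg : ∀ r → NonnegOn r → ∀ v → Nonneg (Lin.fun (rational r) (pt v))
  rational-nonneg r r≥0 v = Nonneg-resp (≃-sym (rational-pt r v))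
    (Nonneg-fromℚ (*-nonneg (ℚₚ.<⇒≤ (inv-pos (chart>0 v))) (r≥0 v)))

  rational-zero : ∀ r v → ⟨ r , vert v ⟩ ≡ 0ℚ → Lin.fun (rational r) (pt v) ≃ 0ℝ
  rational-zero r v eq = ≃-trans (rational-pt r v) (fromℚ-cong (≡.trans (cong (inv (scale v) ℚ.*_) eq) (ℚₚ.*-zeroʳ (inv (scale v)))))

  rational-apart : ∀ r v → ⟨ r , vert v ⟩ ≢ 0ℚ → Apart (Lin.fun (rational r) (pt v))
  rational-apart r v ≢0 = Apart-resp (≃-sym (rational-pt r v)) (Apart-fromℚ nonzero)
    where
    nonzero : inv (scale v) ℚ.* ⟨ r , vert v ⟩ ≢ 0ℚ
    nonzero eq = ≢0 (≡.trans (≡.sym (ℚₚ.*-identityˡ _)) (≡.trans (cong (ℚ._* ⟨ r , vert v ⟩) (≡.sym (scale-inv v)))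
      (≡.trans (ℚₚ.*-assoc (scale v) _ _) (≡.trans (cong (scale v ℚ.*_) eq) (ℚₚ.*-zeroʳ (scale v))))))

  record Duals (n : ℕ) : Set where
    field
      B    : Fin n → V
      dual : Fin n → Q⁵
      off  : ∀ {a b} → a ≢ b → ⟨ dual a , vert (B b) ⟩ ≡ 0ℚ
      diag : ∀ a → ⟨ dual a , vert (B a) ⟩ ≢ 0ℚ

    coef : Q⁵ → Fin n → ℚ
    coef x b = ⟨ dual b , x ⟩ ℚ.* inv ⟨ dual b , vert (B b) ⟩

    Spanned : Q⁵ → Set
    Spanned x = ∀ j → x j ≡ ∑q (λ b → coef x b ℚ.* vert (B b) j)

    corner-span : ∀ b x → (∀ j → x j ≡ vert (B b) j) → Spanned x
    corner-span b x eq j = ≡.sym (≡.trans (∑q-single _ b (λ k k≢b → ≡.trans (cong (ℚ._* vert (B k) j)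
        (≡.trans (cong (ℚ._* inv ⟨ dual k , vert (B k) ⟩) (≡.trans (⟨⟩-cong (dual k) eq) (off k≢b))) (ℚₚ.*-zeroˡ (inv ⟨ dual k , vert (B k) ⟩)))) (ℚₚ.*-zeroˡ (vert (B k) j))))
      (≡.trans (cong (ℚ._* vert (B b) j) (≡.trans (cong (ℚ._* inv ⟨ dual b , vert (B b) ⟩) (⟨⟩-cong (dual b) eq)) (inv-inverse _ (diag b))))
        (≡.trans (ℚₚ.*-identityˡ (vert (B b) j)) (≡.sym (eq j)))))

  -- `K` delimits the vectors that have an expansion. For a vertex or an edge it just names the
  -- corners, as finally only vertices are expanded; for triangles and facets it is a linear
  -- condition, because `extend` also applies it to vectors that are not vertices.
  record Basis (n : ℕ) (K : Q⁵ → Set) : Set where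
    field
      duals : Duals n
    open Duals duals public
    field
      span : ∀ x → K x → Spanned x

  module _ {n K} (𝔅 : Basis (suc n) K) where
    open Basis 𝔅

    -- Pairing the combination with `dual i` leaves only the term of `μ i`. The pairing is a sum
    -- over coordinates and is apart from 0, hence so is one coordinate.
    basis-independent : AffinelyIndependent (pt ∘ B)
    basis-independent μ _ (i , μi#0) =
      let j , q = Apart-∑ (λ j → fromℚ (dual i j) * combination μ (pt ∘ B) j) total
      in j , Apart⇒# (Apart-*ʳ {fromℚ (dual i j)} {combination μ (pt ∘ B) j} q)
      where
      L = rational (dual i)
      expand : μ i * Lin.fun L (pt (B i)) ≃ Lin.fun L (combination μ (pt ∘ B))
      expand = ≃-sym (≃-trans (Lin.preserves-∑ L μ (pt ∘ B))
        (∑-single (λ k → μ k * Lin.fun L (pt (B k))) i (λ k k≢i → *-zero (rational-zero (dual i) (B k) (off (λ eq → k≢i (≡.sym eq)))))))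
      total : Apart (Lin.fun L (combination μ (pt ∘ B)))
      total = Apart-resp expand (Apart-* (#⇒Apart μi#0) (rational-apart (dual i) (B i) (diag i)))

    module _ (μ : Fin nV → ℝ) (∑μ : ∑ μ ≃ 1ℝ) (supp : ∀ i → μ i ≃ 0ℝ ⊎ K (vert (VE.to i))) where

      private
        c : Fin nV → Fin (suc n) → ℚ
        -- The scales convert coefficients with respect to the rays `vert` into coefficients with
        -- respect to the points `gv` of the section.
        c i b = inv (scale (VE.to i)) ℚ.* coef (vert (VE.to i)) b ℚ.* scale (B b)

      β : Fin (suc n) → ℝ
      β b = ∑ (λ i → μ i * fromℚ (c i b))

      β-nonneg : (∀ i → Nonneg (μ i)) → (∀ v b → 0ℚ ℚ.≤ coef (vert v) b) → ∀ b → Nonneg (β b)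
      β-nonneg μ≥0 coef≥0 b = Nonneg-∑ (λ i → Nonneg-* (μ≥0 i) (Nonneg-fromℚ
        (*-nonneg (*-nonneg (ℚₚ.<⇒≤ (inv-pos (chart>0 (VE.to i)))) (coef≥0 (VE.to i) b)) (ℚₚ.<⇒≤ (chart>0 (B b))))))

      private
        expand-gv : ∀ i → K (vert (VE.to i)) → ∀ j → ∑q (λ b → c i b ℚ.* gv (B b) j) ≡ gv (VE.to i) j
        expand-gv i k j = begin
          ∑q (λ b → c i b ℚ.* gv (B b) j)                    ≡⟨ ℚ-Sum.sum-cong-≗ {suc n} (λ b → ≡.trans (s w (coef x b) (scale (B b)) (gv (B b) j)) (cong (λ z → w ℚ.* (coef x b ℚ.* z)) (≡.sym (vert-gv (B b) j)))) ⟩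
          ∑q (λ b → w ℚ.* (coef x b ℚ.* vert (B b) j))       ≡⟨ ℚ-Sum.*-distribˡ-sum w (λ b → coef x b ℚ.* vert (B b) j) ⟨
          w ℚ.* ∑q (λ b → coef x b ℚ.* vert (B b) j)         ≡⟨ cong (w ℚ.*_) (span x k j) ⟨
          gv (VE.to i) j                                     ∎
          where
          open ≡.≡-Reasoning
          x = vert (VE.to i)
          w = inv (scale (VE.to i))
          s : ∀ w c d g → w ℚ.* c ℚ.* d ℚ.* g ≡ w ℚ.* (c ℚ.* (d ℚ.* g))
          s = solve 4 (λ w c d g → w :* c :* d :* g := w :* (c :* (d :* g))) refl

        row : ∀ j i → μ i * ∑ (λ b → fromℚ (c i b) * pt (B b) j) ≃ μ i * gens i j
        row j i = decide (supp i)
          where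
          decide : μ i ≃ 0ℝ ⊎ K (vert (VE.to i)) → μ i * ∑ (λ b → fromℚ (c i b) * pt (B b) j) ≃ μ i * gens i j
          decide (inj₁ μ0) = ≃-trans (*-cong μ0 ≃-refl) (≃-trans (zeroˡ (∑ (λ b → fromℚ (c i b) * pt (B b) j))) (≃-sym (≃-trans (*-cong μ0 ≃-refl) (zeroˡ (gens i j)))))
          decide (inj₂ k) = *-cong ≃-refl (≃-trans (fromℚ-∑ (c i) (λ b → gv (B b) j)) (fromℚ-cong (expand-gv i k j)))

      β-combination : combination β (pt ∘ B) ≅ combination μ gens
      β-combination j = begin
        ∑ (λ b → β b * pt (B b) j)                                 ≈⟨ ∑-cong (λ b → *-distribʳ-sum (pt (B b) j) (λ i → μ i * fromℚ (c i b))) ⟩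
        ∑ (λ b → ∑ (λ i → μ i * fromℚ (c i b) * pt (B b) j))       ≈⟨ ∑-comm (λ b i → μ i * fromℚ (c i b) * pt (B b) j) ⟩
        ∑ (λ i → ∑ (λ b → μ i * fromℚ (c i b) * pt (B b) j))       ≈⟨ ∑-cong (λ i → ∑-cong (λ b → *-assoc (μ i) (fromℚ (c i b)) (pt (B b) j))) ⟩
        ∑ (λ i → ∑ (λ b → μ i * (fromℚ (c i b) * pt (B b) j)))     ≈⟨ ∑-cong (λ i → ≃-sym (*-distribˡ-sum (μ i) (λ b → fromℚ (c i b) * pt (B b) j))) ⟩
        ∑ (λ i → μ i * ∑ (λ b → fromℚ (c i b) * pt (B b) j))       ≈⟨ ∑-cong (row j) ⟩
        ∑ (λ i → μ i * gens i j)                                   ∎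
        where open ≃-Reasoning

      -- The chart is 1 at every vertex, so applying it to the equality of the two combinations
      -- gives the equality of the coefficient sums.
      ∑β : ∑ β ≃ 1ℝ
      ∑β = begin
        ∑ β                                                  ≈⟨ ∑-cong (λ b → ≃-sym (≃-trans (*-cong ≃-refl (chart-pt (B b))) (*-identityʳ (β b)))) ⟩
        ∑ (λ b → β b * Lin.fun L (pt (B b)))                 ≈⟨ Lin.preserves-∑ L β (pt ∘ B) ⟨
        Lin.fun L (combination β (pt ∘ B))                   ≈⟨ Lin.resp L β-combination ⟩
        Lin.fun L (combination μ gens)                       ≈⟨ Lin.preserves-∑ L μ gens ⟩
        ∑ (λ i → μ i * Lin.fun L (gens i))                   ≈⟨ ∑-cong (λ i → ≃-trans (*-cong ≃-refl (chart-pt (VE.to i))) (*-identityʳ (μ i))) ⟩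
        ∑ μ                                                  ≈⟨ ∑μ ⟩
        1ℝ                                                   ∎
        where
        open ≃-Reasoning
        L = rational chart

  -- One dimension up: as `h` vanishes on the old basis but not at `w`, adding multiples of `h` to
  -- the old dual functionals makes them vanish at `w` without changing their values on the old
  -- basis.
  extend : ∀ {n} {K K′ : Q⁵ → Set} (𝔅 : Basis n K) w h → ⟨ h , vert w ⟩ ≢ 0ℚ →
    (∀ b → ⟨ h , vert (Basis.B 𝔅 b) ⟩ ≡ 0ℚ) →
    (∀ x → K′ x → K (x ∸[ ⟨ h , x ⟩ ℚ.* inv ⟨ h , vert w ⟩ ] w)) → Basis (suc n) K′
  extend {n} {K} {K′} 𝔅 w h hw≢0 h0 reduce = record
    { duals = record { B = B′ ; dual = dual′ ; off = λ {a} {b} → off′ {a} {b} ; diag = diag′ } ; span = span′ }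
    where
    open Basis 𝔅
    B′ : Fin (suc n) → V
    B′ zero = w
    B′ (suc b) = B b
    k : Fin n → ℚ
    k b = ⟨ dual b , vert w ⟩ ℚ.* inv ⟨ h , vert w ⟩
    corrected : Fin n → Q⁵
    corrected b j = 1ℚ ℚ.* dual b j ℚ.+ ℚ.- k b ℚ.* h j
    dual′ : Fin (suc n) → Q⁵
    dual′ zero = h
    dual′ (suc b) = corrected b
    ⟨corrected⟩ : ∀ b x → ⟨ corrected b , x ⟩ ≡ ⟨ dual b , x ⟩ ℚ.- k b ℚ.* ⟨ h , x ⟩
    ⟨corrected⟩ b x = ≡.trans (⟨⟩-comm (corrected b) x) (≡.trans (⟨⟩-lin x 1ℚ (dual b) (ℚ.- k b) h)
      (≡.trans (s ⟨ x , dual b ⟩ (k b) ⟨ x , h ⟩) (cong₂ (λ p q → p ℚ.- k b ℚ.* q) (⟨⟩-comm x (dual b)) (⟨⟩-comm x h))))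
      where
      s : ∀ p k q → 1ℚ ℚ.* p ℚ.+ ℚ.- k ℚ.* q ≡ p ℚ.- k ℚ.* q
      s = solve 3 (λ p k q → con 1ℚ :* p :+ :- k :* q := p :- k :* q) refl
    on-old : ∀ a b → ⟨ corrected a , vert (B b) ⟩ ≡ ⟨ dual a , vert (B b) ⟩
    on-old a b = ≡.trans (⟨corrected⟩ a (vert (B b))) (≡.trans (cong (λ q → ⟨ dual a , vert (B b) ⟩ ℚ.- k a ℚ.* q) (h0 b))
      (solve 2 (λ p k → p :- k :* con 0ℚ := p) refl ⟨ dual a , vert (B b) ⟩ (k a)))
    off′ : ∀ {a b} → a ≢ b → ⟨ dual′ a , vert (B′ b) ⟩ ≡ 0ℚ
    off′ {zero} {zero} a≢b = ⊥-elim (a≢b refl)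
    off′ {zero} {suc b} _ = h0 b
    off′ {suc a} {zero} _ = ≡.trans (⟨corrected⟩ a (vert w)) (≡.trans (s ⟨ dual a , vert w ⟩ (inv ⟨ h , vert w ⟩) ⟨ h , vert w ⟩)
      (≡.trans (cong (λ z → ⟨ dual a , vert w ⟩ ℚ.- ⟨ dual a , vert w ⟩ ℚ.* z) (inv-inverse _ hw≢0))
        (solve 1 (λ p → p :- p :* con 1ℚ := con 0ℚ) refl ⟨ dual a , vert w ⟩)))
      where
      s : ∀ p i q → p ℚ.- p ℚ.* i ℚ.* q ≡ p ℚ.- p ℚ.* (q ℚ.* i)
      s = solve 3 (λ p i q → p :- p :* i :* q := p :- p :* (q :* i)) refl
    off′ {suc a} {suc b} a≢b = ≡.trans (on-old a b) (off (λ eq → a≢b (cong suc eq)))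
    diag′ : ∀ a → ⟨ dual′ a , vert (B′ a) ⟩ ≢ 0ℚ
    diag′ zero = hw≢0
    diag′ (suc a) eq = diag a (≡.trans (≡.sym (on-old a a)) eq)
    span′ : ∀ x → K′ x → ∀ j → x j ≡ ∑q (λ b → (⟨ dual′ b , x ⟩ ℚ.* inv ⟨ dual′ b , vert (B′ b) ⟩) ℚ.* vert (B′ b) j)
    span′ x kx j = ≡.trans (restore x τ w j) (cong (τ ℚ.* vert w j ℚ.+_)
        (≡.trans (span y (reduce x kx) j) (ℚ-Sum.sum-cong-≗ {n} λ b → cong₂ (λ p q → p ℚ.* inv q ℚ.* vert (B b) j) (agree b) (≡.sym (on-old b b)))))
      where
      τ = ⟨ h , x ⟩ ℚ.* inv ⟨ h , vert w ⟩
      y = x ∸[ τ ] w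
      agree : ∀ b → ⟨ dual b , y ⟩ ≡ ⟨ corrected b , x ⟩
      agree b = ≡.trans (⟨⟩-∸ (dual b) x τ w) (≡.trans
        (cong (ℚ._-_ ⟨ dual b , x ⟩) (solve 3 (λ p i q → p :* i :* q := q :* i :* p) refl ⟨ h , x ⟩ (inv ⟨ h , vert w ⟩) ⟨ dual b , vert w ⟩))
        (≡.sym (⟨corrected⟩ b x)))


  vertex-basis : ∀ v → Basis 1 (λ x → ∀ j → x j ≡ vert v j)
  vertex-basis v = record { duals = 𝔇 ; span = λ x → Duals.corner-span 𝔇 0F x }
    where
    𝔇 : Duals 1
    𝔇 = record { B = λ _ → v ; dual = λ _ → chart ; off = λ { {0F} {0F} a≢b → ⊥-elim (a≢b refl) } ; diag = λ _ → >⇒≢0 (chart>0 v) }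

  edge-basis : ∀ e → Basis 2 (λ x → ∃[ k ] (∀ j → x j ≡ vert (end e k) j))
  edge-basis e = record { duals = 𝔇 ; span = λ x (k , eq) → Duals.corner-span 𝔇 k x eq }
    where
    𝔇 : Duals 2
    𝔇 = record
      { B = end e
      -- The functional supporting the other end vanishes there and is positive at end `k`.
      ; dual = λ k → vfun (end e (other k))
      ; off = λ { {0F} {0F} a≢b → ⊥-elim (a≢b refl) ; {1F} {1F} a≢b → ⊥-elim (a≢b refl)
                ; {0F} {1F} _ → vfun-self (end e 1F) ; {1F} {0F} _ → vfun-self (end e 0F) }
      ; diag = λ { 0F → >⇒≢0 (vfun-other (end e 1F) (end e 0F) (end-≢ e))
                 ; 1F → >⇒≢0 (vfun-other (end e 0F) (end e 1F) (λ eq → end-≢ e (≡.sym eq))) } }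

  abstract
    tri-span : ∀ t x → (∀ s → ⟨ fac (tf t s) , x ⟩ ≡ 0ℚ) → ∀ j →
      x j ≡ ∑q (λ l → (⟨ fac (th t l) , x ⟩ ℚ.* inv ⟨ fac (th t l) , vert (tv t l) ⟩) ℚ.* vert (tv t l) j)
    tri-span = t-span

  tri-basis : ∀ t → Basis 3 (λ x → ∀ s → ⟨ fac (tf t s) , x ⟩ ≡ 0ℚ)
  tri-basis t = record
    { duals = record { B = tv t ; dual = fac ∘ th t ; off = th∋ t ; diag = th∌ t }
    ; span = tri-span t }

  facet-basis : ∀ g → Basis 4 (λ x → ⟨ fac g , x ⟩ ≡ 0ℚ)
  facet-basis g = extend (tri-basis t) (tip g) (fac h) (tip∉ g) (tf∋ t (other (side g))) λ x x∈g s →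
      both (side g) s {λ k → ⟨ fac k , x ∸[ ratio x (tip g) h ] tip g ⟩ ≡ 0ℚ}
        (subst (λ k → ⟨ fac k , x ∸[ ratio x (tip g) h ] tip g ⟩ ≡ 0ℚ) (≡.sym (base-tf g)) (≡.trans (∸-on x (ratio x (tip g) h) (tip g) g (tip∈ g)) x∈g))
        (ratio-hit x (tip g) h (tip∉ g))
    where
    t = base g
    h = tf t (other (side g))
    both : ∀ s s′ {P : Φ → Set} → P (tf t s) → P (tf t (other s)) → P (tf t s′)
    both 0F 0F p q = p
    both 0F 1F p q = q
    both 1F 0F p q = q
    both 1F 1F p q = p

  module _ (v₀ : V) where

    whole-basis : Basis 5 (λ _ → 0ℚ ≡ 0ℚ)
    whole-basis = extend (facet-basis (out v₀)) v₀ (fac (out v₀)) (out∌ v₀) on-facet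
      λ x _ → ratio-hit x v₀ (out v₀) (out∌ v₀)
      where
      on-facet : ∀ b → ⟨ fac (out v₀) , vert (Basis.B (facet-basis (out v₀)) b) ⟩ ≡ 0ℚ
      on-facet 0F = tip∈ (out v₀)
      on-facet (suc l) = subst (tv (base (out v₀)) l ∈ᶠ_) (base-tf (out v₀)) (tf∋ (base (out v₀)) (side (out v₀)) l)

-- The faces of the realised polytope

module Faces (C : Cert) (v₀ : Cert.V C) where
  open Cert C
  open Realisation C

  -- A sum of nonnegative functionals vanishes exactly where all of them do, so the facets through
  -- an edge or a triangle add up to a functional that cuts it out.
  equation : Flat → Q⁵
  equation (vertex v) = vfun v
  equation (edge′ e) j = fac (ef e 0F) j ℚ.+ (fac (ef e 1F) j ℚ.+ fac (ef e 2F) j)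
  equation (tri t) j = fac (tf t 0F) j ℚ.+ fac (tf t 1F) j
  equation (facet g) = fac g
  equation whole _ = 0ℚ

  ⟨+⟩ : ∀ f g x → ⟨ (λ j → f j ℚ.+ g j) , x ⟩ ≡ ⟨ f , x ⟩ ℚ.+ ⟨ g , x ⟩
  ⟨+⟩ f g x = ≡.trans (⟨⟩-comm (λ j → f j ℚ.+ g j) x) (≡.trans (⟨⟩-+ x f g) (cong₂ ℚ._+_ (⟨⟩-comm x f) (⟨⟩-comm x g)))

  ⟨0⟩ : ∀ x → ⟨ (λ _ → 0ℚ) , x ⟩ ≡ 0ℚ
  ⟨0⟩ x = ≡.trans (⟨⟩-comm (λ _ → 0ℚ) x) (⟨⟩-zero x)

  ⟨edge⟩ : ∀ e v → ⟨ equation (edge′ e) , vert v ⟩ ≡ ⟨ fac (ef e 0F) , vert v ⟩ ℚ.+ (⟨ fac (ef e 1F) , vert v ⟩ ℚ.+ ⟨ fac (ef e 2F) , vert v ⟩)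
  ⟨edge⟩ e v = ≡.trans (⟨+⟩ (fac (ef e 0F)) (λ j → fac (ef e 1F) j ℚ.+ fac (ef e 2F) j) (vert v)) (cong (⟨ fac (ef e 0F) , vert v ⟩ ℚ.+_) (⟨+⟩ (fac (ef e 1F)) (fac (ef e 2F)) (vert v)))

  ⟨tri⟩ : ∀ t v → ⟨ equation (tri t) , vert v ⟩ ≡ ⟨ fac (tf t 0F) , vert v ⟩ ℚ.+ ⟨ fac (tf t 1F) , vert v ⟩
  ⟨tri⟩ t v = ⟨+⟩ (fac (tf t 0F)) (fac (tf t 1F)) (vert v)

  equation-nonneg : ∀ X → NonnegOn (equation X)
  equation-nonneg (vertex v) u with u VE.≟ v
  ... | yes refl = ℚₚ.≤-reflexive (≡.sym (vfun-self v))
  ... | no u≢v = ℚₚ.<⇒≤ (vfun-other v u u≢v)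
  equation-nonneg (edge′ e) v = subst (0ℚ ℚ.≤_) (≡.sym (⟨edge⟩ e v)) (+-nonneg (fac≥0 _ v) (+-nonneg (fac≥0 _ v) (fac≥0 _ v)))
  equation-nonneg (tri t) v = subst (0ℚ ℚ.≤_) (≡.sym (⟨tri⟩ t v)) (+-nonneg (fac≥0 _ v) (fac≥0 _ v))
  equation-nonneg (facet g) v = fac≥0 g v
  equation-nonneg whole v = ℚₚ.≤-reflexive (≡.sym (⟨0⟩ (vert v)))

  equation-zero : ∀ X v → v ∈ˡ X → ⟨ equation X , vert v ⟩ ≡ 0ℚ
  equation-zero (vertex v) v (in-vertex refl) = vfun-self v
  equation-zero (edge′ e) v (in-edge (k , refl)) = ≡.trans (⟨edge⟩ e v) (cong₂ ℚ._+_ (ef∋ e 0F k) (cong₂ ℚ._+_ (ef∋ e 1F k) (ef∋ e 2F k)))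
  equation-zero (tri t) v (in-tri (l , refl)) = ≡.trans (⟨tri⟩ t v) (cong₂ ℚ._+_ (tf∋ t 0F l) (tf∋ t 1F l))
  equation-zero (facet g) v (in-facet v∈g) = v∈g
  equation-zero whole v in-whole = ⟨0⟩ (vert v)

  equation-zero⁻ : ∀ X v → ⟨ equation X , vert v ⟩ ≡ 0ℚ → v ∈ˡ X
  equation-zero⁻ (vertex u) v eq with v VE.≟ u
  ... | yes refl = in-vertex refl
  ... | no v≢u = ⊥-elim (>⇒≢0 (vfun-other u v v≢u) eq)
  equation-zero⁻ (edge′ e) v eq = in-edge (ef-three e v λ { 0F → p ; 1F → +-zeroˡ (fac≥0 _ v) (fac≥0 _ v) q ; 2F → +-zeroʳ (fac≥0 _ v) (fac≥0 _ v) q })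
    where
    p = +-zeroˡ (fac≥0 (ef e 0F) v) (+-nonneg (fac≥0 (ef e 1F) v) (fac≥0 (ef e 2F) v)) (≡.trans (≡.sym (⟨edge⟩ e v)) eq)
    q = +-zeroʳ (fac≥0 (ef e 0F) v) (+-nonneg (fac≥0 (ef e 1F) v) (fac≥0 (ef e 2F) v)) (≡.trans (≡.sym (⟨edge⟩ e v)) eq)
  equation-zero⁻ (tri t) v eq = in-tri (tf-two t v λ { 0F → +-zeroˡ (fac≥0 _ v) (fac≥0 _ v) eq′ ; 1F → +-zeroʳ (fac≥0 _ v) (fac≥0 _ v) eq′ })
    where
    eq′ = ≡.trans (≡.sym (⟨tri⟩ t v)) eq
  equation-zero⁻ (facet g) v eq = in-facet eq
  equation-zero⁻ whole v eq = in-whole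

  rank : Flat → ℕ
  rank (vertex _) = 0
  rank (edge′ _) = 1
  rank (tri _) = 2
  rank (facet _) = 3
  rank whole = 4

  _∈ˡ?_ : ∀ v X → Dec (v ∈ˡ X)
  v ∈ˡ? X with ⟨ equation X , vert v ⟩ ℚₚ.≟ 0ℚ
  ... | yes eq = yes (equation-zero⁻ X v eq)
  ... | no ≢0 = no (λ v∈X → ≢0 (equation-zero X v v∈X))

  K : Flat → Q⁵ → Set
  K (vertex v) x = ∀ j → x j ≡ vert v j
  K (edge′ e) x = ∃[ k ] (∀ j → x j ≡ vert (end e k) j)
  K (tri t) x = ∀ s → ⟨ fac (tf t s) , x ⟩ ≡ 0ℚ
  K (facet g) x = ⟨ fac g , x ⟩ ≡ 0ℚ
  K whole x = 0ℚ ≡ 0ℚ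

  basis : ∀ X → Basis (suc (rank X)) (K X)
  basis (vertex v) = vertex-basis v
  basis (edge′ e) = edge-basis e
  basis (tri t) = tri-basis t
  basis (facet g) = facet-basis g
  basis whole = whole-basis v₀

  K-vert : ∀ X v → v ∈ˡ X → K X (vert v)
  K-vert (vertex v) v (in-vertex refl) j = refl
  K-vert (edge′ e) v (in-edge (k , refl)) = k , λ j → refl
  K-vert (tri t) v (in-tri (l , refl)) s = tf∋ t s l
  K-vert (facet g) v (in-facet v∈g) = v∈g
  K-vert whole v in-whole = refl

  basis∈ : ∀ X b → Basis.B (basis X) b ∈ˡ X
  basis∈ (vertex v) b = in-vertex refl
  basis∈ (edge′ e) k = in-edge (k , refl)
  basis∈ (tri t) l = in-tri (l , refl)
  basis∈ (facet g) 0F = in-facet (tip∈ g)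
  basis∈ (facet g) (suc l) = in-facet (subst (tv (base g) l ∈ᶠ_) (base-tf g) (tf∋ (base g) (side g) l))
  basis∈ whole b = in-whole

  On : Flat → Pred (Point 5) 0ℓ
  On X y = conv gens y × Lin.fun (rational (equation X)) y ≃ 0ℝ

  -- The vanishing value is a sum of nonnegative terms, so every term vanishes; at a vertex off `X`
  -- the functional is a nonzero rational and can be cancelled.
  supported : ∀ X (μ : Fin nV → ℝ) → (∀ i → Nonneg (μ i)) →
    Lin.fun (rational (equation X)) (combination μ gens) ≃ 0ℝ → ∀ i → ¬ VE.to i ∈ˡ X → μ i ≃ 0ℝ
  supported X μ μ≥0 eq i i∉X = Apart-cancel (rational-apart (equation X) (VE.to i) (λ z → i∉X (equation-zero⁻ X (VE.to i) z)))
      (≃-trans (*-comm (L (gens i)) (μ i)) (Nonneg-∑-zero terms≥0 total i))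
    where
    L = Lin.fun (rational (equation X))
    terms≥0 : ∀ i → Nonneg (μ i * L (gens i))
    terms≥0 i = Nonneg-* (μ≥0 i) (rational-nonneg (equation X) (equation-nonneg X) (VE.to i))
    total : ∑ (λ i → μ i * L (gens i)) ≃ 0ℝ
    total = ≃-trans (≃-sym (Lin.preserves-∑ (rational (equation X)) μ gens)) eq

  module _ (X : Flat) (y : Point 5) (y∈X : On X y) where

    μ-of : Fin nV → ℝ
    μ-of = proj₁ (proj₁ y∈X)

    μ-nonneg : ∀ i → Nonneg (μ-of i)
    μ-nonneg i = ≤⇒Nonneg (proj₁ (proj₂ (proj₁ y∈X)) i)

    ∑μ-of : ∑ μ-of ≃ 1ℝ
    ∑μ-of = wrap (proj₁ (proj₂ (proj₂ (proj₁ y∈X))))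

    μ-combination : y ≅ combination μ-of gens
    μ-combination j = wrap (proj₂ (proj₂ (proj₂ (proj₁ y∈X))) j)

    μ-supported : ∀ i → ¬ VE.to i ∈ˡ X → μ-of i ≃ 0ℝ
    μ-supported = supported X μ-of μ-nonneg (≃-trans (Lin.resp (rational (equation X)) (λ j → ≃-sym (μ-combination j))) (proj₂ y∈X))

    μ-split : ∀ i → μ-of i ≃ 0ℝ ⊎ K X (vert (VE.to i))
    μ-split i with VE.to i ∈ˡ? X
    ... | yes i∈X = inj₂ (K-vert X (VE.to i) i∈X)
    ... | no i∉X = inj₁ (μ-supported i i∉X)

    β-of : Fin (suc (rank X)) → ℝ
    β-of = β (basis X) μ-of ∑μ-of μ-split

    β-expands : y ≋ combination β-of (pt ∘ Basis.B (basis X))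
    β-expands j = unwrap (expanded j)
      where
      expanded : y ≅ combination β-of (pt ∘ Basis.B (basis X))
      expanded j = ≃-trans (μ-combination j) (≃-sym (β-combination (basis X) μ-of ∑μ-of μ-split j))

    ∑β-of : ∑ β-of ≈ 1ℝ
    ∑β-of = unwrap (∑β (basis X) μ-of ∑μ-of μ-split)

  pt∈conv : ∀ v → conv gens (pt v)
  pt∈conv v = subst (λ u → conv gens (pt u)) (VE.to-from v) (vertex∈conv gens (VE.from v))

  pt∈On : ∀ X v → v ∈ˡ X → On X (pt v)
  pt∈On X v v∈X = pt∈conv v , rational-zero (equation X) v (equation-zero X v v∈X)

  pt∈On⁻ : ∀ X v → On X (pt v) → v ∈ˡ X
  pt∈On⁻ X v (_ , eq) = decide (v ∈ˡ? X)
    where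
    decide : Dec (v ∈ˡ X) → v ∈ˡ X
    decide (yes p) = p
    decide (no v∉X) = ⊥-elim (Apart-≉0 (rational-apart (equation X) v (λ z → v∉X (equation-zero⁻ X v z))) eq)

  On-dimension : ∀ X → HasDimension (On X) (rank X)
  On-dimension X = pt ∘ Basis.B (basis X) , (λ b → pt∈On X _ (basis∈ X b)) , basis-independent (basis X)
    , λ y y∈X → β-of X y y∈X , ∑β-of X y y∈X , β-expands X y y∈X

  P : Polytope 4
  P = record
    { ambient = 5 ; size = nV ; generators = gens
    ; dimension = dimension-resp ((λ y → proj₁) , λ y y∈ → y∈ , on-whole y) (On-dimension whole) }
    where
    on-whole : ∀ y → Lin.fun (rational (equation whole)) y ≃ 0ℝ
    on-whole y = ∑-zero (λ j → zeroˡ (y j))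

  face : Flat → Face P
  face X = record
    -- The sign is reversed because `equation X` is bounded below by 0, whereas a face is defined by
    -- an upper bound.
    { normal = λ j → fromℚ (ℚ.- equation X j)
    ; offset = 0ℝ
    ; valid = λ x (μ , μ≥0 , _ , x≋) → ≤-resp {y = Lin.fun L x} (negated-dot (equation X) x)
        (neg-≤0 (Nonneg-resp (≃-sym (expand x μ x≋)) (Nonneg-∑ (λ i → Nonneg-* (≤⇒Nonneg {μ i} (μ≥0 i)) (rational-nonneg (equation X) (equation-nonneg X) (VE.to i)))))) }
    where
    L = rational (equation X)
    expand : ∀ x (μ : Fin nV → ℝ) → x ≋ combination μ gens → Lin.fun L x ≃ ∑ (λ i → μ i * Lin.fun L (gens i))
    expand x μ x≋ = ≃-trans (Lin.resp L (wrapped {x = x} {combination μ gens} x≋)) (Lin.preserves-∑ L μ gens)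
    ≤-resp : ∀ {x y} → x ≃ ⁻ y → ⁻ y ≤ 0ℝ → x ≤ 0ℝ
    ≤-resp {x} {y} eq le = flip (Nonneg-resp (*-cong ≃-refl (≃-sym eq)) (flip⁻ le))
      where
      s₁ : ∀ a e → a ℚ.+ (ℚ.- 1ℚ ℚ.* a ℚ.+ e) ≡ 0ℚ ℚ.+ e
      s₁ = solve 2 (λ a e → a :+ (con (ℚ.- 1ℚ) :* a :+ e) := con 0ℚ :+ e) refl
      s₂ : ∀ a e → 0ℚ ℚ.+ e ℚ.+ ℚ.- 1ℚ ℚ.* a ≡ ℚ.- 1ℚ ℚ.* a ℚ.+ e
      s₂ = solve 2 (λ a e → con 0ℚ :+ e :+ con (ℚ.- 1ℚ) :* a := con (ℚ.- 1ℚ) :* a :+ e) refl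
      s₃ : ∀ a → a ℚ.+ ℚ.- 1ℚ ℚ.* a ≡ 0ℚ
      s₃ = solve 1 (λ a → a :+ con (ℚ.- 1ℚ) :* a := con 0ℚ) refl
      flip : ∀ {x} → Nonneg (⁻ x) → x ≤ 0ℝ
      flip {x} (nonneg p) ε ε>0 = Ev-map (λ n le → subst (seq x n ℚ.≤_) (s₁ (seq x n) ε)
        (subst (ℚ._≤ seq x n ℚ.+ (ℚ.- 1ℚ ℚ.* seq x n ℚ.+ ε)) (ℚₚ.+-identityʳ (seq x n)) (ℚₚ.+-monoʳ-≤ (seq x n) le))) (p ε ε>0)
      flip⁻ : ∀ {x} → x ≤ 0ℝ → Nonneg (⁻ x)
      flip⁻ {x} p = nonneg λ ε ε>0 → Ev-map (λ n le → subst (0ℚ ℚ.≤_) (s₂ (seq x n) ε)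
        (subst (ℚ._≤ 0ℚ ℚ.+ ε ℚ.+ ℚ.- 1ℚ ℚ.* seq x n) (s₃ (seq x n)) (ℚₚ.+-monoˡ-≤ (ℚ.- 1ℚ ℚ.* seq x n) le))) (p ε ε>0)

  face≐On : ∀ X → facePoints (face X) ≐′ On X
  face≐On X = (λ y (y∈ , eq) → y∈ , to′ y (wrap eq)) , λ y (y∈ , eq) → y∈ , unwrap (from′ y eq)
    where
    L = Lin.fun (rational (equation X))
    to′ : ∀ y → (λ j → fromℚ (ℚ.- equation X j)) · y ≃ 0ℝ → L y ≃ 0ℝ
    to′ y eq = ≃-trans (≃-sym (neg-neg (L y))) (≃-trans (*-cong ≃-refl (≃-sym (negated-dot (equation X) y))) (*-zero eq))
    from′ : ∀ y → L y ≃ 0ℝ → (λ j → fromℚ (ℚ.- equation X j)) · y ≃ 0ℝ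
    from′ y eq = ≃-trans (negated-dot (equation X) y) (*-zero eq)

  ≐-sym : ∀ {S S′ : Pred (Point 5) 0ℓ} → S ≐′ S′ → S′ ≐′ S
  ≐-sym (a , b) = b , a

  ≐-trans : ∀ {S S′ S″ : Pred (Point 5) 0ℓ} → S ≐′ S′ → S′ ≐′ S″ → S ≐′ S″
  ≐-trans (a , b) (c , d) = (λ y y∈ → c y (a y y∈)) , λ y y∈ → b y (d y y∈)

  face-dimension : ∀ X → HasDimension (facePoints (face X)) (rank X)
  face-dimension X = dimension-resp (≐-sym (face≐On X)) (On-dimension X)

  -- Every face of the real polytope is one of the listed flats

  module Classify (F : Face P) where
    open Face F hiding (facePoints)

    -- The slack of the inequality that defines `F`.
    h : Aff 5
    h = cross 1ℝ (constant offset) 1ℝ (lin⇒aff (dot normal))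

    h-nonneg : ∀ x → conv gens x → Nonneg (h ⟪ x ⟫)
    h-nonneg x x∈ = nonneg λ ε ε>0 → Ev-map (λ n le → convert (seq (normal · x) n) (seq offset n) ε le) (valid x x∈ ε ε>0)
      where
      convert : ∀ a o ε → a ℚ.≤ o ℚ.+ ε → 0ℚ ℚ.≤ 1ℚ ℚ.* o ℚ.+ ℚ.- 1ℚ ℚ.* (1ℚ ℚ.* a) ℚ.+ ε
      convert a o ε le = subst (0ℚ ℚ.≤_) (s a o ε) (≤⇒0≤- le)
        where
        s : ∀ a o e → o ℚ.+ e ℚ.- a ≡ 1ℚ ℚ.* o ℚ.+ ℚ.- 1ℚ ℚ.* (1ℚ ℚ.* a) ℚ.+ e
        s = solve 3 (λ a o e → o :+ e :- a := con 1ℚ :* o :+ con (ℚ.- 1ℚ) :* (con 1ℚ :* a) :+ e) refl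

    h-zero : ∀ x → normal · x ≃ offset → h ⟪ x ⟫ ≃ 0ℝ
    h-zero x eq = ≃-trans (+-cong (*-identityˡ offset) (*-cong ≃-refl (≃-trans (*-identityˡ (normal · x)) eq)))
      (≃-pointwise λ n → s (seq offset n))
      where
      s : ∀ a → a ℚ.+ ℚ.- 1ℚ ℚ.* a ≡ 0ℚ
      s = solve 1 (λ a → a :+ con (ℚ.- 1ℚ) :* a := con 0ℚ) refl

    h-zero⁻ : ∀ x → h ⟪ x ⟫ ≃ 0ℝ → normal · x ≃ offset
    h-zero⁻ x eq = ≃-trans (≃-pointwise λ n → s (seq (normal · x) n) (seq offset n))
      (≃-trans (+-cong {offset} ≃-refl (*-zero {fromℚ (ℚ.- 1ℚ)} eq)) (+-identityʳ offset))
      where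
      s : ∀ a o → a ≡ o ℚ.+ ℚ.- 1ℚ ℚ.* (1ℚ ℚ.* o ℚ.+ ℚ.- 1ℚ ℚ.* (1ℚ ℚ.* a))
      s = solve 2 (λ a o → a := o :+ con (ℚ.- 1ℚ) :* (con 1ℚ :* o :+ con (ℚ.- 1ℚ) :* (con 1ℚ :* a))) refl

    -- The slack vanishes at `x`, so each of its nonnegative weighted terms vanishes, and a weight
    -- apart from 0 can be cancelled.
    heavy∈F : ∀ x (μ : Fin nV → ℝ) → (∀ i → Nonneg (μ i)) → ∑ μ ≃ 1ℝ → x ≅ combination μ gens → normal · x ≃ offset →
              ∀ i → Apart (μ i) → gens i ∈ᵖ facePoints F
    heavy∈F x μ μ≥0 ∑μ x≅ eq i Aμ = vertex∈conv gens i , unwrap (h-zero⁻ (gens i) (Apart-cancel Aμ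
        (Nonneg-∑-zero (λ i → Nonneg-* (μ≥0 i) (h-nonneg (gens i) (vertex∈conv gens i))) total i)))
      where
      total : ∑ (λ i → μ i * h ⟪ gens i ⟫) ≃ 0ℝ
      total = ≃-trans (≃-sym (≃-trans (Aff.resp h x≅) (Aff.affine h μ gens ∑μ))) (h-zero x eq)

    IsVertex : Point 5 → Set
    IsVertex u = ∃[ v ] u ≡ pt v

    -- The functional `φ a` is apart from 0 at a convex combination of vertices, hence some term is
    -- apart from 0: the vertex of that term has weight apart from 0, so it lies on `F`, and `φ a`
    -- is apart from 0 at it.
    replacement : ∀ {n} (X : Frame (facePoints F) n) a →
      Σ[ u ∈ Point 5 ] IsVertex u × u ∈ᵖ facePoints F × Apart (Frame.φ X a ⟪ u ⟫)
    replacement X a = locate (Frame.mem X a)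
      where
      x = Frame.pts X a
      f = Frame.φ X a
      locate : x ∈ᵖ facePoints F → Σ[ u ∈ Point 5 ] IsVertex u × u ∈ᵖ facePoints F × Apart (f ⟪ u ⟫)
      locate ((μ , μ≥0 , ∑μ , x≋) , eq) =
        let i , q = Apart-∑ (λ i → μ i * f ⟪ gens i ⟫) (Apart-resp expand (Frame.diag X a))
        in gens i , (VE.to i , refl) , heavy∈F x μ (λ i → ≤⇒Nonneg (μ≥0 i)) (wrap ∑μ) (wrapped x≋) (wrap eq) i (Apart-*ˡ {μ i} {f ⟪ gens i ⟫} q)
           , Apart-*ʳ {μ i} {f ⟪ gens i ⟫} q
        where
        expand : f ⟪ x ⟫ ≃ ∑ (λ i → μ i * f ⟪ gens i ⟫)
        expand = ≃-trans (Aff.resp f (wrapped x≋)) (Aff.affine f μ gens (wrap ∑μ))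

    -- The homogenisation of h; it agrees with h on the section chart = 1.
    ĥ : Q⁵ → ℝ
    ĥ x = offset * Lin.fun (rational chart) (embed x) + ⁻ (normal · embed x)

    ĥ-lin : ∀ τ x y z → (∀ j → z j ≡ τ ℚ.* x j ℚ.+ y j) → ĥ z ≃ fromℚ τ * ĥ x + ĥ y
    ĥ-lin τ x y z eq = ≃-trans (+-cong (*-cong ≃-refl (through (rational chart))) (*-cong ≃-refl (through (dot normal))))
      (≃-pointwise λ n → s (seq offset n) τ (seq (Lin.fun (rational chart) (embed x)) n) (seq (Lin.fun (rational chart) (embed y)) n)
         (seq (normal · embed x) n) (seq (normal · embed y) n))
      where
      through : ∀ (L : Lin 5) → Lin.fun L (embed z) ≃ fromℚ τ * Lin.fun L (embed x) + 1ℝ * Lin.fun L (embed y)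
      through L = ≃-trans (Lin.resp L (λ j → ≃-trans (fromℚ-cong (eq j)) (≃-pointwise λ _ → cong (τ ℚ.* x j ℚ.+_) (≡.sym (ℚₚ.*-identityˡ (y j))))))
        (Lin.linear L (fromℚ τ) 1ℝ (embed x) (embed y))
      s : ∀ o τ a b c d → o ℚ.* (τ ℚ.* a ℚ.+ 1ℚ ℚ.* b) ℚ.+ ℚ.- 1ℚ ℚ.* (τ ℚ.* c ℚ.+ 1ℚ ℚ.* d)
        ≡ τ ℚ.* (o ℚ.* a ℚ.+ ℚ.- 1ℚ ℚ.* c) ℚ.+ (o ℚ.* b ℚ.+ ℚ.- 1ℚ ℚ.* d)
      s = solve 6 (λ o τ a b c d → o :* (τ :* a :+ con 1ℚ :* b) :+ con (ℚ.- 1ℚ) :* (τ :* c :+ con 1ℚ :* d)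
        := τ :* (o :* a :+ con (ℚ.- 1ℚ) :* c) :+ (o :* b :+ con (ℚ.- 1ℚ) :* d)) refl

    ĥ-0 : ∀ z → (∀ j → z j ≡ 0ℚ) → ĥ z ≃ 0ℝ
    ĥ-0 z eq = ≃-trans (+-cong (*-zero (Lin.preserves-0 (rational chart) (λ j → fromℚ-cong (eq j)))) (*-zero (Lin.preserves-0 (dot normal) (λ j → fromℚ-cong (eq j)))))
      (+-identityʳ 0ℝ)

    ĥ-vert : ∀ v → ĥ (vert v) ≃ fromℚ (scale v) * h ⟪ pt v ⟫
    ĥ-vert v = ≃-trans (ĥ-lin (scale v) (gv v) (λ _ → 0ℚ) (vert v) (λ j → ≡.trans (vert-gv v j) (≡.sym (ℚₚ.+-identityʳ (scale v ℚ.* gv v j)))))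
      (≃-trans (+-cong (*-cong ≃-refl agree) (ĥ-0 (λ _ → 0ℚ) (λ _ → refl))) (+-identityʳ (fromℚ (scale v) * h ⟪ pt v ⟫)))
      where
      agree : ĥ (gv v) ≃ h ⟪ pt v ⟫
      agree = +-cong (≃-trans (*-cong ≃-refl (chart-pt v)) (*-comm offset 1ℝ)) (*-cong ≃-refl (≃-sym (*-identityˡ (normal · pt v))))

    ĥ-vert-nonneg : ∀ v → Nonneg (ĥ (vert v))
    ĥ-vert-nonneg v = Nonneg-resp (≃-sym (ĥ-vert v)) (Nonneg-* (Nonneg-fromℚ (ℚₚ.<⇒≤ (chart>0 v))) (h-nonneg (pt v) (pt∈conv v)))

    ĥ-cone : ∀ {x} → Cone x → Nonneg (ĥ x)
    ĥ-cone {x} (nil eq) = Nonneg-resp (≃-sym (ĥ-0 x eq)) (Nonneg-fromℚ ℚₚ.≤-refl)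
    ĥ-cone {x} (add {y = y} t v t≥0 y∈ eq) = Nonneg-resp (≃-sym (ĥ-lin t (vert v) y x eq))
      (Nonneg-+ (Nonneg-* (Nonneg-fromℚ t≥0) (ĥ-vert-nonneg v)) (ĥ-cone y∈))

    ĥ-∑ : ∀ {n} (J : Fin n → V) → (∀ a → h ⟪ pt (J a) ⟫ ≃ 0ℝ) → ĥ (λ j → ∑q (λ a → vert (J a) j)) ≃ 0ℝ
    ĥ-∑ {zero} J J0 = ĥ-0 (λ j → 0ℚ) (λ _ → refl)
    ĥ-∑ {suc n} J J0 = ≃-trans
      (ĥ-lin 1ℚ (vert (J zero)) (λ j → ∑q (λ a → vert (J (suc a)) j)) (λ j → ∑q (λ a → vert (J a) j))
        (λ j → cong (ℚ._+ ∑q (λ a → vert (J (suc a)) j)) (≡.sym (ℚₚ.*-identityˡ (vert (J zero) j)))))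
      (≃-trans (+-cong (*-zero (≃-trans (ĥ-vert (J zero)) (*-zero (J0 zero)))) (ĥ-∑ (J ∘ suc) (J0 ∘ suc))) (+-identityʳ 0ℝ))

    -- In the relation of `closure-combination`, `ĥ` vanishes on the left and is nonnegative on both
    -- summands of the right, so it vanishes on the multiple of `w`.
    closed : ∀ {n} (J : Fin n → V) → (∀ a → h ⟪ pt (J a) ⟫ ≃ 0ℝ) → ∀ w → (∀ g → (∀ a → J a ∈ᶠ g) → w ∈ᶠ g) → h ⟪ pt w ⟫ ≃ 0ℝ
    closed J J0 w cl = finish (closure-combination J w cl)
      where
      finish : ∃[ τ ] ∃[ y ] (0ℚ ℚ.< τ × Cone y × (∀ j → ∑q (λ a → vert (J a) j) ≡ τ ℚ.* vert w j ℚ.+ y j)) → h ⟪ pt w ⟫ ≃ 0ℝ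
      finish (τ , y , τ>0 , y∈ , eq) = Apart-cancel (Apart-fromℚ (>⇒≢0 (chart>0 w))) (≃-trans (≃-sym (ĥ-vert w))
        (Apart-cancel (Apart-fromℚ (>⇒≢0 τ>0)) (Nonneg-+-zeroˡ (Nonneg-* (Nonneg-fromℚ (ℚₚ.<⇒≤ τ>0)) (ĥ-vert-nonneg w)) (ĥ-cone y∈)
          (≃-trans (≃-sym (ĥ-lin τ (vert w) y (λ j → ∑q (λ a → vert (J a) j)) eq)) (ĥ-∑ J J0)))))

    -- The equation of `X` vanishes on the exchanged basis, hence on all of `F` by `span`.
    -- Conversely, each vertex of `X` is in the closure of that basis, where the slack vanishes by
    -- `closed`. The rank is then forced by uniqueness of dimension.
    classify : ∀ {i} → HasDimension (facePoints F) i → Σ[ X ∈ Flat ] rank X ≡ i × facePoints F ≐′ On X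
    classify {i} dim = X , dimension-unique (dimension-resp (≐-sym F≐X) (On-dimension X)) dim , F≐X
      where
      Z = replace-all IsVertex replacement (frame dim)
      open Frame (proj₁ Z)
      J : Fin (suc i) → V
      J a = proj₁ (proj₂ Z a)
      pts≡ : ∀ a → pts a ≡ pt (J a)
      pts≡ a = proj₂ (proj₂ Z a)
      J0 : ∀ a → h ⟪ pt (J a) ⟫ ≃ 0ℝ
      J0 a = subst (λ p → h ⟪ p ⟫ ≃ 0ℝ) (pts≡ a) (h-zero (pts a) (wrap (proj₂ (mem a))))
      H = hull J
      X = proj₁ H
      F⊆X : facePoints F ⊆′ On X
      F⊆X y y∈F = proj₁ y∈F , span (lin⇒aff (rational (equation X)))
        (λ a → subst (λ p → Lin.fun (rational (equation X)) p ≃ 0ℝ) (≡.sym (pts≡ a))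
          (rational-zero (equation X) (J a) (equation-zero X (J a) (proj₁ (proj₂ H) a)))) y y∈F
      X⊆F : On X ⊆′ facePoints F
      X⊆F y y∈X = proj₁ y∈X , unwrap (h-zero⁻ y (≃-trans (Aff.resp h (μ-combination X y y∈X))
          (≃-trans (Aff.affine h μ gens (∑μ-of X y y∈X)) (∑-zero term))))
        where
        μ = μ-of X y y∈X
        term : ∀ i → μ i * h ⟪ gens i ⟫ ≃ 0ℝ
        term i = decide (VE.to i ∈ˡ? X)
          where
          decide : Dec (VE.to i ∈ˡ X) → μ i * h ⟪ gens i ⟫ ≃ 0ℝ
          decide (yes i∈X) = *-zero (closed J J0 (VE.to i) (proj₂ (proj₂ H) (VE.to i) i∈X))
          decide (no i∉X) = ≃-trans (*-cong (μ-supported X y y∈X i i∉X) ≃-refl) (zeroˡ (h ⟪ gens i ⟫))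
      F≐X : facePoints F ≐′ On X
      F≐X = F⊆X , X⊆F

  listed : ∀ X → FaceOfDim P (rank X)
  listed X = face X , face-dimension X

  ⊆⇒∈ : ∀ X Y → On X ⊆′ On Y → ∀ v → v ∈ˡ X → v ∈ˡ Y
  ⊆⇒∈ X Y sub v v∈X = pt∈On⁻ Y v (sub (pt v) (pt∈On X v v∈X))

  face-⊆⇒∈ : ∀ X Y → facePoints (face X) ⊆′ facePoints (face Y) → ∀ v → v ∈ˡ X → v ∈ˡ Y
  face-⊆⇒∈ X Y sub = ⊆⇒∈ X Y (λ y y∈ → proj₁ (face≐On Y) y (sub y (proj₂ (face≐On X) y y∈)))

  ∈⇒⊆ : ∀ X Y → (∀ v → v ∈ˡ X → v ∈ˡ Y) → On X ⊆′ On Y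
  ∈⇒⊆ X Y sub y y∈X = proj₁ y∈X , ≃-trans (Lin.resp L (μ-combination X y y∈X)) (≃-trans (Lin.preserves-∑ L μ gens) (∑-zero term))
    where
    L = rational (equation Y)
    μ = μ-of X y y∈X
    term : ∀ i → μ i * Lin.fun L (gens i) ≃ 0ℝ
    term i = decide (VE.to i ∈ˡ? X)
      where
      decide : Dec (VE.to i ∈ˡ X) → μ i * Lin.fun L (gens i) ≃ 0ℝ
      decide (yes i∈X) = *-zero (rational-zero (equation Y) (VE.to i) (equation-zero Y (VE.to i) (sub _ i∈X)))
      decide (no i∉X) = ≃-trans (*-cong (μ-supported X y y∈X i i∉X) ≃-refl) (zeroˡ (Lin.fun L (gens i)))

  classified : ∀ {i} (F : FaceOfDim P i) → Σ[ X ∈ Flat ] rank X ≡ i × facePoints (proj₁ F) ≐′ facePoints (face X)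
  classified (F , dim) = let X , r , eq = Classify.classify F dim in X , r , ≐-trans eq (≐-sym (face≐On X))

  Listed : ℕ → Pred (Point 5) 0ℓ → Set
  Listed r S = Σ[ X ∈ Flat ] rank X ≡ r × S ≐′ facePoints (face X)

  only-vertex : ∀ {S} → Listed 0 S → ∃[ v ] S ≐′ facePoints (face (vertex v))
  only-vertex (vertex v , _ , eq) = v , eq
  only-vertex (edge′ _ , () , _)
  only-vertex (tri _ , () , _)
  only-vertex (facet _ , () , _)
  only-vertex (whole , () , _)

  only-edge : ∀ {S} → Listed 1 S → ∃[ e ] S ≐′ facePoints (face (edge′ e))
  only-edge (edge′ e , _ , eq) = e , eq
  only-edge (vertex _ , () , _)
  only-edge (tri _ , () , _)
  only-edge (facet _ , () , _)
  only-edge (whole , () , _)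

  only-tri : ∀ {S} → Listed 2 S → ∃[ t ] S ≐′ facePoints (face (tri t))
  only-tri (tri t , _ , eq) = t , eq
  only-tri (vertex _ , () , _)
  only-tri (edge′ _ , () , _)
  only-tri (facet _ , () , _)
  only-tri (whole , () , _)

  only-facet : ∀ {S} → Listed 3 S → ∃[ g ] S ≐′ facePoints (face (facet g))
  only-facet (facet g , _ , eq) = g , eq
  only-facet (vertex _ , () , _)
  only-facet (edge′ _ , () , _)
  only-facet (tri _ , () , _)
  only-facet (whole , () , _)

  strip-vertex : ∀ {v u} → v ∈ˡ vertex u → v ≡ u
  strip-vertex (in-vertex p) = p

  strip-edge : ∀ {v e} → v ∈ˡ edge′ e → ∃[ l ] v ≡ end e l
  strip-edge (in-edge p) = p

  strip-tri : ∀ {v t} → v ∈ˡ tri t → ∃[ l ] v ≡ tv t l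
  strip-tri (in-tri p) = p

  strip-facet : ∀ {v g} → v ∈ˡ facet g → v ∈ᶠ g
  strip-facet (in-facet p) = p

  enumerated : ∀ {A : Set} {n r} (enum : Fin n ↔ A) (flat : A → Flat) (rank≡ : ∀ a → rank (flat a) ≡ r) →
    (∀ a b → facePoints (face (flat a)) ≐′ facePoints (face (flat b)) → a ≡ b) →
    (∀ (F : FaceOfDim P r) → ∃[ a ] facePoints (proj₁ F) ≐′ facePoints (face (flat a))) →
    HasCardinality (faces P r) n
  enumerated {A} {n} {r} enum flat rank≡ distinct exhaust = record
    { to = λ i → face (flat (to i)) , subst (HasDimension (facePoints (face (flat (to i))))) (rank≡ (to i)) (face-dimension (flat (to i)))
    ; cong = λ { refl → (λ y p → p) , λ y p → p }
    ; bijective = (λ {i} {j} eq → to-injective (distinct (to i) (to j) eq)) , surjective }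
    where
    open Enumerated enum
    surjective : ∀ (F : FaceOfDim P r) → ∃[ i ] (∀ {z} → z ≡ i → facePoints (face (flat (to z))) ≐′ facePoints (proj₁ F))
    surjective F = from a , λ { refl → subst (λ a → facePoints (face (flat a)) ≐′ facePoints (proj₁ F)) (≡.sym (to-from a)) (≐-sym eq) }
      where
      a = proj₁ (exhaust F)
      eq = proj₂ (exhaust F)

  vertices : HasCardinality (faces P 0) nV
  vertices = enumerated enumV vertex (λ _ → refl)
    (λ u v eq → strip-vertex (face-⊆⇒∈ (vertex u) (vertex v) (proj₁ eq) u (in-vertex refl)))
    (λ F → only-vertex (classified F))

  edges : HasCardinality (faces P 1) nE
  edges = enumerated enumE edge′ (λ _ → refl)
    (λ e e′ eq → end-set e e′ (λ k → strip-edge (face-⊆⇒∈ (edge′ e) (edge′ e′) (proj₁ eq) (end e k) (in-edge (k , refl))))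
      (λ k → strip-edge (face-⊆⇒∈ (edge′ e′) (edge′ e) (proj₂ eq) (end e′ k) (in-edge (k , refl)))))
    (λ F → only-edge (classified F))

  tri-injective : ∀ t t′ → facePoints (face (tri t)) ≐′ facePoints (face (tri t′)) → t ≡ t′
  tri-injective t t′ eq = tv-set t t′ (λ l → strip-tri (face-⊆⇒∈ (tri t) (tri t′) (proj₁ eq) (tv t l) (in-tri (l , refl))))
    (λ l → strip-tri (face-⊆⇒∈ (tri t′) (tri t) (proj₂ eq) (tv t′ l) (in-tri (l , refl))))

  triangles : HasCardinality (faces P 2) nT
  triangles = enumerated enumT tri (λ _ → refl) tri-injective (λ F → only-tri (classified F))

  corner⊑ : ∀ t l → face (vertex (tv t l)) ⊑ face (tri t)
  corner⊑ t l y y∈ = proj₂ (face≐On (tri t)) y (∈⇒⊆ (vertex (tv t l)) (tri t) (λ { v (in-vertex eq) → in-tri (l , eq) }) y (proj₁ (face≐On (vertex (tv t l))) y y∈))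

  Flag : Set
  Flag = Σ[ (A , B) ∈ FaceOfDim P 0 × FaceOfDim P 2 ] proj₁ A ⊑ proj₁ B

  vertex-triangle-flags : HasCardinality (flags P 0 2) (nT ℕ.* 3)
  vertex-triangle-flags = record
    { to = flag ∘ TL.to
    ; cong = λ { refl → ((λ y p → p) , λ y p → p) , ((λ y p → p) , λ y p → p) }
    ; bijective = (λ {i} {j} eq → TL.to-injective (injective (TL.to i) (TL.to j) (proj₁ eq) (proj₂ eq))) , surjective }
    where
    module TL = Enumerated (enumT ×-enum ↔-id (Fin 3))
    cornerFace : T × Fin 3 → Face P
    cornerFace (t , l) = face (vertex (tv t l))
    triFace : T × Fin 3 → Face P
    triFace (t , _) = face (tri t)
    flag : T × Fin 3 → Flag
    flag (t , l) = (listed (vertex (tv t l)) , listed (tri t)) , corner⊑ t l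
    same-corner : ∀ t l l′ → tv t l ≡ tv t l′ → l ≡ l′
    same-corner t l l′ same with l Finₚ.≟ l′
    ... | yes l≡l′ = l≡l′
    ... | no l≢l′ = ⊥-elim (tv-≢ t l≢l′ same)
    same-flag : ∀ t l t′ l′ → t ≡ t′ → tv t l ≡ tv t′ l′ → (t , l) ≡ (t′ , l′)
    same-flag t l t l′ refl same = cong (t ,_) (same-corner t l l′ same)
    injective : ∀ (p q : T × Fin 3) → facePoints (cornerFace p) ≐′ facePoints (cornerFace q) →
                facePoints (triFace p) ≐′ facePoints (triFace q) → p ≡ q
    injective (t , l) (t′ , l′) eqV eqT = same-flag t l t′ l′ (tri-injective t t′ eqT)
      (strip-vertex (face-⊆⇒∈ (vertex (tv t l)) (vertex (tv t′ l′)) (proj₁ eqV) (tv t l) (in-vertex refl)))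
    Matches : T × Fin 3 → Flag → Set
    Matches p ((A , B) , _) = facePoints (cornerFace p) ≐′ facePoints (proj₁ A) × facePoints (triFace p) ≐′ facePoints (proj₁ B)
    find : ∀ F → ∃[ p ] Matches p F
    find ((A , B) , A⊑B) = (t , proj₁ l) , subst (λ u → facePoints (face (vertex u)) ≐′ facePoints (proj₁ A)) (proj₂ l) (≐-sym (proj₂ Av)) , ≐-sym (proj₂ Bt)
      where
      Av = only-vertex (classified A)
      Bt = only-tri (classified B)
      v = proj₁ Av
      t = proj₁ Bt
      l = strip-tri (face-⊆⇒∈ (vertex v) (tri t) (λ y y∈ → proj₁ (proj₂ Bt) y (A⊑B y (proj₂ (proj₂ Av) y y∈))) v (in-vertex refl))
    surjective : ∀ F → ∃[ i ] (∀ {z} → z ≡ i → Matches (TL.to z) F)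
    surjective F = TL.from (proj₁ (find F)) , λ { refl → subst (λ p → Matches p F) (≡.sym (TL.to-from (proj₁ (find F)))) (proj₂ (find F)) }

  module _ (t : T) where

    private
      ⊆conv : On (tri t) ⊆′ conv (pt ∘ tv t)
      ⊆conv y y∈ = β-of (tri t) y y∈
        , (λ b → Nonneg⇒≤ (β-nonneg (tri-basis t) (μ-of (tri t) y y∈) (∑μ-of (tri t) y y∈) (μ-split (tri t) y y∈) (μ-nonneg (tri t) y y∈) coef≥0 b))
        , ∑β-of (tri t) y y∈ , β-expands (tri t) y y∈
        where
        -- The coordinates with respect to the corners are quotients of facet values, so the
        -- expansion is convex and not merely affine.
        coef≥0 : ∀ v l → 0ℚ ℚ.≤ ⟨ fac (th t l) , vert v ⟩ ℚ.* inv ⟨ fac (th t l) , vert (tv t l) ⟩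
        coef≥0 v l = *-nonneg (fac≥0 (th t l) v) (ℚₚ.<⇒≤ (inv-pos (∉⇒> {tv t l} {th t l} (th∌ t l))))
      conv⊆ : conv (pt ∘ tv t) ⊆′ On (tri t)
      conv⊆ y (μ , μ≥0 , ∑μ , y≋) = conv-in-conv , ≃-trans (Lin.resp L (wrapped {x = y} {combination μ (pt ∘ tv t)} y≋)) (≃-trans (Lin.preserves-∑ L μ (pt ∘ tv t))
          (∑-zero {f = λ l → μ l * Lin.fun L (pt (tv t l))} λ l → *-zero {μ l} (rational-zero (equation (tri t)) (tv t l) (equation-zero (tri t) (tv t l) (in-tri (l , refl))))))
        where
        L = rational (equation (tri t))
        κ : Fin 3 → Fin nV → ℝ
        κ l = proj₁ (pt∈conv (tv t l))
        ν : Fin nV → ℝ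
        ν i = ∑ (λ l → μ l * κ l i)
        total : ∑ ν ≃ 1ℝ
        total = begin
          ∑ (λ i → ∑ (λ l → μ l * κ l i))     ≈⟨ ∑-comm (λ i l → μ l * κ l i) ⟩
          ∑ (λ l → ∑ (λ i → μ l * κ l i))     ≈⟨ ∑-cong (λ l → ≃-sym (*-distribˡ-sum (μ l) (κ l))) ⟩
          ∑ (λ l → μ l * ∑ (κ l))             ≈⟨ ∑-cong (λ l → ≃-trans (*-cong ≃-refl (wrap {∑ (κ l)} {1ℝ} (proj₁ (proj₂ (proj₂ (pt∈conv (tv t l))))))) (*-identityʳ (μ l))) ⟩
          ∑ μ                                 ≈⟨ wrap ∑μ ⟩
          1ℝ                                  ∎
          where open ≃-Reasoning
        value : ∀ j → combination μ (pt ∘ tv t) j ≃ combination ν gens j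
        value j = begin
          ∑ (λ l → μ l * pt (tv t l) j)                          ≈⟨ ∑-cong (λ l → *-cong {μ l} {μ l} ≃-refl (wrap {pt (tv t l) j} {∑ (λ i → κ l i * gens i j)} (proj₂ (proj₂ (proj₂ (pt∈conv (tv t l)))) j))) ⟩
          ∑ (λ l → μ l * ∑ (λ i → κ l i * gens i j))             ≈⟨ ∑-cong (λ l → *-distribˡ-sum (μ l) (λ i → κ l i * gens i j)) ⟩
          ∑ (λ l → ∑ (λ i → μ l * (κ l i * gens i j)))           ≈⟨ ∑-comm (λ l i → μ l * (κ l i * gens i j)) ⟩
          ∑ (λ i → ∑ (λ l → μ l * (κ l i * gens i j)))           ≈⟨ ∑-cong (λ i → ∑-cong (λ l → ≃-sym (*-assoc (μ l) (κ l i) (gens i j)))) ⟩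
          ∑ (λ i → ∑ (λ l → μ l * κ l i * gens i j))             ≈⟨ ∑-cong (λ i → ≃-sym (*-distribʳ-sum (gens i j) (λ l → μ l * κ l i))) ⟩
          ∑ (λ i → ν i * gens i j)                               ∎
          where open ≃-Reasoning
        conv-in-conv : conv gens y
        conv-in-conv = ν , (λ i → Nonneg⇒≤ (Nonneg-∑ {f = λ l → μ l * κ l i} (λ l → Nonneg-* (≤⇒Nonneg {μ l} (μ≥0 l)) (≤⇒Nonneg {κ l i} (proj₁ (proj₂ (pt∈conv (tv t l))) i)))))
          , unwrap total , λ j → unwrap (combined j)
          where
          combined : y ≅ combination ν gens
          combined j = ≃-trans (wrap (y≋ j)) (value j)

    On-tri≐conv : On (tri t) ≐′ conv (pt ∘ tv t)
    On-tri≐conv = ⊆conv , conv⊆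

  two-simplicial : TwoSimplicial P
  two-simplicial F = pt ∘ tv t , basis-independent (tri-basis t) , ≐-trans (proj₂ Ft) (≐-trans (face≐On (tri t)) (On-tri≐conv t))
    where
    Ft = only-tri (classified F)
    t = proj₁ Ft

  two-simple : TwoSimple P
  two-simple F = record
    { to = λ i → listed (facet (ef e i)) , F⊑ i
    ; cong = λ { refl → (λ y p → p) , λ y p → p }
    ; bijective = (λ {i} {j} eq → injective i j (i Finₚ.≟ j) eq) , surjective }
    where
    Fe = only-edge (classified F)
    e = proj₁ Fe
    F⊑ : ∀ i → proj₁ F ⊑ face (facet (ef e i))
    F⊑ i y y∈ = proj₂ (face≐On (facet (ef e i))) y
      (∈⇒⊆ (edge′ e) (facet (ef e i)) (λ { v (in-edge (k , refl)) → in-facet (ef∋ e i k) }) y (proj₁ (face≐On (edge′ e)) y (proj₁ (proj₂ Fe) y y∈)))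
    injective : ∀ i j → Dec (i ≡ j) → facePoints (face (facet (ef e i))) ≐′ facePoints (face (facet (ef e j))) → i ≡ j
    injective i j (yes i≡j) _ = i≡j
    injective i j (no i≢j) eq = ⊥-elim (ef-≢ e i≢j (≡.sym (facet-⊆ (ef e i) (ef e j) λ v v∈ →
      strip-facet (face-⊆⇒∈ (facet (ef e i)) (facet (ef e j)) (proj₁ eq) v (in-facet v∈)))))
    surjective : ∀ (G : Σ[ G ∈ FaceOfDim P 3 ] proj₁ F ⊑ proj₁ G) →
      ∃[ i ] (∀ {z} → z ≡ i → facePoints (face (facet (ef e z))) ≐′ facePoints (proj₁ (proj₁ G)))
    surjective (G , F⊑G) = proj₁ found , λ { refl → subst (λ h → facePoints (face (facet h)) ≐′ facePoints (proj₁ G)) (proj₂ found) (≐-sym (proj₂ Gg)) }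
      where
      Gg = only-facet (classified G)
      g = proj₁ Gg
      found = ef-all e g (λ k → strip-facet (face-⊆⇒∈ (edge′ e) (facet g)
        (λ y y∈ → proj₁ (proj₂ Gg) y (F⊑G y (proj₂ (proj₂ Fe) y y∈))) (end e k) (in-edge (k , refl))))

  -- With triangular 2-faces `f₀₂ = 3 f₂`, so `g₂ = 0` reduces to `f₁ + 10 = 4 f₀`.
  certified : ∀ {k} → nV ≡ k → nE ℕ.+ 10 ≡ 4 ℕ.* k →
    Σ[ P ∈ Polytope 4 ] HasVertices P k × TwoSimple P × TwoSimplicial P × Elementary P
  certified refl count = P , vertices , two-simple , two-simplicial
    , nV , nE , nT , nT ℕ.* 3 , vertices , edges , triangles , vertex-triangle-flags , elementary
    where
    module I = ℤ-Solver.+-*-Solver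
    open ≡.≡-Reasoning
    cast-+ : + nE ℤ.+ + 10 ≡ + 4 ℤ.* + nV
    cast-+ = ≡.trans (≡.sym (ℤₚ.pos-+ nE 10)) (≡.trans (cong +_ count) (ℤₚ.pos-* 4 nV))
    rearrange : ∀ t e v → t ℤ.* + 3 ℤ.- + 3 ℤ.* t ℤ.+ e ℤ.- + 4 ℤ.* v ℤ.+ + 10 ≡ (e ℤ.+ + 10) ℤ.- + 4 ℤ.* v
    rearrange = I.solve 3 (λ t e v → t I.:* I.con (+ 3) I.:- I.con (+ 3) I.:* t I.:+ e I.:- I.con (+ 4) I.:* v I.:+ I.con (+ 10)
      I.:= (e I.:+ I.con (+ 10)) I.:- I.con (+ 4) I.:* v) refl
    elementary : g₂ 4 nV nE nT (nT ℕ.* 3) ≡ + 0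
    elementary = begin
      + (nT ℕ.* 3) ℤ.- + 3 ℤ.* + nT ℤ.+ + nE ℤ.- + 4 ℤ.* + nV ℤ.+ + 10   ≡⟨ cong (λ z → z ℤ.- + 3 ℤ.* + nT ℤ.+ + nE ℤ.- + 4 ℤ.* + nV ℤ.+ + 10) (ℤₚ.pos-* nT 3) ⟩
      + nT ℤ.* + 3 ℤ.- + 3 ℤ.* + nT ℤ.+ + nE ℤ.- + 4 ℤ.* + nV ℤ.+ + 10   ≡⟨ rearrange (+ nT) (+ nE) (+ nV) ⟩
      (+ nE ℤ.+ + 10) ℤ.- + 4 ℤ.* + nV                                    ≡⟨ cong (ℤ._- + 4 ℤ.* + nV) cast-+ ⟩
      + 4 ℤ.* + nV ℤ.- + 4 ℤ.* + nV                                       ≡⟨ ℤₚ.+-inverseʳ (+ 4 ℤ.* + nV) ⟩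
      + 0                                                                  ∎

-- Gluing

_⊎-enum_ : ∀ {A B : Set} {m n} → Fin m ↔ A → Fin n ↔ B → Fin (m ℕ.+ n) ↔ (A ⊎ B)
a ⊎-enum b = (a ⊎-↔ b) ↔-∘ Finₚ.+↔⊎

unit : Fin 5 → Q⁵
unit = indicator

⟨⟩-unit : ∀ f a → ⟨ f , unit a ⟩ ≡ f a
⟨⟩-unit f a = ≡.trans (⟨⟩-unfold f (unit a)) (≡.trans (∑q-single (λ b → f b ℚ.* indicator a b) a
    (λ b b≢a → ≡.trans (cong (f b ℚ.*_) (indicator-other b≢a)) (ℚₚ.*-zeroʳ (f b))))
  (≡.trans (cong (f a ℚ.*_) (indicator-self a)) (ℚₚ.*-identityʳ (f a))))

unit-⟨⟩ : ∀ a x → ⟨ unit a , x ⟩ ≡ x a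
unit-⟨⟩ a x = ≡.trans (⟨⟩-comm (unit a) x) (⟨⟩-unit x a)

∑q-pos : ∀ {n} {f : Fin (suc n) → ℚ} → 0ℚ ℚ.< f zero → (∀ i → 0ℚ ℚ.≤ f (suc i)) → 0ℚ ℚ.< ∑q f
∑q-pos {n} {f} p q = subst (ℚ._< ∑q f) (ℚₚ.+-identityʳ 0ℚ) (ℚₚ.+-mono-<-≤ p (∑q-nonneg q))

neg*neg : ∀ {p q} → p ℚ.≤ 0ℚ → q ℚ.≤ 0ℚ → 0ℚ ℚ.≤ p ℚ.* q
neg*neg {p} {q} p≤0 q≤0 = subst (0ℚ ℚ.≤_) (solve 2 (λ p q → (:- p) :* (:- q) := p :* q) refl p q)
  (*-nonneg (ℚₚ.neg-antimono-≤ p≤0) (ℚₚ.neg-antimono-≤ q≤0))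

neg*neg< : ∀ {p q} → p ℚ.< 0ℚ → q ℚ.< 0ℚ → 0ℚ ℚ.< p ℚ.* q
neg*neg< {p} {q} p<0 q<0 = subst (0ℚ ℚ.<_) (solve 2 (λ p q → (:- p) :* (:- q) := p :* q) refl p q)
  (*-pos (ℚₚ.neg-antimono-< p<0) (ℚₚ.neg-antimono-< q<0))

-- A polytope together with a simple vertex fr 0 whose neighbours are fr 1, …, fr 4.
-- The vertices, edges and triangles avoiding fr 0 are listed separately, because these survive gluing.
record Open : Set₁ where
  field
    C : Cert
  open Cert C
  field
    fr       : Fin 5 → V
    ξ        : Fin 5 → Q⁵
    fv       : Fin 4 → Φ
    ξ-fv     : ∀ i x → ⟨ ξ (suc i) , x ⟩ ≡ ⟨ fac (fv i) , x ⟩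
    -- Simplicity of `fr 0` in coordinates: each of its four facets misses exactly one of the
    -- neighbours, where its value is 1, and `ξ 0` completes the four to a dual basis.
    dual     : ∀ a b → ⟨ ξ a , vert (fr b) ⟩ ≡ indicator b a
    only     : ∀ g → fr 0F ∈ᶠ g → ∃[ i ] g ≡ fv i
    -- Two facets at `fr 0` meet in a triangle whose other corners are neighbours of `fr 0`.
    two      : ∀ u {i k} → i ≢ k → u ∈ᶠ fv i → u ∈ᶠ fv k → ∃[ a ] u ≡ fr a

    V° E° T°    : Set
    nV° nE° nT° : ℕ
    enumV°      : Fin nV° ↔ V°
    enumE°      : Fin nE° ↔ E°
    enumT°      : Fin nT° ↔ T°

    up       : V° → V
    up-inj   : ∀ {o p} → up o ≡ up p → o ≡ p
    up≢      : ∀ o → up o ≢ fr 0F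
    coverV   : ∀ u → u ≢ fr 0F → ∃[ o ] up o ≡ u
    nb       : Fin 4 → V°
    up-nb    : ∀ i → up (nb i) ≡ fr (suc i)
    ιE       : E° → E
    ιE-inj   : ∀ {e e′} → ιE e ≡ ιE e′ → e ≡ e′
    end°     : E° → Fin 2 → V°
    up-end   : ∀ e k → up (end° e k) ≡ end (ιE e) k
    coverE   : ∀ e → (∀ k → end e k ≢ fr 0F) → ∃[ e° ] ιE e° ≡ e
    ιT       : T° → T
    ιT-inj   : ∀ {t t′} → ιT t ≡ ιT t′ → t ≡ t′
    tv°      : T° → Fin 3 → V°
    up-tv    : ∀ t l → up (tv° t l) ≡ tv (ιT t) l
    coverT   : ∀ t → (∀ l → tv t l ≢ fr 0F) → ∃[ t° ] ιT t° ≡ t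

    countV   : nV ≡ suc nV°
    countE   : nE ℕ.+ 10 ≡ 4 ℕ.* nV
    countE°  : nE° ℕ.+ 10 ≡ 4 ℕ.* nV°

-- A polytope with a simplex facet F, in the basis whose vectors 1, …, 4 are the vertices of F and
-- whose vector 0 lies on the four facets adjacent to F; these facets are the coordinates 1, …, 4.
-- Only what lies outside F is listed.  The second simple vertex is the first element of Y.
record Cap : Set where
  field
    m nΨ nT₂ : ℕ

  Y : Set
  Y = Fin (suc m)

  Ψ : Set
  Ψ = Fin nΨ

  E₂ : Set
  E₂ = Fin (4 ℕ.+ 4 ℕ.* m)

  T₂ : Set
  T₂ = Fin (6 ℕ.+ nT₂)

  W : Set
  W = Fin 4 ⊎ Y

  G : Set
  G = Fin 4 ⊎ Ψ

  field
    yv   : Y → Q⁵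
    ψ    : Ψ → Q⁵
    yfun : Y → Q⁵

  cv : W → Q⁵
  cv = [ unit ∘ suc , yv ]′

  cf : G → Q⁵
  cf = [ unit ∘ suc , ψ ]′

  field
    -- Vector 0 will become the simple vertex v of the other polytope. By these signs the new
    -- vertices lie in the cone over v and its neighbours, and every facet `ψ` cuts v off without
    -- cutting off a neighbour.
    yv≥0       : ∀ y i → 0ℚ ℚ.≤ yv y (suc i)
    yv>0       : ∀ y → 0ℚ ℚ.< yv y 0F
    ψ≥0        : ∀ p i → 0ℚ ℚ.≤ ψ p (suc i)
    ψ<0        : ∀ p → ψ p 0F ℚ.< 0ℚ
    ψ-yv       : ∀ p y → 0ℚ ℚ.≤ ⟨ ψ p , yv y ⟩
    yfun>0     : ∀ y i → 0ℚ ℚ.< yfun y (suc i)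
    yfun≤0     : ∀ y → yfun y 0F ℚ.≤ 0ℚ
    yfun-self  : ∀ y → ⟨ yfun y , yv y ⟩ ≡ 0ℚ
    yfun-other : ∀ y z → z ≢ y → 0ℚ ℚ.< ⟨ yfun y , yv z ⟩

    inc          : G → W → Bool
    inc-sound    : ∀ g w → inc g w ≡ true → ⟨ cf g , cv w ⟩ ≡ 0ℚ
    inc-complete : ∀ g w → ⟨ cf g , cv w ⟩ ≡ 0ℚ → inc g w ≡ true

  infix 4 _∈ᶜ_
  _∈ᶜ_ : W → G → Set
  w ∈ᶜ g = inc g w ≡ true

  field
    -- An edge of the simplex facet already has its three facets, namely that facet and two adjacent
    -- ones, so no further facet contains two of its vertices.
    ψ-one     : ∀ p i k → i ≢ k → inj₁ i ∈ᶜ inj₂ p → ¬ inj₁ k ∈ᶜ inj₂ p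
    yout      : Y → G
    yout∌     : ∀ y → ¬ inj₂ y ∈ᶜ yout y

    cend      : E₂ → Fin 2 → W
    cend-new  : ∀ e → ∃[ k ] ∃[ y ] cend e k ≡ inj₂ y
    cend-≢    : ∀ e → cend e 0F ≢ cend e 1F
    cend-set  : ∀ e e′ → (∀ k → ∃[ l ] cend e k ≡ cend e′ l) → e ≡ e′
    ctv       : T₂ → Fin 3 → W
    ctv-new   : ∀ t → ∃[ l ] ∃[ y ] ctv t l ≡ inj₂ y
    ctv-≢     : ∀ t l k → l ≢ k → ctv t l ≢ ctv t k
    ctv-set   : ∀ t t′ → (∀ k → ∃[ l ] ctv t k ≡ ctv t′ l) → t ≡ t′

    cef       : E₂ → Fin 3 → G
    cef-≢     : ∀ e i j → i ≢ j → cef e i ≢ cef e j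
    cef∋      : ∀ e i k → cend e k ∈ᶜ cef e i
    cef-all   : ∀ e g → (∀ k → cend e k ∈ᶜ g) → ∃[ i ] g ≡ cef e i
    cef-three : ∀ e w → (∀ i → w ∈ᶜ cef e i) → ∃[ k ] w ≡ cend e k
    cef-two   : ∀ e i j w → i ≢ j → w ∈ᶜ cef e i → w ∈ᶜ cef e j → (∃[ k ] w ≡ cend e k) ⊎
                (∃[ t ] ((∀ k → ∃[ l ] cend e k ≡ ctv t l) × (∃[ l ] w ≡ ctv t l) ×
                         (∀ l → (∃[ k ] ctv t l ≡ cend e k) ⊎ ctv t l ≡ w)))
    cedge     : ∀ y w g h → inj₂ y ≢ w → g ≢ h → inj₂ y ∈ᶜ g → w ∈ᶜ g → inj₂ y ∈ᶜ h → w ∈ᶜ h →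
                ∃[ e ] ((inj₂ y ≡ cend e 0F × w ≡ cend e 1F) ⊎ (inj₂ y ≡ cend e 1F × w ≡ cend e 0F))

    ctf       : T₂ → Fin 2 → G
    ctf-≢     : ∀ t → ctf t 0F ≢ ctf t 1F
    ctf∋      : ∀ t s l → ctv t l ∈ᶜ ctf t s
    ctf-all   : ∀ t g → (∀ l → ctv t l ∈ᶜ g) → ∃[ s ] g ≡ ctf t s
    ctf-two   : ∀ t w → (∀ s → w ∈ᶜ ctf t s) → ∃[ l ] w ≡ ctv t l
    cef-adj   : ∀ e i j → i ≢ j → ∃[ t ] ∃[ s ] (ctf t s ≡ cef e i × ctf t (other s) ≡ cef e j)

    -- The common triangle of two facets adjacent to the simplex facet. It takes the place of the
    -- triangle formed by v and two neighbours, which gluing destroys.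
    sides     : ∀ i j → i ≢ j → ∃[ t ] ∃[ s ] (ctf t s ≡ inj₁ i × ctf t (other s) ≡ inj₁ j)
    corner    : ∀ i j a b y → i ≢ j → a ≢ b → inj₁ a ∈ᶜ inj₁ i → inj₁ a ∈ᶜ inj₁ j → inj₁ b ∈ᶜ inj₁ i → inj₁ b ∈ᶜ inj₁ j →
                inj₂ y ∈ᶜ inj₁ i → inj₂ y ∈ᶜ inj₁ j →
                ∃[ t ] ((∃[ l ] inj₁ a ≡ ctv t l) × (∃[ l ] inj₁ b ≡ ctv t l) × (∃[ l ] inj₂ y ≡ ctv t l) ×
                        (∀ l → ctv t l ≡ inj₁ a ⊎ ctv t l ≡ inj₁ b ⊎ ctv t l ≡ inj₂ y))

    cbase     : G → T₂
    cside     : G → Fin 2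
    cbase-tf  : ∀ g → ctf (cbase g) (cside g) ≡ g
    ctip      : G → W
    ctip∈     : ∀ g → ctip g ∈ᶜ g
    ctip∉     : ∀ g → ¬ ctip g ∈ᶜ ctf (cbase g) (other (cside g))

    nbᶜ       : Fin 4 → W
    fvᶜ       : Fin 4 → G
    -- Completes the facets `fvᶜ` to the basis dual to the apex and its neighbours, which the next
    -- gluing requires.
    ξ₀        : Q⁵

  apex : W
  apex = inj₂ zero

  frᶜ : Fin 5 → W
  frᶜ = apex Vector.∷ nbᶜ

  ξᶜ : Fin 5 → Q⁵
  ξᶜ = ξ₀ Vector.∷ (cf ∘ fvᶜ)

  field
    dualᶜ     : ∀ a b → ⟨ ξᶜ a , cv (frᶜ b) ⟩ ≡ indicator b a
    onlyᶜ     : ∀ g → apex ∈ᶜ g → ∃[ i ] g ≡ fvᶜ i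
    twoᶜ      : ∀ w i j → i ≢ j → w ∈ᶜ fvᶜ i → w ∈ᶜ fvᶜ j → ∃[ a ] w ≡ frᶜ a
    cend≢apex : ∀ e k → cend (4 ↑ʳ e) k ≢ apex
    coverE₂   : ∀ e → (∀ k → cend e k ≢ apex) → ∃[ e° ] 4 ↑ʳ e° ≡ e
    ctv≢apex  : ∀ t l → ctv (6 ↑ʳ t) l ≢ apex
    coverT₂   : ∀ t → (∀ l → ctv t l ≢ apex) → ∃[ t° ] 6 ↑ʳ t° ≡ t

-- The certificate of the glued polytope

module Gluing (O : Open) (K : Cap) where
  open Open O
  open Cert C
  open Cap K

  v : V
  v = fr 0F

  -- The projective map of the overview as a linear map: the basis of the cap goes to `v` and its
  -- neighbours. Its inverse is `coords`, and `ι*` is the transpose of that inverse, which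
  -- transports functionals.
  ι : Q⁵ → Q⁵
  ι x j = ∑q (λ a → x a ℚ.* vert (fr a) j)

  ι* : Q⁵ → Q⁵
  ι* f j = ∑q (λ a → f a ℚ.* ξ a j)

  coords : Q⁵ → Q⁵
  coords x a = ⟨ ξ a , x ⟩

  complete : ∀ x j → x j ≡ ∑q (λ a → ⟨ ξ a , x ⟩ ℚ.* vert (fr a) j)
  complete = dual-complete ξ (vert ∘ fr) dual

  ⟨ι⟩ : ∀ f x → ⟨ f , ι x ⟩ ≡ ∑q (λ a → x a ℚ.* ⟨ f , vert (fr a) ⟩)
  ⟨ι⟩ f x = ⟨⟩-combination f x (vert ∘ fr)

  ⟨ι*⟩ : ∀ f x → ⟨ ι* f , x ⟩ ≡ ⟨ f , coords x ⟩
  ⟨ι*⟩ f x = ≡.trans (⟨⟩-comm (ι* f) x) (≡.trans (⟨⟩-combination x f ξ)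
    (≡.trans (ℚ-Sum.sum-cong-≗ {5} (λ a → cong (f a ℚ.*_) (⟨⟩-comm x (ξ a)))) (≡.sym (⟨⟩-unfold f (coords x)))))

  coords-ι : ∀ x a → coords (ι x) a ≡ x a
  coords-ι x a = ≡.trans (⟨ι⟩ (ξ a) x) (≡.trans (ℚ-Sum.sum-cong-≗ {5} (λ b → cong (x b ℚ.*_) (dual a b))) (∑q-indicator x a))

  coords-fr : ∀ b a → coords (vert (fr b)) a ≡ unit b a
  coords-fr b a = dual a b

  GV GF GE GT : Set
  GV = V° ⊎ Y
  GF = Φ ⊎ Ψ
  GE = E° ⊎ E₂
  GT = T° ⊎ T₂

  gvert : GV → Q⁵
  gvert (inj₁ o) = vert (up o)
  gvert (inj₂ y) = ι (yv y)

  gfac : GF → Q⁵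
  gfac (inj₁ g) = fac g
  gfac (inj₂ p) = ι* (ψ p)

  infix 4 _∈ᵍ_
  _∈ᵍ_ : GV → GF → Set
  w ∈ᵍ g = ⟨ gfac g , gvert w ⟩ ≡ 0ℚ

  capV : W → GV
  capV (inj₁ i) = inj₁ (nb i)
  capV (inj₂ y) = inj₂ y

  capF : G → GF
  capF (inj₁ i) = inj₁ (fv i)
  capF (inj₂ p) = inj₂ p

  coords-cap : ∀ w a → coords (gvert (capV w)) a ≡ cv w a
  coords-cap (inj₁ i) a = ≡.trans (cong (λ u → coords (vert u) a) (up-nb i)) (coords-fr (suc i) a)
  coords-cap (inj₂ y) a = coords-ι (yv y) a

  pair-capF : ∀ g x → ⟨ gfac (capF g) , x ⟩ ≡ ⟨ cf g , coords x ⟩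
  pair-capF (inj₁ i) x = ≡.trans (≡.sym (ξ-fv i x)) (≡.sym (unit-⟨⟩ (suc i) (coords x)))
  pair-capF (inj₂ p) x = ⟨ι*⟩ (ψ p) x

  pair-cap : ∀ g w → ⟨ gfac (capF g) , gvert (capV w) ⟩ ≡ ⟨ cf g , cv w ⟩
  pair-cap g w = ≡.trans (pair-capF g (gvert (capV w))) (⟨⟩-cong (cf g) (coords-cap w))

  cap∈ : ∀ {w g} → w ∈ᶜ g → capV w ∈ᵍ capF g
  cap∈ {w} {g} p = ≡.trans (pair-cap g w) (inc-sound g w p)

  cap∈⁻ : ∀ {w g} → capV w ∈ᵍ capF g → w ∈ᶜ g
  cap∈⁻ {w} {g} p = inc-complete g w (≡.trans (≡.sym (pair-cap g w)) p)

  1≢0 : 1ℚ ≢ 0ℚ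
  1≢0 ()

  v∈fv : ∀ i → v ∈ᶠ fv i
  v∈fv i = ≡.trans (≡.sym (ξ-fv i (vert v))) (dual (suc i) 0F)

  fr∈fv : ∀ a i → a ≢ suc i → fr a ∈ᶠ fv i
  fr∈fv a i a≢ = ≡.trans (≡.sym (ξ-fv i (vert (fr a)))) (≡.trans (dual (suc i) a) (indicator-other (a≢ ∘ ≡.sym)))

  fr∉fv : ∀ i → ¬ fr (suc i) ∈ᶠ fv i
  fr∉fv i p = 1≢0 (≡.trans (≡.sym (indicator-self (suc i))) (≡.trans (≡.sym (dual (suc i) (suc i))) (≡.trans (ξ-fv i _) p)))

  fv-inj : ∀ {i k} → fv i ≡ fv k → i ≡ k
  fv-inj {i} {k} eq with i Finₚ.≟ k
  ... | yes i≡k = i≡k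
  ... | no i≢k = ⊥-elim (fr∉fv k (subst (fr (suc k) ∈ᶠ_) eq (fr∈fv (suc k) i (i≢k ∘ ≡.sym ∘ Finₚ.suc-injective))))

  fr-inj : ∀ {a b} → fr a ≡ fr b → a ≡ b
  fr-inj {a} {b} eq with a Finₚ.≟ b
  ... | yes a≡b = a≡b
  ... | no a≢b = ⊥-elim (1≢0 (≡.trans (≡.sym (≡.trans (dual a a) (indicator-self a)))
          (≡.trans (cong (λ u → ⟨ ξ a , vert u ⟩) eq) (≡.trans (dual a b) (indicator-other a≢b)))))

  nb-inj : ∀ {i k} → nb i ≡ nb k → i ≡ k
  nb-inj {i} {k} eq = Finₚ.suc-injective (fr-inj (≡.trans (≡.sym (up-nb i)) (≡.trans (cong up eq) (up-nb k))))

  capF-inj : ∀ {g h} → capF g ≡ capF h → g ≡ h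
  capF-inj {inj₁ i} {inj₁ k} eq = cong inj₁ (fv-inj (inj₁-injective eq))
  capF-inj {inj₂ p} {inj₂ q} refl = refl
  capF-inj {inj₁ _} {inj₂ _} ()
  capF-inj {inj₂ _} {inj₁ _} ()

  capV-inj : ∀ {w u} → capV w ≡ capV u → w ≡ u
  capV-inj {inj₁ i} {inj₁ k} eq = cong inj₁ (nb-inj (inj₁-injective eq))
  capV-inj {inj₂ p} {inj₂ q} refl = refl
  capV-inj {inj₁ _} {inj₂ _} ()
  capV-inj {inj₂ _} {inj₁ _} ()

  isNb? : ∀ o → Dec (∃[ i ] o ≡ nb i)
  isNb? o with Finₚ.any? (λ i → up o VE.≟ fr (suc i))
  ... | yes (i , eq) = yes (i , up-inj (≡.trans eq (≡.sym (up-nb i))))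
  ... | no none = no λ { (i , eq) → none (i , ≡.trans (cong up eq) (up-nb i)) }

  coords≥0 : ∀ u i → 0ℚ ℚ.≤ coords (vert u) (suc i)
  coords≥0 u i = subst (0ℚ ℚ.≤_) (≡.sym (ξ-fv i (vert u))) (fac≥0 (fv i) u)

  not-fr : ∀ o → ¬ (∃[ i ] o ≡ nb i) → ∀ a → up o ≢ fr a
  not-fr o o∉nb zero eq = up≢ o eq
  not-fr o o∉nb (suc i) eq = o∉nb (i , up-inj (≡.trans eq (≡.sym (up-nb i))))

  -- Otherwise u would be a nonnegative combination of v and its neighbours, all of which lie
  -- strictly on the positive side of the functional supporting u.
  coords<0 : ∀ o → ¬ (∃[ i ] o ≡ nb i) → coords (vert (up o)) 0F ℚ.< 0ℚ
  coords<0 o o∉nb = ℚₚ.≰⇒> λ x₀≥0 → >⇒≢0 (chart>0 u) (≡.trans (⟨⟩-cong chart (λ j → ≡.trans (complete (vert u) j)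
      (≡.trans (ℚ-Sum.sum-cong-≗ {5} (λ a → ≡.trans (cong (ℚ._* vert (fr a) j) (vanish x₀≥0 a)) (ℚₚ.*-zeroˡ (vert (fr a) j))))
        (ℚ-Sum.sum-replicate-zero 5)))) (⟨⟩-zero chart))
    where
    u = up o
    f = vfun u
    x = coords (vert u)
    f>0 : ∀ a → 0ℚ ℚ.< ⟨ f , vert (fr a) ⟩
    f>0 a = vfun-other u (fr a) (not-fr o o∉nb a ∘ ≡.sym)
    total : ∑q (λ a → x a ℚ.* ⟨ f , vert (fr a) ⟩) ≡ 0ℚ
    total = ≡.trans (≡.sym (≡.trans (⟨⟩-cong f (complete (vert u))) (⟨⟩-combination f x (vert ∘ fr)))) (vfun-self u)
    module _ (x₀≥0 : 0ℚ ℚ.≤ x 0F) where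
      x≥0 : ∀ a → 0ℚ ℚ.≤ x a
      x≥0 zero = x₀≥0
      x≥0 (suc i) = coords≥0 u i
      vanish : ∀ a → x a ≡ 0ℚ
      vanish a = ≡.trans (≡.sym (ℚₚ.*-identityʳ (x a))) (≡.trans (cong (x a ℚ.*_) (≡.sym (inv-inverse q (>⇒≢0 (f>0 a)))))
        (≡.trans (≡.sym (ℚₚ.*-assoc (x a) q (inv q))) (≡.trans (cong (ℚ._* inv q)
          (∑q-zero (λ a → *-nonneg (x≥0 a) (ℚₚ.<⇒≤ (f>0 a))) total a)) (ℚₚ.*-zeroˡ (inv q)))))
        where q = ⟨ f , vert (fr a) ⟩

  -- Convexity across the seam: at `v` the functional is negative, and so is the `v`-coordinate of
  -- an old vertex that is no neighbour; their product is positive, and the remaining terms are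
  -- nonnegative.
  ψ-old : ∀ p o → ¬ (∃[ i ] o ≡ nb i) → 0ℚ ℚ.< ⟨ gfac (inj₂ p) , gvert (inj₁ o) ⟩
  ψ-old p o o∉nb = subst (0ℚ ℚ.<_) (≡.sym (≡.trans (⟨ι*⟩ (ψ p) (vert (up o))) (⟨⟩-unfold (ψ p) (coords (vert (up o))))))
    (∑q-pos {f = λ a → ψ p a ℚ.* coords (vert (up o)) a} (neg*neg< (ψ<0 p) (coords<0 o o∉nb)) (λ i → *-nonneg (ψ≥0 p i) (coords≥0 (up o) i)))

  -- A new vertex has positive weight at `v` and nonnegative weights at its neighbours. This hands
  -- on positivity of the chart, of the facets missing `v` and of the functionals `vfun`.
  new-pos : ∀ f y → 0ℚ ℚ.< ⟨ f , vert v ⟩ → (∀ i → 0ℚ ℚ.≤ ⟨ f , vert (fr (suc i)) ⟩) → 0ℚ ℚ.< ⟨ f , ι (yv y) ⟩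
  new-pos f y fv>0 f≥0 = subst (0ℚ ℚ.<_) (≡.sym (⟨ι⟩ f (yv y)))
    (∑q-pos {f = λ a → yv y a ℚ.* ⟨ f , vert (fr a) ⟩} (*-pos (yv>0 y) fv>0) (λ i → *-nonneg (yv≥0 y i) (f≥0 i)))

  old-new : ∀ g y → ¬ v ∈ᶠ g → 0ℚ ℚ.< ⟨ gfac (inj₁ g) , gvert (inj₂ y) ⟩
  old-new g y v∉g = new-pos (fac g) y (∉⇒> {v} {g} v∉g) (λ i → fac≥0 g (fr (suc i)))

  through-new : ∀ g y → inj₂ y ∈ᵍ g → ∃[ h ] g ≡ capF h
  through-new (inj₂ p) y _ = inj₂ p , refl
  through-new (inj₁ g) y y∈g = decide (v ∈ᶠ? g)
    where
    decide : Dec (v ∈ᶠ g) → ∃[ h ] inj₁ g ≡ capF h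
    decide (yes v∈g) = let i , eq = only g v∈g in inj₁ i , cong inj₁ eq
    decide (no v∉g) = ⊥-elim (>⇒≢0 (old-new g y v∉g) y∈g)

  old-through-new : ∀ {g} y → inj₂ y ∈ᵍ inj₁ g → ∃[ i ] g ≡ fv i
  old-through-new {g} y y∈g = strip (through-new (inj₁ g) y y∈g)
    where
    strip : ∃[ h ] inj₁ g ≡ capF h → ∃[ i ] g ≡ fv i
    strip (inj₁ i , refl) = i , refl

  on-new : ∀ p o → inj₁ o ∈ᵍ inj₂ p → ∃[ i ] o ≡ nb i
  on-new p o o∈p with isNb? o
  ... | yes q = q
  ... | no o∉nb = ⊥-elim (>⇒≢0 (ψ-old p o o∉nb) o∈p)

  on-two-sides : ∀ o {i k} → i ≢ k → up o ∈ᶠ fv i → up o ∈ᶠ fv k → ∃[ i ] o ≡ nb i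
  on-two-sides o i≢k p q with isNb? o
  ... | yes r = r
  ... | no o∉nb = let a , eq = two (up o) i≢k p q in ⊥-elim (not-fr o o∉nb a eq)

  on-two-caps : ∀ o g h → g ≢ h → inj₁ o ∈ᵍ capF g → inj₁ o ∈ᵍ capF h → ∃[ i ] o ≡ nb i
  on-two-caps o (inj₂ p) h _ o∈g _ = on-new p o o∈g
  on-two-caps o (inj₁ i) (inj₂ q) _ _ o∈h = on-new q o o∈h
  on-two-caps o (inj₁ i) (inj₁ k) g≢h o∈g o∈h = on-two-sides o (g≢h ∘ cong inj₁) o∈g o∈h

  -- Incidences with two distinct cap facets never leave the cap, so they can be read off its
  -- tables. An old vertex on two such facets must be a neighbour of `v`, by `two` or because `ψ` is
  -- positive on all other old vertices.
  cap-vertex : ∀ w g h → g ≢ h → w ∈ᵍ capF g → w ∈ᵍ capF h → ∃[ u ] w ≡ capV u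
  cap-vertex (inj₂ y) g h _ _ _ = inj₂ y , refl
  cap-vertex (inj₁ o) g h g≢h p q = let i , eq = on-two-caps o g h g≢h p q in inj₁ i , cong inj₁ eq

  ψ-two : ∀ p o o′ → o ≢ o′ → inj₁ o ∈ᵍ inj₂ p → ¬ inj₁ o′ ∈ᵍ inj₂ p
  ψ-two p o o′ o≢o′ o∈ o′∈ = clash (on-new p o o∈) (on-new p o′ o′∈)
    where
    clash : ∃[ i ] o ≡ nb i → ∃[ i ] o′ ≡ nb i → ⊥
    clash (i , refl) (k , refl) = ψ-one p i k (o≢o′ ∘ cong nb) (cap∈⁻ {inj₁ i} {inj₂ p} o∈) (cap∈⁻ {inj₁ k} {inj₂ p} o′∈)

  gfac≥0 : ∀ g w → 0ℚ ℚ.≤ ⟨ gfac g , gvert w ⟩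
  gfac≥0 (inj₁ g) (inj₁ o) = fac≥0 g (up o)
  gfac≥0 (inj₁ g) (inj₂ y) = decide (v ∈ᶠ? g)
    where
    decide : Dec (v ∈ᶠ g) → 0ℚ ℚ.≤ ⟨ fac g , ι (yv y) ⟩
    decide (no v∉g) = ℚₚ.<⇒≤ (old-new g y v∉g)
    decide (yes v∈g) with only g v∈g
    ... | i , refl = subst (0ℚ ℚ.≤_) (≡.sym (≡.trans (pair-cap (inj₁ i) (inj₂ y)) (unit-⟨⟩ (suc i) (yv y)))) (yv≥0 y i)
  gfac≥0 (inj₂ p) (inj₂ y) = subst (0ℚ ℚ.≤_) (≡.sym (pair-cap (inj₂ p) (inj₂ y))) (ψ-yv p y)
  gfac≥0 (inj₂ p) (inj₁ o) with isNb? o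
  ... | no o∉nb = ℚₚ.<⇒≤ (ψ-old p o o∉nb)
  ... | yes (i , refl) = subst (0ℚ ℚ.≤_) (≡.sym (≡.trans (pair-cap (inj₂ p) (inj₁ i)) (⟨⟩-unit (ψ p) (suc i)))) (ψ≥0 p i)

  gchart>0 : ∀ w → 0ℚ ℚ.< ⟨ chart , gvert w ⟩
  gchart>0 (inj₁ o) = chart>0 (up o)
  gchart>0 (inj₂ y) = new-pos chart y (chart>0 v) (λ i → ℚₚ.<⇒≤ (chart>0 (fr (suc i))))

  gvfun : GV → Q⁵
  gvfun (inj₁ o) = vfun (up o)
  gvfun (inj₂ y) = ι* (yfun y)

  gvfun-self : ∀ w → ⟨ gvfun w , gvert w ⟩ ≡ 0ℚ
  gvfun-self (inj₁ o) = vfun-self (up o)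
  gvfun-self (inj₂ y) = ≡.trans (⟨ι*⟩ (yfun y) (ι (yv y))) (≡.trans (⟨⟩-cong (yfun y) (coords-ι (yv y))) (yfun-self y))

  gvfun-other : ∀ w u → u ≢ w → 0ℚ ℚ.< ⟨ gvfun w , gvert u ⟩
  gvfun-other (inj₁ o) (inj₁ p) p≢o = vfun-other (up o) (up p) (p≢o ∘ cong inj₁ ∘ up-inj)
  gvfun-other (inj₁ o) (inj₂ y) _ = new-pos (vfun (up o)) y (vfun-other (up o) v (up≢ o ∘ ≡.sym)) nonneg′
    where
    nonneg′ : ∀ i → 0ℚ ℚ.≤ ⟨ vfun (up o) , vert (fr (suc i)) ⟩
    nonneg′ i with fr (suc i) VE.≟ up o
    ... | yes eq = ℚₚ.≤-reflexive (≡.sym (≡.trans (cong (λ u → ⟨ vfun (up o) , vert u ⟩) eq) (vfun-self (up o))))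
    ... | no ne = ℚₚ.<⇒≤ (vfun-other (up o) (fr (suc i)) ne)
  gvfun-other (inj₂ y) (inj₂ z) z≢y = subst (0ℚ ℚ.<_) (≡.sym (≡.trans (⟨ι*⟩ (yfun y) (ι (yv z))) (⟨⟩-cong (yfun y) (coords-ι (yv z)))))
    (yfun-other y z (z≢y ∘ cong inj₂))
  gvfun-other (inj₂ y) (inj₁ o) _ with isNb? o
  ... | yes (i , refl) = subst (0ℚ ℚ.<_) (≡.sym (≡.trans (⟨ι*⟩ (yfun y) (vert (up (nb i))))
          (≡.trans (⟨⟩-cong (yfun y) (coords-cap (inj₁ i))) (⟨⟩-unit (yfun y) (suc i))))) (yfun>0 y i)
  -- All terms are nonnegative and only strictness is at stake: a zero sum would put the old vertex
  -- on `fv 0` and `fv 1`, hence among the neighbours of `v`.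
  ... | no o∉nb = subst (0ℚ ℚ.<_) (≡.sym (≡.trans (⟨ι*⟩ (yfun y) (vert (up o))) (⟨⟩-unfold (yfun y) x)))
          (≤∧≢⇒< (∑q-nonneg term≥0) λ eq → none (zero-coordinate eq 0F) (zero-coordinate eq 1F))
    where
    x = coords (vert (up o))
    term≥0 : ∀ a → 0ℚ ℚ.≤ yfun y a ℚ.* x a
    term≥0 zero = neg*neg (yfun≤0 y) (ℚₚ.<⇒≤ (coords<0 o o∉nb))
    term≥0 (suc i) = *-nonneg (ℚₚ.<⇒≤ (yfun>0 y i)) (coords≥0 (up o) i)
    zero-coordinate : ∑q (λ a → yfun y a ℚ.* x a) ≡ 0ℚ → ∀ i → up o ∈ᶠ fv i
    zero-coordinate eq i = ≡.trans (≡.sym (ξ-fv i (vert (up o)))) (≡.trans (≡.sym (ℚₚ.*-identityˡ (x (suc i))))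
      (≡.trans (cong (ℚ._* x (suc i)) (≡.sym (inv-inverse q (>⇒≢0 (yfun>0 y i)))))
      (≡.trans (solve 3 (λ q j x → q :* j :* x := j :* (q :* x)) refl q (inv q) (x (suc i)))
        (≡.trans (cong (inv q ℚ.*_) (∑q-zero term≥0 eq (suc i))) (ℚₚ.*-zeroʳ (inv q))))))
      where q = yfun y (suc i)
    none : up o ∈ᶠ fv 0F → up o ∈ᶠ fv 1F → ⊥
    none p q = o∉nb (on-two-sides o {0F} {1F} (λ ()) p q)

  gout : GV → GF
  gout (inj₁ o) = inj₁ (out (up o))
  gout (inj₂ y) = capF (yout y)

  gout∌ : ∀ w → ¬ w ∈ᵍ gout w
  gout∌ (inj₁ o) = out∌ (up o)
  gout∌ (inj₂ y) p = yout∌ y (cap∈⁻ {inj₂ y} {yout y} p)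

  gend : GE → Fin 2 → GV
  gend (inj₁ e) k = inj₁ (end° e k)
  gend (inj₂ e) k = capV (cend e k)

  gend-≢ : ∀ e → gend e 0F ≢ gend e 1F
  gend-≢ (inj₁ e) eq = end-≢ (ιE e) (≡.trans (≡.sym (up-end e 0F)) (≡.trans (cong up (inj₁-injective eq)) (up-end e 1F)))
  gend-≢ (inj₂ e) eq = cend-≢ e (capV-inj eq)

  old≢new : ∀ {o : V°} {w : W} {y} → w ≡ inj₂ y → capV w ≢ inj₁ o
  old≢new refl ()

  lower-end : ∀ {e e′} → (∀ k → ∃[ l ] inj₁ {B = Y} (end° e k) ≡ inj₁ (end° e′ l)) → ∀ k → ∃[ l ] end (ιE e) k ≡ end (ιE e′) l
  lower-end {e} {e′} h k = let l , eq = h k in l , ≡.trans (≡.sym (up-end e k)) (≡.trans (cong up (inj₁-injective eq)) (up-end e′ l))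

  gend-set : ∀ e e′ → (∀ k → ∃[ l ] gend e k ≡ gend e′ l) → (∀ k → ∃[ l ] gend e′ k ≡ gend e l) → e ≡ e′
  gend-set (inj₁ e) (inj₁ e′) p q = cong inj₁ (ιE-inj (end-set (ιE e) (ιE e′) (lower-end {e} {e′} p) (lower-end {e′} {e} q)))
  gend-set (inj₂ e) (inj₂ e′) p _ = cong inj₂ (cend-set e e′ λ k → let l , eq = p k in l , capV-inj eq)
  gend-set (inj₁ e) (inj₂ e′) _ q = let k , y , eq = cend-new e′ in ⊥-elim (old≢new eq (proj₂ (q k)))
  gend-set (inj₂ e) (inj₁ e′) p _ = let k , y , eq = cend-new e in ⊥-elim (old≢new eq (proj₂ (p k)))

  gtv : GT → Fin 3 → GV
  gtv (inj₁ t) l = inj₁ (tv° t l)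
  gtv (inj₂ t) l = capV (ctv t l)

  gtv-≢ : ∀ t {l k} → l ≢ k → gtv t l ≢ gtv t k
  gtv-≢ (inj₁ t) {l} {k} l≢k eq = tv-≢ (ιT t) l≢k (≡.trans (≡.sym (up-tv t l)) (≡.trans (cong up (inj₁-injective eq)) (up-tv t k)))
  gtv-≢ (inj₂ t) {l} {k} l≢k eq = ctv-≢ t l k l≢k (capV-inj eq)

  lower-tv : ∀ {t t′} → (∀ k → ∃[ l ] inj₁ {B = Y} (tv° t k) ≡ inj₁ (tv° t′ l)) → ∀ k → ∃[ l ] tv (ιT t) k ≡ tv (ιT t′) l
  lower-tv {t} {t′} h k = let l , eq = h k in l , ≡.trans (≡.sym (up-tv t k)) (≡.trans (cong up (inj₁-injective eq)) (up-tv t′ l))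

  gtv-set : ∀ t t′ → (∀ k → ∃[ l ] gtv t k ≡ gtv t′ l) → (∀ k → ∃[ l ] gtv t′ k ≡ gtv t l) → t ≡ t′
  gtv-set (inj₁ t) (inj₁ t′) p q = cong inj₁ (ιT-inj (tv-set (ιT t) (ιT t′) (lower-tv {t} {t′} p) (lower-tv {t′} {t} q)))
  gtv-set (inj₂ t) (inj₂ t′) p _ = cong inj₂ (ctv-set t t′ λ k → let l , eq = p k in l , capV-inj eq)
  gtv-set (inj₁ t) (inj₂ t′) _ q = let k , y , eq = ctv-new t′ in ⊥-elim (old≢new eq (proj₂ (q k)))
  gtv-set (inj₂ t) (inj₁ t′) p _ = let k , y , eq = ctv-new t in ⊥-elim (old≢new eq (proj₂ (p k)))

  gef : GE → Fin 3 → GF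
  gef (inj₁ e) i = inj₁ (ef (ιE e) i)
  gef (inj₂ e) i = capF (cef e i)

  gef-≢ : ∀ e {i j} → i ≢ j → gef e i ≢ gef e j
  gef-≢ (inj₁ e) i≢j eq = ef-≢ (ιE e) i≢j (inj₁-injective eq)
  gef-≢ (inj₂ e) {i} {j} i≢j eq = cef-≢ e i j i≢j (capF-inj eq)

  gef∋ : ∀ e i k → gend e k ∈ᵍ gef e i
  gef∋ (inj₁ e) i k = subst (_∈ᶠ ef (ιE e) i) (≡.sym (up-end e k)) (ef∋ (ιE e) i k)
  gef∋ (inj₂ e) i k = cap∈ {cend e k} {cef e i} (cef∋ e i k)

  end°-≢ : ∀ e → end° e 0F ≢ end° e 1F
  end°-≢ e eq = gend-≢ (inj₁ e) (cong inj₁ eq)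

  up-end∈ : ∀ {g} e k → up (end° e k) ∈ᶠ g → end (ιE e) k ∈ᶠ g
  up-end∈ {g} e k = subst (_∈ᶠ g) (up-end e k)

  cap-all : ∀ {n} (w : Fin n → W) g → (∀ k → capV (w k) ∈ᵍ g) → (∃[ k ] ∃[ y ] w k ≡ inj₂ y) →
            ∃[ h ] (g ≡ capF h × (∀ k → w k ∈ᶜ h))
  cap-all w g h (k , y , eq) with through-new g y (subst (λ u → capV u ∈ᵍ g) eq (h k))
  ... | g′ , refl = g′ , refl , λ k → cap∈⁻ {w k} {g′} (h k)

  gef-all : ∀ e g → (∀ k → gend e k ∈ᵍ g) → ∃[ i ] g ≡ gef e i
  gef-all (inj₁ e) (inj₁ g) h = let i , eq = ef-all (ιE e) g (λ k → up-end∈ e k (h k)) in i , cong inj₁ eq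
  gef-all (inj₁ e) (inj₂ p) h = ⊥-elim (ψ-two p (end° e 0F) (end° e 1F) (end°-≢ e) (h 0F) (h 1F))
  gef-all (inj₂ e) g h with cap-all (cend e) g h (cend-new e)
  ... | g′ , refl , h′ = let i , eq = cef-all e g′ h′ in i , cong capF eq

  v∉E° : ∀ e k → end (ιE e) k ≢ v
  v∉E° e k eq = up≢ (end° e k) (≡.trans (up-end e k) eq)

  v∉T° : ∀ t l → tv (ιT t) l ≢ v
  v∉T° t l eq = up≢ (tv° t l) (≡.trans (up-tv t l) eq)

  v-through : ∀ {g} y → inj₂ y ∈ᵍ inj₁ g → v ∈ᶠ g
  v-through {g} y y∈g = let i , eq = old-through-new {g} y y∈g in subst (v ∈ᶠ_) (≡.sym eq) (v∈fv i)

  gef-three : ∀ e w → (∀ i → w ∈ᵍ gef e i) → ∃[ k ] w ≡ gend e k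
  gef-three (inj₁ e) (inj₁ o) h = let k , eq = ef-three (ιE e) (up o) h in k , cong inj₁ (up-inj (≡.trans eq (≡.sym (up-end e k))))
  gef-three (inj₁ e) (inj₂ y) h = let k , eq = ef-three (ιE e) v (λ i → v-through y (h i)) in ⊥-elim (v∉E° e k (≡.sym eq))
  gef-three (inj₂ e) w h with cap-vertex w (cef e 0F) (cef e 1F) (cef-≢ e 0F 1F (λ ())) (h 0F) (h 1F)
  ... | u , refl = let k , eq = cef-three e u (λ i → cap∈⁻ {u} {cef e i} (h i)) in k , cong capV eq

  TriangleOn : GE → GV → Set
  TriangleOn e w = ∃[ t ] ((∀ k → ∃[ l ] gend e k ≡ gtv t l) × (∃[ l ] w ≡ gtv t l) × (∀ l → (∃[ k ] gtv t l ≡ gend e k) ⊎ gtv t l ≡ w))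

  OldTriangleOn : E → V → Set
  OldTriangleOn e w = ∃[ t ] ((∀ k → ∃[ l ] end e k ≡ tv t l) × (∃[ l ] w ≡ tv t l) × (∀ l → (∃[ k ] tv t l ≡ end e k) ⊎ tv t l ≡ w))

  old-triangle : ∀ e o → OldTriangleOn (ιE e) (up o) → TriangleOn (inj₁ e) (inj₁ o)
  old-triangle e o (t , ends , w∈ , split) = lift (coverT t avoid)
    where
    avoid : ∀ l → tv t l ≢ v
    avoid l eq = decide (split l)
      where
      decide : (∃[ k ] tv t l ≡ end (ιE e) k) ⊎ tv t l ≡ up o → ⊥
      decide (inj₁ (k , eq′)) = v∉E° e k (≡.trans (≡.sym eq′) eq)
      decide (inj₂ eq′) = up≢ o (≡.trans (≡.sym eq′) eq)
    lift : ∃[ t° ] ιT t° ≡ t → TriangleOn (inj₁ e) (inj₁ o)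
    lift (t° , refl) = inj₁ t°
      , (λ k → let l , eq = ends k in l , cong inj₁ (up-inj (≡.trans (up-end e k) (≡.trans eq (≡.sym (up-tv t° l))))))
      , (let l , eq = w∈ in l , cong inj₁ (up-inj (≡.trans eq (≡.sym (up-tv t° l)))))
      , λ l → regroup l (split l)
      where
      regroup : ∀ l → (∃[ k ] tv t l ≡ end (ιE e) k) ⊎ tv t l ≡ up o → (∃[ k ] inj₁ (tv° t° l) ≡ inj₁ (end° e k)) ⊎ inj₁ (tv° t° l) ≡ inj₁ o
      regroup l (inj₁ (k , eq)) = inj₁ (k , cong inj₁ (up-inj (≡.trans (up-tv t° l) (≡.trans eq (≡.sym (up-end e k))))))
      regroup l (inj₂ eq) = inj₂ (cong inj₁ (up-inj (≡.trans (up-tv t° l) eq)))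

  gef-two : ∀ e i j w → i ≢ j → w ∈ᵍ gef e i → w ∈ᵍ gef e j → (∃[ k ] w ≡ gend e k) ⊎ TriangleOn e w
  gef-two (inj₁ e) i j (inj₁ o) i≢j p q with ef-two (ιE e) i j (up o) i≢j p q
  ... | inj₁ (k , eq) = inj₁ (k , cong inj₁ (up-inj (≡.trans eq (≡.sym (up-end e k)))))
  ... | inj₂ t = inj₂ (old-triangle e o t)
  -- Facets of the first polytope that contain a new vertex pass through `v`, so `e` joins two
  -- neighbours of `v`; the lost third corner `v` is replaced by `y`.
  gef-two (inj₁ e) i j (inj₂ y) i≢j p q = inj₂ (corners (old-through-new {ef (ιE e) i} y p) (old-through-new {ef (ιE e) j} y q))
    where
    corners : ∃[ k ] ef (ιE e) i ≡ fv k → ∃[ l ] ef (ιE e) j ≡ fv l → TriangleOn (inj₁ e) (inj₂ y)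
    corners (k , eqk) (l , eql) = finish (at 0F) (at 1F)
      where
      k≢l : k ≢ l
      k≢l k≡l = ef-≢ (ιE e) i≢j (≡.trans eqk (≡.trans (cong fv k≡l) (≡.sym eql)))
      on-k : ∀ m → up (end° e m) ∈ᶠ fv k
      on-k m = subst (up (end° e m) ∈ᶠ_) eqk (gef∋ (inj₁ e) i m)
      on-l : ∀ m → up (end° e m) ∈ᶠ fv l
      on-l m = subst (up (end° e m) ∈ᶠ_) eql (gef∋ (inj₁ e) j m)
      at : ∀ m → ∃[ a ] end° e m ≡ nb a
      at m = on-two-sides (end° e m) k≢l (on-k m) (on-l m)
      finish : ∃[ a ] end° e 0F ≡ nb a → ∃[ b ] end° e 1F ≡ nb b → TriangleOn (inj₁ e) (inj₂ y)
      finish (a , eqa) (b , eqb) = build (corner k l a b y k≢l a≢b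
          (side∈ 0F a k eqa (on-k 0F)) (side∈ 0F a l eqa (on-l 0F)) (side∈ 1F b k eqb (on-k 1F)) (side∈ 1F b l eqb (on-l 1F))
          (cap∈⁻ {inj₂ y} {inj₁ k} (subst (λ g → inj₂ y ∈ᵍ inj₁ g) eqk p)) (cap∈⁻ {inj₂ y} {inj₁ l} (subst (λ g → inj₂ y ∈ᵍ inj₁ g) eql q)))
        where
        a≢b : a ≢ b
        a≢b a≡b = end°-≢ e (≡.trans eqa (≡.trans (cong nb a≡b) (≡.sym eqb)))
        side∈ : ∀ m c k → end° e m ≡ nb c → up (end° e m) ∈ᶠ fv k → inj₁ c ∈ᶜ inj₁ k
        side∈ m c k eq r = cap∈⁻ {inj₁ c} {inj₁ k} (subst (λ o → up o ∈ᶠ fv k) eq r)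
        build : ∃[ t ] ((∃[ l ] inj₁ a ≡ ctv t l) × (∃[ l ] inj₁ b ≡ ctv t l) × (∃[ l ] inj₂ y ≡ ctv t l) ×
                        (∀ l → ctv t l ≡ inj₁ a ⊎ ctv t l ≡ inj₁ b ⊎ ctv t l ≡ inj₂ y)) → TriangleOn (inj₁ e) (inj₂ y)
        build (t , (la , qa) , (lb , qb) , (ly , qy) , split) = inj₂ t
          , (λ { 0F → la , ≡.trans (cong inj₁ eqa) (cong capV qa) ; 1F → lb , ≡.trans (cong inj₁ eqb) (cong capV qb) })
          , (ly , cong capV qy) , λ l → regroup l (split l)
          where
          regroup : ∀ l → ctv t l ≡ inj₁ a ⊎ ctv t l ≡ inj₁ b ⊎ ctv t l ≡ inj₂ y → (∃[ k ] capV (ctv t l) ≡ inj₁ (end° e k)) ⊎ capV (ctv t l) ≡ inj₂ y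
          regroup l (inj₁ r) = inj₁ (0F , ≡.trans (cong capV r) (cong inj₁ (≡.sym eqa)))
          regroup l (inj₂ (inj₁ r)) = inj₁ (1F , ≡.trans (cong capV r) (cong inj₁ (≡.sym eqb)))
          regroup l (inj₂ (inj₂ r)) = inj₂ (cong capV r)
  gef-two (inj₂ e) i j w i≢j p q with cap-vertex w (cef e i) (cef e j) (cef-≢ e i j i≢j) p q
  ... | u , refl with cef-two e i j u i≢j (cap∈⁻ {u} {cef e i} p) (cap∈⁻ {u} {cef e j} q)
  ...   | inj₁ (k , eq) = inj₁ (k , cong capV eq)
  ...   | inj₂ (t , ends , (l , eq) , split) = inj₂ (inj₂ t , (λ k → let l , eq = ends k in l , cong capV eq) , (l , cong capV eq) , λ l → regroup (split l))
    where
    regroup : ∀ {l} → (∃[ k ] ctv t l ≡ cend e k) ⊎ ctv t l ≡ u → (∃[ k ] capV (ctv t l) ≡ capV (cend e k)) ⊎ capV (ctv t l) ≡ capV u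
    regroup (inj₁ (k , eq)) = inj₁ (k , cong capV eq)
    regroup (inj₂ eq) = inj₂ (cong capV eq)

  Joined : GV → GV → Set
  Joined u w = ∃[ e ] ((u ≡ gend e 0F × w ≡ gend e 1F) ⊎ (u ≡ gend e 1F × w ≡ gend e 0F))

  Joined-sym : ∀ {u w} → Joined u w → Joined w u
  Joined-sym (e , inj₁ (p , q)) = e , inj₂ (q , p)
  Joined-sym (e , inj₂ (p , q)) = e , inj₁ (q , p)

  edge-new : ∀ y w g h → inj₂ y ≢ w → g ≢ h → inj₂ y ∈ᵍ g → w ∈ᵍ g → inj₂ y ∈ᵍ h → w ∈ᵍ h → Joined (inj₂ y) w
  edge-new y w g h y≢w g≢h p q r s with through-new g y p | through-new h y r
  ... | g′ , refl | h′ , refl with cap-vertex w g′ h′ (g≢h ∘ cong capF) q s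
  ...   | u , refl = lift (cedge y u g′ h′ (y≢w ∘ cong capV) (g≢h ∘ cong capF)
            (cap∈⁻ {inj₂ y} {g′} p) (cap∈⁻ {u} {g′} q) (cap∈⁻ {inj₂ y} {h′} r) (cap∈⁻ {u} {h′} s))
    where
    lift : ∃[ e ] ((inj₂ y ≡ cend e 0F × u ≡ cend e 1F) ⊎ (inj₂ y ≡ cend e 1F × u ≡ cend e 0F)) → Joined (inj₂ y) (capV u)
    lift (e , inj₁ (a , b)) = inj₂ e , inj₁ (cong capV a , cong capV b)
    lift (e , inj₂ (a , b)) = inj₂ e , inj₂ (cong capV a , cong capV b)

  gedge : ∀ u w g h → u ≢ w → g ≢ h → u ∈ᵍ g → w ∈ᵍ g → u ∈ᵍ h → w ∈ᵍ h → Joined u w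
  gedge (inj₂ y) w g h u≢w g≢h p q r s = edge-new y w g h u≢w g≢h p q r s
  gedge (inj₁ o) (inj₂ y) g h u≢w g≢h p q r s = Joined-sym (edge-new y (inj₁ o) g h (u≢w ∘ ≡.sym) g≢h q p s r)
  gedge (inj₁ o) (inj₁ o′) (inj₂ ψ) h u≢w _ p q _ _ = ⊥-elim (ψ-two ψ o o′ (u≢w ∘ cong inj₁) p q)
  gedge (inj₁ o) (inj₁ o′) (inj₁ g) (inj₂ ψ) u≢w _ _ _ r s = ⊥-elim (ψ-two ψ o o′ (u≢w ∘ cong inj₁) r s)
  gedge (inj₁ o) (inj₁ o′) (inj₁ g) (inj₁ h) u≢w g≢h p q r s =
      lift (edge (up o) (up o′) g h (u≢w ∘ cong inj₁ ∘ up-inj) (g≢h ∘ cong inj₁) p q r s)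
    where
    Ends : E → Set
    Ends e = (up o ≡ end e 0F × up o′ ≡ end e 1F) ⊎ (up o ≡ end e 1F × up o′ ≡ end e 0F)
    avoid : ∀ e → Ends e → ∀ k → end e k ≢ v
    avoid e (inj₁ (a , b)) 0F eq = up≢ o (≡.trans a eq)
    avoid e (inj₁ (a , b)) 1F eq = up≢ o′ (≡.trans b eq)
    avoid e (inj₂ (a , b)) 1F eq = up≢ o (≡.trans a eq)
    avoid e (inj₂ (a , b)) 0F eq = up≢ o′ (≡.trans b eq)
    down : ∀ {o} e k → up o ≡ end (ιE e) k → _≡_ {A = GV} (inj₁ o) (inj₁ (end° e k))
    down e k eq = cong inj₁ (up-inj (≡.trans eq (≡.sym (up-end e k))))
    finish : ∀ e° → Ends (ιE e°) → Joined (inj₁ o) (inj₁ o′)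
    finish e (inj₁ (a , b)) = inj₁ e , inj₁ (down e 0F a , down e 1F b)
    finish e (inj₂ (a , b)) = inj₁ e , inj₂ (down e 1F a , down e 0F b)
    lift : ∃[ e ] Ends e → Joined (inj₁ o) (inj₁ o′)
    lift (e , ends) with coverE e (avoid e ends)
    ... | e° , refl = finish e° ends

  gtf : GT → Fin 2 → GF
  gtf (inj₁ t) s = inj₁ (tf (ιT t) s)
  gtf (inj₂ t) s = capF (ctf t s)

  gtf-≢ : ∀ t → gtf t 0F ≢ gtf t 1F
  gtf-≢ (inj₁ t) eq = tf-≢ (ιT t) (inj₁-injective eq)
  gtf-≢ (inj₂ t) eq = ctf-≢ t (capF-inj eq)

  gtf∋ : ∀ t s l → gtv t l ∈ᵍ gtf t s
  gtf∋ (inj₁ t) s l = subst (_∈ᶠ tf (ιT t) s) (≡.sym (up-tv t l)) (tf∋ (ιT t) s l)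
  gtf∋ (inj₂ t) s l = cap∈ {ctv t l} {ctf t s} (ctf∋ t s l)

  gtf-all : ∀ t g → (∀ l → gtv t l ∈ᵍ g) → ∃[ s ] g ≡ gtf t s
  gtf-all (inj₁ t) (inj₁ g) h = let s , eq = tf-all (ιT t) g (λ l → subst (_∈ᶠ g) (up-tv t l) (h l)) in s , cong inj₁ eq
  gtf-all (inj₁ t) (inj₂ p) h = ⊥-elim (ψ-two p (tv° t 0F) (tv° t 1F) (λ eq → gtv-≢ (inj₁ t) {0F} {1F} (λ ()) (cong inj₁ eq)) (h 0F) (h 1F))
  gtf-all (inj₂ t) g h with cap-all (ctv t) g h (ctv-new t)
  ... | g′ , refl , h′ = let s , eq = ctf-all t g′ h′ in s , cong capF eq

  gtf-two : ∀ t w → (∀ s → w ∈ᵍ gtf t s) → ∃[ l ] w ≡ gtv t l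
  gtf-two (inj₁ t) (inj₁ o) h = let l , eq = tf-two (ιT t) (up o) h in l , cong inj₁ (up-inj (≡.trans eq (≡.sym (up-tv t l))))
  gtf-two (inj₁ t) (inj₂ y) h = let l , eq = tf-two (ιT t) v (λ s → v-through y (h s)) in ⊥-elim (v∉T° t l (≡.sym eq))
  gtf-two (inj₂ t) w h with cap-vertex w (ctf t 0F) (ctf t 1F) (ctf-≢ t) (h 0F) (h 1F)
  ... | u , refl = let l , eq = ctf-two t u (λ s → cap∈⁻ {u} {ctf t s} (h s)) in l , cong capV eq

  gef-adj : ∀ e i j → i ≢ j → ∃[ t ] ∃[ s ] (gtf t s ≡ gef e i × gtf t (other s) ≡ gef e j)
  gef-adj (inj₂ e) i j i≢j = let t , s , p , q = cef-adj e i j i≢j in inj₂ t , s , cong capF p , cong capF q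
  gef-adj (inj₁ e) i j i≢j = decide (ef-adj (ιE e) i j i≢j)
    where
    Goal = ∃[ t ] ∃[ s ] (gtf t s ≡ inj₁ (ef (ιE e) i) × gtf t (other s) ≡ inj₁ (ef (ιE e) j))
    decide : ∃[ t ] ∃[ s ] (tf t s ≡ ef (ιE e) i × tf t (other s) ≡ ef (ιE e) j) → Goal
    decide (t , s , p , q) with Finₚ.any? (λ l → tv t l VE.≟ v)
    ... | no v∉t with coverT t (λ l eq → v∉t (l , eq))
    ...   | t° , refl = inj₁ t° , s , cong inj₁ p , cong inj₁ q
    -- The shared triangle contained `v` and is gone, but both facets pass through `v`, and the cap
    -- provides a triangle between them.
    decide (t , s , p , q) | yes (l , v≡) = use (only _ (subst (v ∈ᶠ_) p (v∈ s))) (only _ (subst (v ∈ᶠ_) q (v∈ (other s))))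
      where
      v∈ : ∀ s → v ∈ᶠ tf t s
      v∈ s = subst (_∈ᶠ tf t s) v≡ (tf∋ t s l)
      use : ∃[ a ] ef (ιE e) i ≡ fv a → ∃[ b ] ef (ιE e) j ≡ fv b → Goal
      use (a , eqa) (b , eqb) = let t , s , p , q = sides a b (λ a≡b → ef-≢ (ιE e) i≢j (≡.trans eqa (≡.trans (cong fv a≡b) (≡.sym eqb)))) in
        inj₂ t , s , ≡.trans (cong capF p) (cong inj₁ (≡.sym eqa)) , ≡.trans (cong capF q) (cong inj₁ (≡.sym eqb))

  record Tipped (g : GF) : Set where
    field
      gbase  : GT
      gside  : Fin 2
      gbase≡ : gtf gbase gside ≡ g
      gtip   : GV
      gtip∈  : gtip ∈ᵍ g
      gtip∉  : ¬ gtip ∈ᵍ gtf gbase (other gside)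

  cap-tipped : ∀ g → Tipped (capF g)
  cap-tipped g = record
    { gbase = inj₂ (cbase g) ; gside = cside g ; gbase≡ = cong capF (cbase-tf g)
    ; gtip = capV (ctip g) ; gtip∈ = cap∈ {ctip g} {g} (ctip∈ g)
    ; gtip∉ = λ p → ctip∉ g (cap∈⁻ {ctip g} {ctf (cbase g) (other (cside g))} p) }

  -- A facet through `v` takes its base and tip from the cap. For any other facet the old ones avoid
  -- `v` and therefore survive.
  tipped : ∀ g → Tipped g
  tipped (inj₂ p) = cap-tipped (inj₂ p)
  tipped (inj₁ g) = decide (v ∈ᶠ? g)
    where
    decide : Dec (v ∈ᶠ g) → Tipped (inj₁ g)
    decide (yes v∈g) with only g v∈g
    ... | i , refl = cap-tipped (inj₁ i)
    decide (no v∉g) = build (coverT (base g) avoid) (coverV (tip g) (λ eq → v∉g (subst (_∈ᶠ g) eq (tip∈ g))))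
      where
      avoid : ∀ l → tv (base g) l ≢ v
      avoid l eq = v∉g (subst (_∈ᶠ g) eq (subst (tv (base g) l ∈ᶠ_) (base-tf g) (tf∋ (base g) (side g) l)))
      build : ∃[ t ] ιT t ≡ base g → ∃[ o ] up o ≡ tip g → Tipped (inj₁ g)
      build (t , eqt) (o , eqo) = record
        { gbase = inj₁ t ; gside = side g
        ; gbase≡ = cong inj₁ (≡.trans (cong (λ t → tf t (side g)) eqt) (base-tf g))
        ; gtip = inj₁ o ; gtip∈ = subst (_∈ᶠ g) (≡.sym eqo) (tip∈ g)
        ; gtip∉ = λ p → tip∉ g (subst (_∈ᶠ tf (base g) (other (side g))) eqo (subst (λ t → up o ∈ᶠ tf t (other (side g))) eqt p)) }

  cert : Cert
  cert = record
    { V = GV ; E = GE ; T = GT ; Φ = GF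
    ; enumV = enumV° ⊎-enum ↔-id Y ; enumE = enumE° ⊎-enum ↔-id E₂ ; enumT = enumT° ⊎-enum ↔-id T₂ ; enumΦ = enumΦ ⊎-enum ↔-id Ψ
    ; vert = gvert ; fac = gfac ; chart = chart ; fac≥0 = gfac≥0 ; chart>0 = gchart>0
    ; vfun = gvfun ; vfun-self = gvfun-self ; vfun-other = gvfun-other ; out = gout ; out∌ = gout∌
    ; end = gend ; end-≢ = gend-≢ ; end-set = gend-set ; tv = gtv ; tv-≢ = gtv-≢ ; tv-set = gtv-set
    ; ef = gef ; ef-≢ = gef-≢ ; ef∋ = gef∋ ; ef-all = gef-all ; ef-three = gef-three ; ef-two = gef-two ; edge = gedge
    ; tf = gtf ; tf-≢ = gtf-≢ ; tf∋ = gtf∋ ; tf-all = gtf-all ; tf-two = gtf-two ; ef-adj = gef-adj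
    ; base = λ g → Tipped.gbase (tipped g) ; side = λ g → Tipped.gside (tipped g) ; base-tf = λ g → Tipped.gbase≡ (tipped g)
    ; tip = λ g → Tipped.gtip (tipped g) ; tip∈ = λ g → Tipped.gtip∈ (tipped g) ; tip∉ = λ g → Tipped.gtip∉ (tipped g) }

  nbᶜ≢apex : ∀ i → nbᶜ i ≢ apex
  nbᶜ≢apex i eq = 1≢0 (≡.trans (≡.sym (dualᶜ 0F 0F)) (≡.trans (cong (λ w → ⟨ ξ₀ , cv w ⟩) (≡.sym eq)) (dualᶜ 0F (suc i))))

  fvᶜ-≢ : ∀ {i k} → i ≢ k → fvᶜ i ≢ fvᶜ k
  fvᶜ-≢ {i} {k} i≢k eq = 1≢0 (≡.trans (≡.sym (≡.trans (dualᶜ (suc i) (suc i)) (indicator-self (suc i))))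
    (≡.trans (cong (λ g → ⟨ cf g , cv (nbᶜ i) ⟩) eq) (≡.trans (dualᶜ (suc k) (suc i)) (indicator-other (i≢k ∘ ≡.sym ∘ Finₚ.suc-injective)))))

  gup : V° ⊎ Fin m → GV
  gup (inj₁ o) = inj₁ o
  gup (inj₂ y) = inj₂ (suc y)

  gup-inj : ∀ {o p} → gup o ≡ gup p → o ≡ p
  gup-inj {inj₁ o} {inj₁ p} eq = cong inj₁ (inj₁-injective eq)
  gup-inj {inj₂ y} {inj₂ z} eq = cong inj₂ (Finₚ.suc-injective (inj₂-injective eq))
  gup-inj {inj₁ _} {inj₂ _} ()
  gup-inj {inj₂ _} {inj₁ _} ()

  gup≢ : ∀ o → gup o ≢ inj₂ zero
  gup≢ (inj₁ o) ()
  gup≢ (inj₂ y) ()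

  gcoverV : ∀ u → u ≢ inj₂ zero → ∃[ o ] gup o ≡ u
  gcoverV (inj₁ o) _ = inj₁ o , refl
  gcoverV (inj₂ zero) ne = ⊥-elim (ne refl)
  gcoverV (inj₂ (suc y)) _ = inj₂ y , refl

  gcap : ∀ w → w ≢ apex → ∃[ o ] gup o ≡ capV w
  gcap w ne = gcoverV (capV w) (λ eq → ne (capV-inj eq))

  gιE : E° ⊎ Fin (4 ℕ.* m) → GE
  gιE (inj₁ e) = inj₁ e
  gιE (inj₂ e) = inj₂ (4 ↑ʳ e)

  gend° : E° ⊎ Fin (4 ℕ.* m) → Fin 2 → V° ⊎ Fin m
  gend° (inj₁ e) k = inj₁ (end° e k)
  gend° (inj₂ e) k = proj₁ (gcap (cend (4 ↑ʳ e) k) (cend≢apex e k))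

  gup-end : ∀ e k → gup (gend° e k) ≡ gend (gιE e) k
  gup-end (inj₁ e) k = refl
  gup-end (inj₂ e) k = proj₂ (gcap (cend (4 ↑ʳ e) k) (cend≢apex e k))

  gιE-inj : ∀ {e e′} → gιE e ≡ gιE e′ → e ≡ e′
  gιE-inj {inj₁ _} {inj₁ _} refl = refl
  gιE-inj {inj₂ e} {inj₂ e′} eq = cong inj₂ (Finₚ.↑ʳ-injective 4 e e′ (inj₂-injective eq))
  gιE-inj {inj₁ _} {inj₂ _} ()
  gιE-inj {inj₂ _} {inj₁ _} ()

  gcoverE : ∀ e → (∀ k → gend e k ≢ inj₂ zero) → ∃[ e° ] gιE e° ≡ e
  gcoverE (inj₁ e) _ = inj₁ e , refl
  gcoverE (inj₂ e) ne = let e° , eq = coverE₂ e (λ k eq → ne k (cong capV eq)) in inj₂ e° , cong inj₂ eq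

  gιT : T° ⊎ Fin nT₂ → GT
  gιT (inj₁ t) = inj₁ t
  gιT (inj₂ t) = inj₂ (6 ↑ʳ t)

  gtv° : T° ⊎ Fin nT₂ → Fin 3 → V° ⊎ Fin m
  gtv° (inj₁ t) l = inj₁ (tv° t l)
  gtv° (inj₂ t) l = proj₁ (gcap (ctv (6 ↑ʳ t) l) (ctv≢apex t l))

  gup-tv : ∀ t l → gup (gtv° t l) ≡ gtv (gιT t) l
  gup-tv (inj₁ t) l = refl
  gup-tv (inj₂ t) l = proj₂ (gcap (ctv (6 ↑ʳ t) l) (ctv≢apex t l))

  gιT-inj : ∀ {t t′} → gιT t ≡ gιT t′ → t ≡ t′
  gιT-inj {inj₁ _} {inj₁ _} refl = refl
  gιT-inj {inj₂ t} {inj₂ t′} eq = cong inj₂ (Finₚ.↑ʳ-injective 6 t t′ (inj₂-injective eq))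
  gιT-inj {inj₁ _} {inj₂ _} ()
  gιT-inj {inj₂ _} {inj₁ _} ()

  gcoverT : ∀ t → (∀ l → gtv t l ≢ inj₂ zero) → ∃[ t° ] gιT t° ≡ t
  gcoverT (inj₁ t) _ = inj₁ t , refl
  gcoverT (inj₂ t) ne = let t° , eq = coverT₂ t (λ l eq → ne l (cong capV eq)) in inj₂ t° , cong inj₂ eq

  gonly : ∀ g → inj₂ zero ∈ᵍ g → ∃[ i ] g ≡ capF (fvᶜ i)
  gonly g p with through-new g zero p
  ... | h , refl = let i , eq = onlyᶜ h (cap∈⁻ {apex} {h} p) in i , cong capF eq

  gtwo : ∀ w {i k} → i ≢ k → w ∈ᵍ capF (fvᶜ i) → w ∈ᵍ capF (fvᶜ k) → ∃[ a ] w ≡ capV (frᶜ a)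
  gtwo w {i} {k} i≢k p q with cap-vertex w (fvᶜ i) (fvᶜ k) (fvᶜ-≢ i≢k) p q
  ... | u , refl = let a , eq = twoᶜ u i k i≢k (cap∈⁻ {u} {fvᶜ i} p) (cap∈⁻ {u} {fvᶜ k} q) in a , cong capV eq

  -- All facets at the apex belong to the cap, so its simplicity and dual basis are transported by
  -- `ι*`; the apex becomes the distinguished vertex for the next gluing.
  reopened : Open
  reopened = record
    { C = cert
    ; fr = capV ∘ frᶜ
    ; ξ = ι* ∘ ξᶜ
    ; fv = capF ∘ fvᶜ
    ; ξ-fv = λ i x → ≡.trans (⟨ι*⟩ (cf (fvᶜ i)) x) (≡.sym (pair-capF (fvᶜ i) x))
    ; dual = λ a b → ≡.trans (⟨ι*⟩ (ξᶜ a) (gvert (capV (frᶜ b)))) (≡.trans (⟨⟩-cong (ξᶜ a) (coords-cap (frᶜ b))) (dualᶜ a b))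
    ; only = gonly ; two = gtwo
    ; enumV° = enumV° ⊎-enum ↔-id (Fin m)
    ; enumE° = enumE° ⊎-enum ↔-id (Fin (4 ℕ.* m))
    ; enumT° = enumT° ⊎-enum ↔-id (Fin nT₂)
    ; up = gup ; up-inj = gup-inj ; up≢ = gup≢ ; coverV = gcoverV
    ; nb = λ i → proj₁ (gcap (nbᶜ i) (nbᶜ≢apex i))
    ; up-nb = λ i → proj₂ (gcap (nbᶜ i) (nbᶜ≢apex i))
    ; ιE = gιE ; ιE-inj = gιE-inj ; end° = gend° ; up-end = gup-end ; coverE = gcoverE
    ; ιT = gιT ; ιT-inj = gιT-inj ; tv° = gtv° ; up-tv = gup-tv ; coverT = gcoverT
    ; countV = ℕₚ.+-suc nV° m
    -- The `suc m` new vertices bring four edges each, so `f₁ + 10 = 4 f₀` is preserved.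
    ; countE = ≡.trans (shift nE° (4 ℕ.+ 4 ℕ.* m)) (≡.trans (cong (ℕ._+ (4 ℕ.+ 4 ℕ.* m)) countE°)
        (≡.trans (cong (4 ℕ.* nV° ℕ.+_) (≡.sym (ℕₚ.*-suc 4 m))) (≡.sym (ℕₚ.*-distribˡ-+ 4 nV° (suc m)))))
    ; countE° = ≡.trans (shift nE° (4 ℕ.* m)) (≡.trans (cong (ℕ._+ 4 ℕ.* m) countE°) (≡.sym (ℕₚ.*-distribˡ-+ 4 nV° m))) }
    where
    shift : ∀ a b → a ℕ.+ b ℕ.+ 10 ≡ a ℕ.+ 10 ℕ.+ b
    shift a b = ≡.trans (ℕₚ.+-assoc a b 10) (≡.trans (cong (a ℕ.+_) (ℕₚ.+-comm b 10)) (≡.sym (ℕₚ.+-assoc a 10 b)))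

-- Caps and the simplex

all⊎? : ∀ {A B : Set} {P : A ⊎ B → Set} → Dec (∀ a → P (inj₁ a)) → Dec (∀ b → P (inj₂ b)) → Dec (∀ w → P w)
all⊎? l r = map′ (λ (p , q) → λ { (inj₁ a) → p a ; (inj₂ b) → q b }) (λ h → h ∘ inj₁ , h ∘ inj₂) (l ×-dec r)

any⊎? : ∀ {A B : Set} {P : A ⊎ B → Set} → Dec (∃[ a ] P (inj₁ a)) → Dec (∃[ b ] P (inj₂ b)) → Dec (∃[ w ] P w)
any⊎? l r = map′ (λ { (inj₁ (a , p)) → inj₁ a , p ; (inj₂ (b , p)) → inj₂ b , p })
  (λ { (inj₁ a , p) → inj₁ (a , p) ; (inj₂ b , p) → inj₂ (b , p) }) (l ⊎-dec r)

-- A rational vector with common denominator suc d.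
Scaled : Set
Scaled = ℕ × Vec ℤ 5

vector : Scaled → Q⁵
vector (d , z) j = lookup z j ℚ./ suc d

-- Vertices and facets are coded by numbers: 0, …, 3 are the vertices of the simplex facet
-- (respectively the facets adjacent to it), the others follow from 4 on.
record CapTable : Set where
  field
    m nΨ nT₂      : ℕ
    points        : Vec Scaled (suc m)
    facets        : Vec Scaled nΨ
    apex-dual     : Scaled
    members       : Vec (List ℕ) (4 ℕ.+ nΨ)
    edges         : Vec (Vec ℕ 2) (4 ℕ.+ 4 ℕ.* m)
    edge-facets   : Vec (Vec ℕ 3) (4 ℕ.+ 4 ℕ.* m)
    triangles     : Vec (Vec ℕ 3) (6 ℕ.+ nT₂)
    tri-facets    : Vec (Vec ℕ 2) (6 ℕ.+ nT₂)
    neighbours    : Vec ℕ 4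
    apex-facets   : Vec ℕ 4

module FromTable (D : CapTable) where
  open CapTable D

  Y Ψ E₂ T₂ W G : Set
  Y = Fin (suc m)
  Ψ = Fin nΨ
  E₂ = Fin (4 ℕ.+ 4 ℕ.* m)
  T₂ = Fin (6 ℕ.+ nT₂)
  W = Fin 4 ⊎ Y
  G = Fin 4 ⊎ Ψ

  -- Reduction modulo the number of vertices only makes the decoding total; the codes in the three
  -- tables are all in range.
  vertexCode : ℕ → W
  vertexCode c = splitAt 4 (c mod (4 ℕ.+ suc m))

  facetCode : ℕ → G
  facetCode c = splitAt 4 (c mod (4 ℕ.+ nΨ))

  yv : Y → Q⁵
  yv y = vector (lookup points y)

  ψ : Ψ → Q⁵
  ψ p = vector (lookup facets p)

  cv : W → Q⁵
  cv = [ unit ∘ suc , yv ]′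

  cf : G → Q⁵
  cf = [ unit ∘ suc , ψ ]′

  inc : G → W → Bool
  inc g w = any (ℕ._≡ᵇ toℕ (Fin.join 4 (suc m) w)) (lookup members (Fin.join 4 nΨ g))

  selected : Bool → ℚ → ℚ
  selected true q = q
  selected false _ = 0ℚ

  -- The sum of the facets through `y`. It vanishes only where all of them do, and so supports `y`
  -- alone.
  yfun : Y → Q⁵
  yfun y j = ∑q (λ i → selected (inc (inj₁ i) (inj₂ y)) (unit (suc i) j)) ℚ.+ ∑q (λ p → selected (inc (inj₂ p) (inj₂ y)) (ψ p j))

  -- The pairing in a form that evaluates, as the decision procedures below require; `⟨_,_⟩` is
  -- abstract.
  pair : Q⁵ → Q⁵ → ℚ
  pair f x = ∑q (λ j → f j ℚ.* x j)

  cend : E₂ → Fin 2 → W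
  cend e k = vertexCode (lookup (lookup edges e) k)

  cef : E₂ → Fin 3 → G
  cef e i = facetCode (lookup (lookup edge-facets e) i)

  ctv : T₂ → Fin 3 → W
  ctv t l = vertexCode (lookup (lookup triangles t) l)

  ctf : T₂ → Fin 2 → G
  ctf t s = facetCode (lookup (lookup tri-facets t) s)

  nbᶜ : Fin 4 → W
  nbᶜ i = vertexCode (lookup neighbours i)

  fvᶜ : Fin 4 → G
  fvᶜ i = facetCode (lookup apex-facets i)

  apex : W
  apex = inj₂ zero

  frᶜ : Fin 5 → W
  frᶜ = apex Vector.∷ nbᶜ

  ξᶜ : Fin 5 → Q⁵
  ξᶜ = vector apex-dual Vector.∷ (cf ∘ fvᶜ)

  infix 4 _∈ᶜ_
  _∈ᶜ_ : W → G → Set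
  w ∈ᶜ g = inc g w ≡ true

  _∈ᶜ?_ : ∀ w g → Dec (w ∈ᶜ g)
  w ∈ᶜ? g = inc g w Boolₚ.≟ true

  _≟ᵂ_ : DecidableEquality W
  _≟ᵂ_ = Sumₚ.≡-dec Finₚ._≟_ Finₚ._≟_

  _≟ᴳ_ : DecidableEquality G
  _≟ᴳ_ = Sumₚ.≡-dec Finₚ._≟_ Finₚ._≟_

  ∀ᵂ : ∀ {P : W → Set} → (∀ w → Dec (P w)) → Dec (∀ w → P w)
  ∀ᵂ P? = all⊎? (Finₚ.all? (P? ∘ inj₁)) (Finₚ.all? (P? ∘ inj₂))

  ∀ᴳ : ∀ {P : G → Set} → (∀ g → Dec (P g)) → Dec (∀ g → P g)
  ∀ᴳ P? = all⊎? (Finₚ.all? (P? ∘ inj₁)) (Finₚ.all? (P? ∘ inj₂))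

  ∃ᵂ : ∀ {P : W → Set} → (∀ w → Dec (P w)) → Dec (∃[ w ] P w)
  ∃ᵂ P? = any⊎? (Finₚ.any? (P? ∘ inj₁)) (Finₚ.any? (P? ∘ inj₂))

  ∃ᴳ : ∀ {P : G → Set} → (∀ g → Dec (P g)) → Dec (∃[ g ] P g)
  ∃ᴳ P? = any⊎? (Finₚ.any? (P? ∘ inj₁)) (Finₚ.any? (P? ∘ inj₂))

  open Finₚ using (all?; any?; _≟_)

  yv≥0? = all? λ y → all? λ i → 0ℚ ℚₚ.≤? yv y (suc i)
  yv>0? = all? λ y → 0ℚ ℚₚ.<? yv y 0F
  ψ≥0? = all? λ p → all? λ i → 0ℚ ℚₚ.≤? ψ p (suc i)
  ψ<0? = all? λ p → ψ p 0F ℚₚ.<? 0ℚ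
  ψ-yv? = all? λ p → all? λ y → 0ℚ ℚₚ.≤? pair (ψ p) (yv y)
  yfun>0? = all? λ y → all? λ i → 0ℚ ℚₚ.<? yfun y (suc i)
  yfun≤0? = all? λ y → yfun y 0F ℚₚ.≤? 0ℚ
  yfun-self? = all? λ y → pair (yfun y) (yv y) ℚₚ.≟ 0ℚ
  yfun-other? = all? λ y → all? λ z → ¬? (z ≟ y) →-dec 0ℚ ℚₚ.<? pair (yfun y) (yv z)
  inc? = ∀ᴳ λ g → ∀ᵂ λ w → inc g w Boolₚ.≟ does (pair (cf g) (cv w) ℚₚ.≟ 0ℚ)
  ψ-one? = all? λ p → all? λ i → all? λ k → ¬? (i ≟ k) →-dec (inj₁ i ∈ᶜ? inj₂ p) →-dec ¬? (inj₁ k ∈ᶜ? inj₂ p)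
  yout? = all? λ y → ∃ᴳ λ g → ¬? (inj₂ y ∈ᶜ? g)
  cend-new? = all? λ e → any? λ k → any? λ y → cend e k ≟ᵂ inj₂ y
  cend-≢? = all? λ e → ¬? (cend e 0F ≟ᵂ cend e 1F)
  cend-set? = all? λ e → all? λ e′ → (all? λ k → any? λ l → cend e k ≟ᵂ cend e′ l) →-dec (e ≟ e′)
  ctv-new? = all? λ t → any? λ l → any? λ y → ctv t l ≟ᵂ inj₂ y
  ctv-≢? = all? λ t → all? λ l → all? λ k → ¬? (l ≟ k) →-dec ¬? (ctv t l ≟ᵂ ctv t k)
  ctv-set? = all? λ t → all? λ t′ → (all? λ k → any? λ l → ctv t k ≟ᵂ ctv t′ l) →-dec (t ≟ t′)
  cef-≢? = all? λ e → all? λ i → all? λ j → ¬? (i ≟ j) →-dec ¬? (cef e i ≟ᴳ cef e j)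
  cef∋? = all? λ e → all? λ i → all? λ k → cend e k ∈ᶜ? cef e i
  cef-all? = all? λ e → ∀ᴳ λ g → (all? λ k → cend e k ∈ᶜ? g) →-dec (any? λ i → g ≟ᴳ cef e i)
  cef-three? = all? λ e → ∀ᵂ λ w → (all? λ i → w ∈ᶜ? cef e i) →-dec (any? λ k → w ≟ᵂ cend e k)
  cef-two? = all? λ e → all? λ i → all? λ j → ∀ᵂ λ w → ¬? (i ≟ j) →-dec (w ∈ᶜ? cef e i) →-dec (w ∈ᶜ? cef e j) →-dec
    ((any? λ k → w ≟ᵂ cend e k) ⊎-dec
     (any? λ t → (all? λ k → any? λ l → cend e k ≟ᵂ ctv t l) ×-dec (any? λ l → w ≟ᵂ ctv t l) ×-dec
                 (all? λ l → (any? λ k → ctv t l ≟ᵂ cend e k) ⊎-dec (ctv t l ≟ᵂ w))))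
  cedge? = all? λ y → ∀ᵂ λ w → ∀ᴳ λ g → ∀ᴳ λ h → ¬? (inj₂ y ≟ᵂ w) →-dec ¬? (g ≟ᴳ h) →-dec
    (inj₂ y ∈ᶜ? g) →-dec (w ∈ᶜ? g) →-dec (inj₂ y ∈ᶜ? h) →-dec (w ∈ᶜ? h) →-dec
    (any? λ e → ((inj₂ y ≟ᵂ cend e 0F) ×-dec (w ≟ᵂ cend e 1F)) ⊎-dec ((inj₂ y ≟ᵂ cend e 1F) ×-dec (w ≟ᵂ cend e 0F)))
  ctf-≢? = all? λ t → ¬? (ctf t 0F ≟ᴳ ctf t 1F)
  ctf∋? = all? λ t → all? λ s → all? λ l → ctv t l ∈ᶜ? ctf t s
  ctf-all? = all? λ t → ∀ᴳ λ g → (all? λ l → ctv t l ∈ᶜ? g) →-dec (any? λ s → g ≟ᴳ ctf t s)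
  ctf-two? = all? λ t → ∀ᵂ λ w → (all? λ s → w ∈ᶜ? ctf t s) →-dec (any? λ l → w ≟ᵂ ctv t l)
  cef-adj? = all? λ e → all? λ i → all? λ j → ¬? (i ≟ j) →-dec (any? λ t → any? λ s → (ctf t s ≟ᴳ cef e i) ×-dec (ctf t (other s) ≟ᴳ cef e j))
  sides? = all? λ i → all? λ j → ¬? (i ≟ j) →-dec (any? λ t → any? λ s → (ctf t s ≟ᴳ inj₁ i) ×-dec (ctf t (other s) ≟ᴳ inj₁ j))
  corner? = all? λ i → all? λ j → all? λ a → all? λ b → all? λ y → ¬? (i ≟ j) →-dec ¬? (a ≟ b) →-dec
    (inj₁ a ∈ᶜ? inj₁ i) →-dec (inj₁ a ∈ᶜ? inj₁ j) →-dec (inj₁ b ∈ᶜ? inj₁ i) →-dec (inj₁ b ∈ᶜ? inj₁ j) →-dec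
    (inj₂ y ∈ᶜ? inj₁ i) →-dec (inj₂ y ∈ᶜ? inj₁ j) →-dec
    (any? λ t → (any? λ l → inj₁ a ≟ᵂ ctv t l) ×-dec (any? λ l → inj₁ b ≟ᵂ ctv t l) ×-dec (any? λ l → inj₂ y ≟ᵂ ctv t l) ×-dec
                (all? λ l → (ctv t l ≟ᵂ inj₁ a) ⊎-dec ((ctv t l ≟ᵂ inj₁ b) ⊎-dec (ctv t l ≟ᵂ inj₂ y))))
  tip? = ∀ᴳ λ g → any? λ t → any? λ s → (ctf t s ≟ᴳ g) ×-dec (∃ᵂ λ w → (w ∈ᶜ? g) ×-dec ¬? (w ∈ᶜ? ctf t (other s)))
  dual? = all? λ a → all? λ b → pair (ξᶜ a) (cv (frᶜ b)) ℚₚ.≟ indicator b a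
  only? = ∀ᴳ λ g → (apex ∈ᶜ? g) →-dec (any? λ i → g ≟ᴳ fvᶜ i)
  two? = ∀ᵂ λ w → all? λ i → all? λ j → ¬? (i ≟ j) →-dec (w ∈ᶜ? fvᶜ i) →-dec (w ∈ᶜ? fvᶜ j) →-dec (any? λ a → w ≟ᵂ frᶜ a)
  cend≢apex? = all? λ e → all? λ k → ¬? (cend (4 ↑ʳ e) k ≟ᵂ apex)
  coverE₂? = all? λ e → (all? λ k → ¬? (cend e k ≟ᵂ apex)) →-dec (any? λ (e° : Fin (4 ℕ.* m)) → (4 ↑ʳ e°) ≟ e)
  ctv≢apex? = all? λ t → all? λ l → ¬? (ctv (6 ↑ʳ t) l ≟ᵂ apex)
  coverT₂? = all? λ t → (all? λ l → ¬? (ctv t l ≟ᵂ apex)) →-dec (any? λ (t° : Fin nT₂) → (6 ↑ʳ t°) ≟ t)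

  conditions? = yv≥0? ×-dec yv>0? ×-dec ψ≥0? ×-dec ψ<0? ×-dec ψ-yv? ×-dec yfun>0? ×-dec yfun≤0? ×-dec yfun-self? ×-dec
    yfun-other? ×-dec inc? ×-dec ψ-one? ×-dec yout? ×-dec cend-new? ×-dec cend-≢? ×-dec cend-set? ×-dec ctv-new? ×-dec
    ctv-≢? ×-dec ctv-set? ×-dec cef-≢? ×-dec cef∋? ×-dec cef-all? ×-dec cef-three? ×-dec cef-two? ×-dec cedge? ×-dec
    ctf-≢? ×-dec ctf∋? ×-dec ctf-all? ×-dec ctf-two? ×-dec cef-adj? ×-dec sides? ×-dec corner? ×-dec tip? ×-dec
    dual? ×-dec only? ×-dec two? ×-dec cend≢apex? ×-dec coverE₂? ×-dec ctv≢apex? ×-dec coverT₂?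

  private
    does⇒ : ∀ {A : Set} (a? : Dec A) → true ≡ does a? → A
    does⇒ (yes a) _ = a

    ⇒does : ∀ {A : Set} (a? : Dec A) → A → does a? ≡ true
    ⇒does (yes _) _ = refl
    ⇒does (no ¬a) a = ⊥-elim (¬a a)

  -- Every requirement on a cap is a finite conjunction of combinatorial or rational statements, so
  -- for a concrete table the witness `ok` is found by evaluating `conditions?`.
  cap : {ok : True conditions?} → Cap
  cap {ok} = assemble (toWitness {a? = conditions?} ok)
    where
    assemble : _ → Cap
    assemble (ok-yv≥0 , ok-yv>0 , ok-ψ≥0 , ok-ψ<0 , ok-ψ-yv , ok-yfun>0 , ok-yfun≤0 , ok-yfun-self ,
          ok-yfun-other , ok-incidence , ok-ψ-one , ok-yout , ok-cend-new , ok-cend-≢ , ok-cend-set , ok-ctv-new ,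
          ok-ctv-≢ , ok-ctv-set , ok-cef-≢ , ok-cef∋ , ok-cef-all , ok-cef-three , ok-cef-two , ok-cedge ,
          ok-ctf-≢ , ok-ctf∋ , ok-ctf-all , ok-ctf-two , ok-cef-adj , ok-sides , ok-corner , ok-tips ,
          ok-dual , ok-only , ok-two , ok-cend≢apex , ok-coverE₂ , ok-ctv≢apex , ok-coverT₂) = record
      { m = m ; nΨ = nΨ ; nT₂ = nT₂ ; yv = yv ; ψ = ψ ; yfun = yfun
      ; yv≥0 = ok-yv≥0 ; yv>0 = ok-yv>0 ; ψ≥0 = ok-ψ≥0 ; ψ<0 = ok-ψ<0
      ; ψ-yv = λ p y → subst (0ℚ ℚ.≤_) (≡.sym (⟨⟩-unfold (ψ p) (yv y))) (ok-ψ-yv p y)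
      ; yfun>0 = ok-yfun>0 ; yfun≤0 = ok-yfun≤0
      ; yfun-self = λ y → ≡.trans (⟨⟩-unfold (yfun y) (yv y)) (ok-yfun-self y)
      ; yfun-other = λ y z z≢y → subst (0ℚ ℚ.<_) (≡.sym (⟨⟩-unfold (yfun y) (yv z))) (ok-yfun-other y z z≢y)
      ; inc = inc
      ; inc-sound = λ g w eq → ≡.trans (⟨⟩-unfold (cf g) (cv w)) (does⇒ (pair (cf g) (cv w) ℚₚ.≟ 0ℚ) (≡.trans (≡.sym eq) (ok-incidence g w)))
      ; inc-complete = λ g w eq → ≡.trans (ok-incidence g w) (⇒does (pair (cf g) (cv w) ℚₚ.≟ 0ℚ) (≡.trans (≡.sym (⟨⟩-unfold (cf g) (cv w))) eq))
      ; ψ-one = ok-ψ-one ; yout = λ y → proj₁ (ok-yout y) ; yout∌ = λ y → proj₂ (ok-yout y)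
      ; cend = cend ; cend-new = ok-cend-new ; cend-≢ = ok-cend-≢ ; cend-set = ok-cend-set
      ; ctv = ctv ; ctv-new = ok-ctv-new ; ctv-≢ = ok-ctv-≢ ; ctv-set = ok-ctv-set
      ; cef = cef ; cef-≢ = ok-cef-≢ ; cef∋ = ok-cef∋ ; cef-all = ok-cef-all
      ; cef-three = ok-cef-three ; cef-two = ok-cef-two ; cedge = ok-cedge
      ; ctf = ctf ; ctf-≢ = ok-ctf-≢ ; ctf∋ = ok-ctf∋ ; ctf-all = ok-ctf-all ; ctf-two = ok-ctf-two
      ; cef-adj = ok-cef-adj ; sides = ok-sides ; corner = ok-corner
      ; cbase = λ g → proj₁ (ok-tips g) ; cside = λ g → proj₁ (proj₂ (ok-tips g)) ; cbase-tf = λ g → proj₁ (proj₂ (proj₂ (ok-tips g)))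
      ; ctip = λ g → proj₁ (proj₂ (proj₂ (proj₂ (ok-tips g)))) ; ctip∈ = λ g → proj₁ (proj₂ (proj₂ (proj₂ (proj₂ (ok-tips g)))))
      ; ctip∉ = λ g → proj₂ (proj₂ (proj₂ (proj₂ (proj₂ (ok-tips g)))))
      ; nbᶜ = nbᶜ ; fvᶜ = fvᶜ ; ξ₀ = vector apex-dual
      ; dualᶜ = λ a b → ≡.trans (⟨⟩-unfold (ξᶜ a) (cv (frᶜ b))) (ok-dual a b)
      ; onlyᶜ = ok-only ; twoᶜ = ok-two
      ; cend≢apex = ok-cend≢apex ; coverE₂ = ok-coverE₂
      ; ctv≢apex = ok-ctv≢apex ; coverT₂ = ok-coverT₂ }

-- Three polytopes found by computer search, with 9, 10 and 11 vertices.

table₉ : CapTable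
table₉ = record
  { m = 4 ; nΨ = 4 ; nT₂ = 16
  ; points =
      (0 , + 11 ∷ + 2 ∷ + 3 ∷ + 2 ∷ + 2 ∷ []) ∷ (0 , + 3 ∷ + 0 ∷ + 0 ∷ + 0 ∷ + 1 ∷ []) ∷ (0 , + 2 ∷ + 1 ∷ + 2 ∷ + 0 ∷ + 0 ∷ [])
      ∷ (0 , + 1 ∷ + 1 ∷ + 0 ∷ + 1 ∷ + 0 ∷ []) ∷ (0 , + 1 ∷ + 0 ∷ + 1 ∷ + 2 ∷ + 0 ∷ []) ∷ []
  ; facets =
      (1 , -[1+ 0 ] ∷ + 0 ∷ + 1 ∷ + 1 ∷ + 3 ∷ []) ∷ (0 , -[1+ 0 ] ∷ + 1 ∷ + 1 ∷ + 0 ∷ + 3 ∷ []) ∷ (2 , -[1+ 1 ] ∷ + 4 ∷ + 0 ∷ + 1 ∷ + 6 ∷ [])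
      ∷ (2 , -[1+ 4 ] ∷ + 4 ∷ + 3 ∷ + 1 ∷ + 18 ∷ []) ∷ []
  ; apex-dual = (5 , + 5 ∷ -[1+ 3 ] ∷ -[1+ 2 ] ∷ -[1+ 0 ] ∷ -[1+ 14 ] ∷ [])
  ; members =
      (1 ∷ 2 ∷ 3 ∷ 5 ∷ 8 ∷ []) ∷ (0 ∷ 2 ∷ 3 ∷ 5 ∷ 7 ∷ []) ∷ (0 ∷ 1 ∷ 3 ∷ 5 ∷ 6 ∷ []) ∷ (0 ∷ 1 ∷ 2 ∷ 6 ∷ 7 ∷ 8 ∷ [])
      ∷ (0 ∷ 4 ∷ 5 ∷ 6 ∷ 7 ∷ []) ∷ (2 ∷ 4 ∷ 5 ∷ 7 ∷ 8 ∷ []) ∷ (1 ∷ 4 ∷ 5 ∷ 6 ∷ 8 ∷ []) ∷ (4 ∷ 6 ∷ 7 ∷ 8 ∷ []) ∷ []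
  ; edges =
      (4 ∷ 5 ∷ []) ∷ (4 ∷ 6 ∷ []) ∷ (4 ∷ 7 ∷ []) ∷ (4 ∷ 8 ∷ []) ∷ (0 ∷ 5 ∷ []) ∷ (0 ∷ 6 ∷ []) ∷ (0 ∷ 7 ∷ []) ∷ (1 ∷ 5 ∷ [])
      ∷ (1 ∷ 6 ∷ []) ∷ (1 ∷ 8 ∷ []) ∷ (2 ∷ 5 ∷ []) ∷ (2 ∷ 7 ∷ []) ∷ (2 ∷ 8 ∷ []) ∷ (3 ∷ 5 ∷ []) ∷ (5 ∷ 6 ∷ []) ∷ (5 ∷ 7 ∷ [])
      ∷ (5 ∷ 8 ∷ []) ∷ (6 ∷ 7 ∷ []) ∷ (6 ∷ 8 ∷ []) ∷ (7 ∷ 8 ∷ []) ∷ []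
  ; edge-facets =
      (4 ∷ 5 ∷ 6 ∷ []) ∷ (4 ∷ 6 ∷ 7 ∷ []) ∷ (4 ∷ 5 ∷ 7 ∷ []) ∷ (5 ∷ 6 ∷ 7 ∷ []) ∷ (1 ∷ 2 ∷ 4 ∷ []) ∷ (2 ∷ 3 ∷ 4 ∷ [])
      ∷ (1 ∷ 3 ∷ 4 ∷ []) ∷ (0 ∷ 2 ∷ 6 ∷ []) ∷ (2 ∷ 3 ∷ 6 ∷ []) ∷ (0 ∷ 3 ∷ 6 ∷ []) ∷ (0 ∷ 1 ∷ 5 ∷ []) ∷ (1 ∷ 3 ∷ 5 ∷ [])
      ∷ (0 ∷ 3 ∷ 5 ∷ []) ∷ (0 ∷ 1 ∷ 2 ∷ []) ∷ (2 ∷ 4 ∷ 6 ∷ []) ∷ (1 ∷ 4 ∷ 5 ∷ []) ∷ (0 ∷ 5 ∷ 6 ∷ []) ∷ (3 ∷ 4 ∷ 7 ∷ [])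
      ∷ (3 ∷ 6 ∷ 7 ∷ []) ∷ (3 ∷ 5 ∷ 7 ∷ []) ∷ []
  ; triangles =
      (4 ∷ 5 ∷ 6 ∷ []) ∷ (4 ∷ 5 ∷ 7 ∷ []) ∷ (4 ∷ 5 ∷ 8 ∷ []) ∷ (4 ∷ 6 ∷ 7 ∷ []) ∷ (4 ∷ 6 ∷ 8 ∷ []) ∷ (4 ∷ 7 ∷ 8 ∷ [])
      ∷ (0 ∷ 1 ∷ 6 ∷ []) ∷ (0 ∷ 2 ∷ 7 ∷ []) ∷ (0 ∷ 3 ∷ 5 ∷ []) ∷ (0 ∷ 5 ∷ 6 ∷ []) ∷ (0 ∷ 5 ∷ 7 ∷ []) ∷ (0 ∷ 6 ∷ 7 ∷ [])
      ∷ (1 ∷ 2 ∷ 8 ∷ []) ∷ (1 ∷ 3 ∷ 5 ∷ []) ∷ (1 ∷ 5 ∷ 6 ∷ []) ∷ (1 ∷ 5 ∷ 8 ∷ []) ∷ (1 ∷ 6 ∷ 8 ∷ []) ∷ (2 ∷ 3 ∷ 5 ∷ [])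
      ∷ (2 ∷ 5 ∷ 7 ∷ []) ∷ (2 ∷ 5 ∷ 8 ∷ []) ∷ (2 ∷ 7 ∷ 8 ∷ []) ∷ (6 ∷ 7 ∷ 8 ∷ []) ∷ []
  ; tri-facets =
      (4 ∷ 6 ∷ []) ∷ (4 ∷ 5 ∷ []) ∷ (5 ∷ 6 ∷ []) ∷ (4 ∷ 7 ∷ []) ∷ (6 ∷ 7 ∷ []) ∷ (5 ∷ 7 ∷ []) ∷ (2 ∷ 3 ∷ []) ∷ (1 ∷ 3 ∷ [])
      ∷ (1 ∷ 2 ∷ []) ∷ (2 ∷ 4 ∷ []) ∷ (1 ∷ 4 ∷ []) ∷ (3 ∷ 4 ∷ []) ∷ (0 ∷ 3 ∷ []) ∷ (0 ∷ 2 ∷ []) ∷ (2 ∷ 6 ∷ []) ∷ (0 ∷ 6 ∷ [])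
      ∷ (3 ∷ 6 ∷ []) ∷ (0 ∷ 1 ∷ []) ∷ (1 ∷ 5 ∷ []) ∷ (0 ∷ 5 ∷ []) ∷ (3 ∷ 5 ∷ []) ∷ (3 ∷ 7 ∷ []) ∷ []
  ; neighbours = (8 ∷ 6 ∷ 7 ∷ 5 ∷ [])
  ; apex-facets = (4 ∷ 5 ∷ 6 ∷ 7 ∷ []) }

table₁₀ : CapTable
table₁₀ = record
  { m = 5 ; nΨ = 5 ; nT₂ = 20
  ; points =
      (0 , + 1 ∷ + 9 ∷ + 0 ∷ + 0 ∷ + 3 ∷ []) ∷ (1 , + 5 ∷ + 15 ∷ + 2 ∷ + 0 ∷ + 5 ∷ []) ∷ (0 , + 1 ∷ + 0 ∷ + 1 ∷ + 0 ∷ + 0 ∷ [])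
      ∷ (1 , + 7 ∷ + 0 ∷ + 0 ∷ + 2 ∷ + 11 ∷ []) ∷ (0 , + 22 ∷ + 0 ∷ + 9 ∷ + 2 ∷ + 21 ∷ []) ∷ (0 , + 3 ∷ + 2 ∷ + 0 ∷ + 15 ∷ + 0 ∷ []) ∷ []
  ; facets =
      (0 , -[1+ 4 ] ∷ + 0 ∷ + 5 ∷ + 1 ∷ + 3 ∷ []) ∷ (0 , -[1+ 2 ] ∷ + 0 ∷ + 5 ∷ + 5 ∷ + 1 ∷ []) ∷ (1 , -[1+ 17 ] ∷ + 2 ∷ + 30 ∷ + 63 ∷ + 0 ∷ [])
      ∷ (0 , -[1+ 9 ] ∷ + 2 ∷ + 10 ∷ + 65 ∷ + 0 ∷ []) ∷ (0 , -[1+ 21 ] ∷ + 33 ∷ + 22 ∷ + 0 ∷ + 14 ∷ []) ∷ []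
  ; apex-dual = (1 , + 2 ∷ + 0 ∷ -[1+ 4 ] ∷ -[1+ 6 ] ∷ + 0 ∷ [])
  ; members =
      (1 ∷ 2 ∷ 3 ∷ 6 ∷ 7 ∷ 8 ∷ []) ∷ (0 ∷ 2 ∷ 3 ∷ 4 ∷ 7 ∷ 9 ∷ []) ∷ (0 ∷ 1 ∷ 3 ∷ 4 ∷ 5 ∷ 6 ∷ []) ∷ (0 ∷ 1 ∷ 2 ∷ 6 ∷ 9 ∷ [])
      ∷ (0 ∷ 5 ∷ 6 ∷ 7 ∷ 8 ∷ 9 ∷ []) ∷ (0 ∷ 4 ∷ 5 ∷ 7 ∷ []) ∷ (3 ∷ 4 ∷ 5 ∷ 7 ∷ 8 ∷ []) ∷ (3 ∷ 5 ∷ 6 ∷ 8 ∷ [])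
      ∷ (2 ∷ 6 ∷ 7 ∷ 9 ∷ []) ∷ []
  ; edges =
      (0 ∷ 4 ∷ []) ∷ (3 ∷ 4 ∷ []) ∷ (4 ∷ 5 ∷ []) ∷ (4 ∷ 7 ∷ []) ∷ (0 ∷ 5 ∷ []) ∷ (0 ∷ 6 ∷ []) ∷ (0 ∷ 7 ∷ []) ∷ (0 ∷ 9 ∷ [])
      ∷ (1 ∷ 6 ∷ []) ∷ (2 ∷ 6 ∷ []) ∷ (2 ∷ 7 ∷ []) ∷ (2 ∷ 9 ∷ []) ∷ (3 ∷ 5 ∷ []) ∷ (3 ∷ 6 ∷ []) ∷ (3 ∷ 7 ∷ []) ∷ (3 ∷ 8 ∷ [])
      ∷ (5 ∷ 6 ∷ []) ∷ (5 ∷ 7 ∷ []) ∷ (5 ∷ 8 ∷ []) ∷ (6 ∷ 7 ∷ []) ∷ (6 ∷ 8 ∷ []) ∷ (6 ∷ 9 ∷ []) ∷ (7 ∷ 8 ∷ []) ∷ (7 ∷ 9 ∷ []) ∷ []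
  ; edge-facets =
      (1 ∷ 2 ∷ 5 ∷ []) ∷ (1 ∷ 2 ∷ 6 ∷ []) ∷ (2 ∷ 5 ∷ 6 ∷ []) ∷ (1 ∷ 5 ∷ 6 ∷ []) ∷ (2 ∷ 4 ∷ 5 ∷ []) ∷ (2 ∷ 3 ∷ 4 ∷ [])
      ∷ (1 ∷ 4 ∷ 5 ∷ []) ∷ (1 ∷ 3 ∷ 4 ∷ []) ∷ (0 ∷ 2 ∷ 3 ∷ []) ∷ (0 ∷ 3 ∷ 8 ∷ []) ∷ (0 ∷ 1 ∷ 8 ∷ []) ∷ (1 ∷ 3 ∷ 8 ∷ [])
      ∷ (2 ∷ 6 ∷ 7 ∷ []) ∷ (0 ∷ 2 ∷ 7 ∷ []) ∷ (0 ∷ 1 ∷ 6 ∷ []) ∷ (0 ∷ 6 ∷ 7 ∷ []) ∷ (2 ∷ 4 ∷ 7 ∷ []) ∷ (4 ∷ 5 ∷ 6 ∷ [])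
      ∷ (4 ∷ 6 ∷ 7 ∷ []) ∷ (0 ∷ 4 ∷ 8 ∷ []) ∷ (0 ∷ 4 ∷ 7 ∷ []) ∷ (3 ∷ 4 ∷ 8 ∷ []) ∷ (0 ∷ 4 ∷ 6 ∷ []) ∷ (1 ∷ 4 ∷ 8 ∷ []) ∷ []
  ; triangles =
      (0 ∷ 3 ∷ 4 ∷ []) ∷ (0 ∷ 4 ∷ 5 ∷ []) ∷ (0 ∷ 4 ∷ 7 ∷ []) ∷ (3 ∷ 4 ∷ 5 ∷ []) ∷ (3 ∷ 4 ∷ 7 ∷ []) ∷ (4 ∷ 5 ∷ 7 ∷ [])
      ∷ (0 ∷ 1 ∷ 6 ∷ []) ∷ (0 ∷ 2 ∷ 9 ∷ []) ∷ (0 ∷ 5 ∷ 6 ∷ []) ∷ (0 ∷ 5 ∷ 7 ∷ []) ∷ (0 ∷ 6 ∷ 9 ∷ []) ∷ (0 ∷ 7 ∷ 9 ∷ [])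
      ∷ (1 ∷ 2 ∷ 6 ∷ []) ∷ (1 ∷ 3 ∷ 6 ∷ []) ∷ (2 ∷ 3 ∷ 7 ∷ []) ∷ (2 ∷ 6 ∷ 7 ∷ []) ∷ (2 ∷ 6 ∷ 9 ∷ []) ∷ (2 ∷ 7 ∷ 9 ∷ [])
      ∷ (3 ∷ 5 ∷ 6 ∷ []) ∷ (3 ∷ 5 ∷ 8 ∷ []) ∷ (3 ∷ 6 ∷ 8 ∷ []) ∷ (3 ∷ 7 ∷ 8 ∷ []) ∷ (5 ∷ 6 ∷ 8 ∷ []) ∷ (5 ∷ 7 ∷ 8 ∷ [])
      ∷ (6 ∷ 7 ∷ 8 ∷ []) ∷ (6 ∷ 7 ∷ 9 ∷ []) ∷ []
  ; tri-facets =
      (1 ∷ 2 ∷ []) ∷ (2 ∷ 5 ∷ []) ∷ (1 ∷ 5 ∷ []) ∷ (2 ∷ 6 ∷ []) ∷ (1 ∷ 6 ∷ []) ∷ (5 ∷ 6 ∷ []) ∷ (2 ∷ 3 ∷ []) ∷ (1 ∷ 3 ∷ [])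
      ∷ (2 ∷ 4 ∷ []) ∷ (4 ∷ 5 ∷ []) ∷ (3 ∷ 4 ∷ []) ∷ (1 ∷ 4 ∷ []) ∷ (0 ∷ 3 ∷ []) ∷ (0 ∷ 2 ∷ []) ∷ (0 ∷ 1 ∷ []) ∷ (0 ∷ 8 ∷ [])
      ∷ (3 ∷ 8 ∷ []) ∷ (1 ∷ 8 ∷ []) ∷ (2 ∷ 7 ∷ []) ∷ (6 ∷ 7 ∷ []) ∷ (0 ∷ 7 ∷ []) ∷ (0 ∷ 6 ∷ []) ∷ (4 ∷ 7 ∷ []) ∷ (4 ∷ 6 ∷ [])
      ∷ (0 ∷ 4 ∷ []) ∷ (4 ∷ 8 ∷ []) ∷ []
  ; neighbours = (5 ∷ 7 ∷ 3 ∷ 0 ∷ [])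
  ; apex-facets = (1 ∷ 2 ∷ 5 ∷ 6 ∷ []) }

table₁₁ : CapTable
table₁₁ = record
  { m = 6 ; nΨ = 6 ; nT₂ = 24
  ; points =
      (0 , + 4 ∷ + 1 ∷ + 1 ∷ + 0 ∷ + 1 ∷ []) ∷ (0 , + 1 ∷ + 1 ∷ + 0 ∷ + 1 ∷ + 0 ∷ []) ∷ (1 , + 6 ∷ + 3 ∷ + 2 ∷ + 2 ∷ + 0 ∷ [])
      ∷ (0 , + 2 ∷ + 0 ∷ + 0 ∷ + 0 ∷ + 1 ∷ []) ∷ (0 , + 6 ∷ + 2 ∷ + 5 ∷ + 0 ∷ + 0 ∷ []) ∷ (0 , + 3 ∷ + 0 ∷ + 4 ∷ + 1 ∷ + 0 ∷ [])
      ∷ (0 , + 5 ∷ + 0 ∷ + 2 ∷ + 5 ∷ + 1 ∷ []) ∷ []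
  ; facets =
      (3 , -[1+ 0 ] ∷ + 0 ∷ + 2 ∷ + 1 ∷ + 2 ∷ []) ∷ (0 , -[1+ 1 ] ∷ + 2 ∷ + 3 ∷ + 0 ∷ + 4 ∷ []) ∷ (3 , -[1+ 4 ] ∷ + 0 ∷ + 6 ∷ + 9 ∷ + 14 ∷ [])
      ∷ (3 , -[1+ 2 ] ∷ + 4 ∷ + 2 ∷ + 1 ∷ + 6 ∷ []) ∷ (0 , -[1+ 0 ] ∷ + 3 ∷ + 0 ∷ + 3 ∷ + 2 ∷ []) ∷ (0 , -[1+ 3 ] ∷ + 6 ∷ + 3 ∷ + 0 ∷ + 14 ∷ []) ∷ []
  ; apex-dual = (3 , + 5 ∷ + 0 ∷ -[1+ 5 ] ∷ -[1+ 8 ] ∷ -[1+ 9 ] ∷ [])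
  ; members =
      (1 ∷ 2 ∷ 3 ∷ 7 ∷ 9 ∷ 10 ∷ []) ∷ (0 ∷ 2 ∷ 3 ∷ 5 ∷ 7 ∷ []) ∷ (0 ∷ 1 ∷ 3 ∷ 4 ∷ 7 ∷ 8 ∷ []) ∷ (0 ∷ 1 ∷ 2 ∷ 5 ∷ 6 ∷ 8 ∷ 9 ∷ [])
      ∷ (0 ∷ 4 ∷ 5 ∷ 6 ∷ 7 ∷ []) ∷ (2 ∷ 5 ∷ 6 ∷ 7 ∷ 10 ∷ []) ∷ (0 ∷ 4 ∷ 6 ∷ 8 ∷ []) ∷ (4 ∷ 6 ∷ 7 ∷ 8 ∷ 9 ∷ 10 ∷ [])
      ∷ (1 ∷ 7 ∷ 8 ∷ 9 ∷ []) ∷ (2 ∷ 6 ∷ 9 ∷ 10 ∷ []) ∷ []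
  ; edges =
      (0 ∷ 4 ∷ []) ∷ (4 ∷ 6 ∷ []) ∷ (4 ∷ 7 ∷ []) ∷ (4 ∷ 8 ∷ []) ∷ (0 ∷ 5 ∷ []) ∷ (0 ∷ 6 ∷ []) ∷ (0 ∷ 7 ∷ []) ∷ (0 ∷ 8 ∷ [])
      ∷ (1 ∷ 7 ∷ []) ∷ (1 ∷ 8 ∷ []) ∷ (1 ∷ 9 ∷ []) ∷ (2 ∷ 5 ∷ []) ∷ (2 ∷ 6 ∷ []) ∷ (2 ∷ 7 ∷ []) ∷ (2 ∷ 9 ∷ []) ∷ (2 ∷ 10 ∷ [])
      ∷ (3 ∷ 7 ∷ []) ∷ (5 ∷ 6 ∷ []) ∷ (5 ∷ 7 ∷ []) ∷ (6 ∷ 7 ∷ []) ∷ (6 ∷ 8 ∷ []) ∷ (6 ∷ 9 ∷ []) ∷ (6 ∷ 10 ∷ []) ∷ (7 ∷ 8 ∷ [])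
      ∷ (7 ∷ 9 ∷ []) ∷ (7 ∷ 10 ∷ []) ∷ (8 ∷ 9 ∷ []) ∷ (9 ∷ 10 ∷ []) ∷ []
  ; edge-facets =
      (2 ∷ 4 ∷ 6 ∷ []) ∷ (4 ∷ 6 ∷ 7 ∷ []) ∷ (2 ∷ 4 ∷ 7 ∷ []) ∷ (2 ∷ 6 ∷ 7 ∷ []) ∷ (1 ∷ 3 ∷ 4 ∷ []) ∷ (3 ∷ 4 ∷ 6 ∷ [])
      ∷ (1 ∷ 2 ∷ 4 ∷ []) ∷ (2 ∷ 3 ∷ 6 ∷ []) ∷ (0 ∷ 2 ∷ 8 ∷ []) ∷ (2 ∷ 3 ∷ 8 ∷ []) ∷ (0 ∷ 3 ∷ 8 ∷ []) ∷ (1 ∷ 3 ∷ 5 ∷ [])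
      ∷ (3 ∷ 5 ∷ 9 ∷ []) ∷ (0 ∷ 1 ∷ 5 ∷ []) ∷ (0 ∷ 3 ∷ 9 ∷ []) ∷ (0 ∷ 5 ∷ 9 ∷ []) ∷ (0 ∷ 1 ∷ 2 ∷ []) ∷ (3 ∷ 4 ∷ 5 ∷ [])
      ∷ (1 ∷ 4 ∷ 5 ∷ []) ∷ (4 ∷ 5 ∷ 7 ∷ []) ∷ (3 ∷ 6 ∷ 7 ∷ []) ∷ (3 ∷ 7 ∷ 9 ∷ []) ∷ (5 ∷ 7 ∷ 9 ∷ []) ∷ (2 ∷ 7 ∷ 8 ∷ [])
      ∷ (0 ∷ 7 ∷ 8 ∷ []) ∷ (0 ∷ 5 ∷ 7 ∷ []) ∷ (3 ∷ 7 ∷ 8 ∷ []) ∷ (0 ∷ 7 ∷ 9 ∷ []) ∷ []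
  ; triangles =
      (0 ∷ 4 ∷ 6 ∷ []) ∷ (0 ∷ 4 ∷ 7 ∷ []) ∷ (0 ∷ 4 ∷ 8 ∷ []) ∷ (4 ∷ 6 ∷ 7 ∷ []) ∷ (4 ∷ 6 ∷ 8 ∷ []) ∷ (4 ∷ 7 ∷ 8 ∷ [])
      ∷ (0 ∷ 1 ∷ 8 ∷ []) ∷ (0 ∷ 2 ∷ 5 ∷ []) ∷ (0 ∷ 3 ∷ 7 ∷ []) ∷ (0 ∷ 5 ∷ 6 ∷ []) ∷ (0 ∷ 5 ∷ 7 ∷ []) ∷ (0 ∷ 6 ∷ 8 ∷ [])
      ∷ (1 ∷ 2 ∷ 9 ∷ []) ∷ (1 ∷ 3 ∷ 7 ∷ []) ∷ (1 ∷ 7 ∷ 8 ∷ []) ∷ (1 ∷ 7 ∷ 9 ∷ []) ∷ (1 ∷ 8 ∷ 9 ∷ []) ∷ (2 ∷ 3 ∷ 7 ∷ [])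
      ∷ (2 ∷ 5 ∷ 6 ∷ []) ∷ (2 ∷ 5 ∷ 7 ∷ []) ∷ (2 ∷ 6 ∷ 9 ∷ []) ∷ (2 ∷ 6 ∷ 10 ∷ []) ∷ (2 ∷ 7 ∷ 10 ∷ []) ∷ (2 ∷ 9 ∷ 10 ∷ [])
      ∷ (5 ∷ 6 ∷ 7 ∷ []) ∷ (6 ∷ 7 ∷ 10 ∷ []) ∷ (6 ∷ 8 ∷ 9 ∷ []) ∷ (6 ∷ 9 ∷ 10 ∷ []) ∷ (7 ∷ 8 ∷ 9 ∷ []) ∷ (7 ∷ 9 ∷ 10 ∷ []) ∷ []
  ; tri-facets =
      (4 ∷ 6 ∷ []) ∷ (2 ∷ 4 ∷ []) ∷ (2 ∷ 6 ∷ []) ∷ (4 ∷ 7 ∷ []) ∷ (6 ∷ 7 ∷ []) ∷ (2 ∷ 7 ∷ []) ∷ (2 ∷ 3 ∷ []) ∷ (1 ∷ 3 ∷ [])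
      ∷ (1 ∷ 2 ∷ []) ∷ (3 ∷ 4 ∷ []) ∷ (1 ∷ 4 ∷ []) ∷ (3 ∷ 6 ∷ []) ∷ (0 ∷ 3 ∷ []) ∷ (0 ∷ 2 ∷ []) ∷ (2 ∷ 8 ∷ []) ∷ (0 ∷ 8 ∷ [])
      ∷ (3 ∷ 8 ∷ []) ∷ (0 ∷ 1 ∷ []) ∷ (3 ∷ 5 ∷ []) ∷ (1 ∷ 5 ∷ []) ∷ (3 ∷ 9 ∷ []) ∷ (5 ∷ 9 ∷ []) ∷ (0 ∷ 5 ∷ []) ∷ (0 ∷ 9 ∷ [])
      ∷ (4 ∷ 5 ∷ []) ∷ (5 ∷ 7 ∷ []) ∷ (3 ∷ 7 ∷ []) ∷ (7 ∷ 9 ∷ []) ∷ (7 ∷ 8 ∷ []) ∷ (0 ∷ 7 ∷ []) ∷ []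
  ; neighbours = (6 ∷ 8 ∷ 7 ∷ 0 ∷ [])
  ; apex-facets = (2 ∷ 4 ∷ 6 ∷ 7 ∷ []) }

cap₉ cap₁₀ cap₁₁ : Cap
cap₉ = FromTable.cap table₉
cap₁₀ = FromTable.cap table₁₀
cap₁₁ = FromTable.cap table₁₁

-- The simplex with a distinguished vertex

module StandardSimplex where
  open Finₚ using (all?; any?; _≟_)

  edges : Vec (Vec (Fin 5) 2) 10
  edges = (0F ∷ 1F ∷ []) ∷ (0F ∷ 2F ∷ []) ∷ (0F ∷ 3F ∷ []) ∷ (0F ∷ 4F ∷ [])
    ∷ (1F ∷ 2F ∷ []) ∷ (1F ∷ 3F ∷ []) ∷ (1F ∷ 4F ∷ []) ∷ (2F ∷ 3F ∷ []) ∷ (2F ∷ 4F ∷ []) ∷ (3F ∷ 4F ∷ []) ∷ []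

  edge-facets : Vec (Vec (Fin 5) 3) 10
  edge-facets = (2F ∷ 3F ∷ 4F ∷ []) ∷ (1F ∷ 3F ∷ 4F ∷ []) ∷ (1F ∷ 2F ∷ 4F ∷ []) ∷ (1F ∷ 2F ∷ 3F ∷ [])
    ∷ (0F ∷ 3F ∷ 4F ∷ []) ∷ (0F ∷ 2F ∷ 4F ∷ []) ∷ (0F ∷ 2F ∷ 3F ∷ []) ∷ (0F ∷ 1F ∷ 4F ∷ []) ∷ (0F ∷ 1F ∷ 3F ∷ []) ∷ (0F ∷ 1F ∷ 2F ∷ []) ∷ []

  triangles : Vec (Vec (Fin 5) 3) 10
  triangles = (0F ∷ 1F ∷ 2F ∷ []) ∷ (0F ∷ 1F ∷ 3F ∷ []) ∷ (0F ∷ 1F ∷ 4F ∷ []) ∷ (0F ∷ 2F ∷ 3F ∷ []) ∷ (0F ∷ 2F ∷ 4F ∷ []) ∷ (0F ∷ 3F ∷ 4F ∷ [])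
    ∷ (1F ∷ 2F ∷ 3F ∷ []) ∷ (1F ∷ 2F ∷ 4F ∷ []) ∷ (1F ∷ 3F ∷ 4F ∷ []) ∷ (2F ∷ 3F ∷ 4F ∷ []) ∷ []

  tri-facets : Vec (Vec (Fin 5) 2) 10
  tri-facets = (3F ∷ 4F ∷ []) ∷ (2F ∷ 4F ∷ []) ∷ (2F ∷ 3F ∷ []) ∷ (1F ∷ 4F ∷ []) ∷ (1F ∷ 3F ∷ []) ∷ (1F ∷ 2F ∷ [])
    ∷ (0F ∷ 4F ∷ []) ∷ (0F ∷ 3F ∷ []) ∷ (0F ∷ 2F ∷ []) ∷ (0F ∷ 1F ∷ []) ∷ []

  end : Fin 10 → Fin 2 → Fin 5
  end e = lookup (lookup edges e)

  ef : Fin 10 → Fin 3 → Fin 5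
  ef e = lookup (lookup edge-facets e)

  tv : Fin 10 → Fin 3 → Fin 5
  tv t = lookup (lookup triangles t)

  tf : Fin 10 → Fin 2 → Fin 5
  tf t = lookup (lookup tri-facets t)

  -- The facet g is opposite to the vertex g.
  on : ∀ {v g} → g ≢ v → ⟨ unit g , unit v ⟩ ≡ 0ℚ
  on {v} {g} g≢v = ≡.trans (unit-⟨⟩ g (unit v)) (indicator-other g≢v)

  on⁻ : ∀ {v g} → ⟨ unit g , unit v ⟩ ≡ 0ℚ → g ≢ v
  on⁻ {v} eq refl = >⇒≢0 (ℚₚ.positive⁻¹ 1ℚ) (≡.trans (≡.sym (indicator-self v)) (≡.trans (≡.sym (unit-⟨⟩ v (unit v))) eq))

  away : Fin 5 → Q⁵
  away v j = 1ℚ ℚ.- indicator v j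

  tips : ∀ g → ∃[ t ] ∃[ s ] (tf t s ≡ g × g ≢ tf t (other s))
  tips = from-yes (all? λ g → any? λ t → any? λ s → (tf t s ≟ g) ×-dec ¬? (g ≟ tf t (other s)))

  cert : Cert
  cert = record
    { V = Fin 5 ; E = Fin 10 ; T = Fin 10 ; Φ = Fin 5
    ; enumV = ↔-id _ ; enumE = ↔-id _ ; enumT = ↔-id _ ; enumΦ = ↔-id _
    ; vert = unit ; fac = unit ; chart = λ _ → 1ℚ
    ; fac≥0 = λ g v → subst (0ℚ ℚ.≤_) (≡.sym (unit-⟨⟩ g (unit v))) (indicator-nonneg v g)
    ; chart>0 = λ v → subst (0ℚ ℚ.<_) (≡.sym (⟨⟩-unit (λ _ → 1ℚ) v)) (ℚₚ.positive⁻¹ 1ℚ)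
    ; vfun = away
    ; vfun-self = λ v → ≡.trans (⟨⟩-unit (away v) v) (cong (λ q → 1ℚ ℚ.- q) (indicator-self v))
    ; vfun-other = λ v u u≢v → subst (0ℚ ℚ.<_) (≡.sym (≡.trans (⟨⟩-unit (away v) u) (cong (λ q → 1ℚ ℚ.- q) (indicator-other u≢v)))) (ℚₚ.positive⁻¹ 1ℚ)
    ; out = id ; out∌ = λ v eq → on⁻ {v} {v} eq refl
    ; end = end ; tv = tv
    ; end-≢ = from-yes (all? λ e → ¬? (end e 0F ≟ end e 1F))
    ; end-set = λ e e′ p _ → from-yes (all? λ e → all? λ e′ → (all? λ k → any? λ l → end e k ≟ end e′ l) →-dec (e ≟ e′)) e e′ p
    ; tv-≢ = λ t {l} {m} → from-yes (all? λ t → all? λ l → all? λ m → ¬? (l ≟ m) →-dec ¬? (tv t l ≟ tv t m)) t l m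
    ; tv-set = λ t t′ p _ → from-yes (all? λ t → all? λ t′ → (all? λ k → any? λ l → tv t k ≟ tv t′ l) →-dec (t ≟ t′)) t t′ p
    ; ef = ef
    ; ef-≢ = λ e {i} {j} → from-yes (all? λ e → all? λ i → all? λ j → ¬? (i ≟ j) →-dec ¬? (ef e i ≟ ef e j)) e i j
    ; ef∋ = λ e i k → on {end e k} {ef e i} (from-yes (all? λ e → all? λ i → all? λ k → ¬? (ef e i ≟ end e k)) e i k)
    ; ef-all = λ e g h → from-yes (all? λ e → all? λ g → (all? λ k → ¬? (g ≟ end e k)) →-dec (any? λ i → g ≟ ef e i)) e g (λ k → on⁻ {end e k} {g} (h k))
    ; ef-three = λ e w h → from-yes (all? λ e → all? λ w → (all? λ i → ¬? (ef e i ≟ w)) →-dec (any? λ k → w ≟ end e k)) e w (λ i → on⁻ {w} {ef e i} (h i))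
    ; ef-two = λ e i j w _ _ _ → from-yes (all? λ e → all? λ w → (any? λ k → w ≟ end e k) ⊎-dec
        (any? λ t → (all? λ k → any? λ l → end e k ≟ tv t l) ×-dec (any? λ l → w ≟ tv t l) ×-dec
                    (all? λ l → (any? λ k → tv t l ≟ end e k) ⊎-dec (tv t l ≟ w)))) e w
    ; edge = λ u w _ _ u≢w _ _ _ _ _ → from-yes (all? λ u → all? λ w → ¬? (u ≟ w) →-dec
        (any? λ e → ((u ≟ end e 0F) ×-dec (w ≟ end e 1F)) ⊎-dec ((u ≟ end e 1F) ×-dec (w ≟ end e 0F)))) u w u≢w
    ; tf = tf
    ; tf-≢ = from-yes (all? λ t → ¬? (tf t 0F ≟ tf t 1F))
    ; tf∋ = λ t s l → on {tv t l} {tf t s} (from-yes (all? λ t → all? λ s → all? λ l → ¬? (tf t s ≟ tv t l)) t s l)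
    ; tf-all = λ t g h → from-yes (all? λ t → all? λ g → (all? λ l → ¬? (g ≟ tv t l)) →-dec (any? λ s → g ≟ tf t s)) t g (λ l → on⁻ {tv t l} {g} (h l))
    ; tf-two = λ t w h → from-yes (all? λ t → all? λ w → (all? λ s → ¬? (tf t s ≟ w)) →-dec (any? λ l → w ≟ tv t l)) t w (λ s → on⁻ {w} {tf t s} (h s))
    ; ef-adj = from-yes (all? λ e → all? λ i → all? λ j → ¬? (i ≟ j) →-dec
        (any? λ t → any? λ s → (tf t s ≟ ef e i) ×-dec (tf t (other s) ≟ ef e j)))
    ; base = λ g → proj₁ (tips g) ; side = λ g → proj₁ (proj₂ (tips g)) ; base-tf = λ g → proj₁ (proj₂ (proj₂ (tips g)))
    ; tip = λ g → tf (proj₁ (tips g)) (other (proj₁ (proj₂ (tips g))))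
    ; tip∈ = λ g → let t , s , _ , ne = tips g in on {tf t (other s)} {g} ne
    ; tip∉ = λ g eq → let t , s , _ = tips g in on⁻ {tf t (other s)} {tf t (other s)} eq refl }

  edges° : Vec (Vec (Fin 4) 2) 6
  edges° = (0F ∷ 1F ∷ []) ∷ (0F ∷ 2F ∷ []) ∷ (0F ∷ 3F ∷ []) ∷ (1F ∷ 2F ∷ []) ∷ (1F ∷ 3F ∷ []) ∷ (2F ∷ 3F ∷ []) ∷ []

  triangles° : Vec (Vec (Fin 4) 3) 4
  triangles° = (0F ∷ 1F ∷ 2F ∷ []) ∷ (0F ∷ 1F ∷ 3F ∷ []) ∷ (0F ∷ 2F ∷ 3F ∷ []) ∷ (1F ∷ 2F ∷ 3F ∷ []) ∷ []

  pointed : Open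
  pointed = record
    { C = cert ; fr = id ; ξ = unit ; fv = suc
    ; ξ-fv = λ i x → refl
    ; dual = λ a b → unit-⟨⟩ a (unit b)
    ; only = λ g eq → nonzero g (on⁻ {0F} {g} eq)
    ; two = λ u _ _ _ → u , refl
    ; V° = Fin 4 ; E° = Fin 6 ; T° = Fin 4 ; enumV° = ↔-id _ ; enumE° = ↔-id _ ; enumT° = ↔-id _
    ; up = suc ; up-inj = Finₚ.suc-injective ; up≢ = λ _ ()
    ; coverV = λ { zero ne → ⊥-elim (ne refl) ; (suc o) _ → o , refl }
    ; nb = id ; up-nb = λ _ → refl
    ; ιE = 4 ↑ʳ_ ; ιE-inj = λ {e} {e′} → Finₚ.↑ʳ-injective 4 e e′
    ; end° = λ e → lookup (lookup edges° e)
    ; up-end = from-yes (all? λ e → all? λ k → suc (lookup (lookup edges° e) k) ≟ end (4 ↑ʳ e) k)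
    ; coverE = from-yes (all? λ e → (all? λ k → ¬? (end e k ≟ 0F)) →-dec (any? λ e° → (4 ↑ʳ e°) ≟ e))
    ; ιT = 6 ↑ʳ_ ; ιT-inj = λ {t} {t′} → Finₚ.↑ʳ-injective 6 t t′
    ; tv° = λ t → lookup (lookup triangles° t)
    ; up-tv = from-yes (all? λ t → all? λ l → suc (lookup (lookup triangles° t) l) ≟ tv (6 ↑ʳ t) l)
    ; coverT = from-yes (all? λ t → (all? λ l → ¬? (tv t l ≟ 0F)) →-dec (any? λ t° → (6 ↑ʳ t°) ≟ t))
    ; countV = refl ; countE = refl ; countE° = refl }
    where
    nonzero : ∀ (g : Fin 5) → g ≢ 0F → ∃[ i ] g ≡ suc i
    nonzero zero ne = ⊥-elim (ne refl)
    nonzero (suc i) _ = i , refl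

-- The distinguished vertex is left out of the count `n`: a gluing uses it up and supplies another,
-- so a cap adds exactly `m`.
Realised : ℕ → Set₁
Realised n = Σ[ O ∈ Open ] Open.nV° O ≡ n

realised-glue : ∀ {n} (K : Cap) → Realised n → Realised (n ℕ.+ Cap.m K)
realised-glue K (O , refl) = Gluing.reopened O K , refl

-- The base cases represent 8, …, 11 as sums of 4, 5 and 6, the numbers of vertices added by the caps.
realised-from-12 : ∀ n → Realised (12 ℕ.+ n)
realised-from-12 zero = realised-glue cap₉ (realised-glue cap₉ (StandardSimplex.pointed , refl))
realised-from-12 (suc zero) = realised-glue cap₁₀ (realised-glue cap₉ (StandardSimplex.pointed , refl))
realised-from-12 (suc (suc zero)) = realised-glue cap₁₁ (realised-glue cap₉ (StandardSimplex.pointed , refl))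
realised-from-12 (suc (suc (suc zero))) = realised-glue cap₁₁ (realised-glue cap₁₀ (StandardSimplex.pointed , refl))
realised-from-12 (suc (suc (suc (suc n)))) = subst Realised (ℕₚ.+-comm (12 ℕ.+ n) 4) (realised-glue cap₉ (realised-from-12 n))

polytope : ∀ {n} → Realised n →
  Σ[ P ∈ Polytope 4 ] HasVertices P (suc n) × TwoSimple P × TwoSimplicial P × Elementary P
polytope (O , refl) = Faces.certified C (fr 0F) countV (≡.trans countE (cong (4 ℕ.*_) countV))
  where open Open O

theorem4p3 : (k : ℕ) → k ∈ (5 ∷ 9 ∷ 10 ∷ 11 ∷ []) ⊎ k ≥ 13 →
    Σ[ P ∈ Polytope 4 ] HasVertices P k × TwoSimple P × TwoSimplicial P × Elementary P
theorem4p3 _ (inj₁ (here refl)) = polytope (StandardSimplex.pointed , refl)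
theorem4p3 _ (inj₁ (there (here refl))) = polytope (realised-glue cap₉ (StandardSimplex.pointed , refl))
theorem4p3 _ (inj₁ (there (there (here refl)))) = polytope (realised-glue cap₁₀ (StandardSimplex.pointed , refl))
theorem4p3 _ (inj₁ (there (there (there (here refl))))) = polytope (realised-glue cap₁₁ (StandardSimplex.pointed , refl))
theorem4p3 k (inj₂ k≥13) = subst (λ k → Σ[ P ∈ Polytope 4 ] HasVertices P k × TwoSimple P × TwoSimplicial P × Elementary P)
  (ℕₚ.m+[n∸m]≡n k≥13) (polytope (realised-from-12 (k ℕ.∸ 13)))
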